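{- There exists a positive integer $c$ such that for every prime power $q\geq c$ and every positive integer $n$ satisfying either (1) $n$ is odd and $q\leq n\leq q^2$, or (2) $n$ is even, $q-1\nmid n$, and $q\leq n\leq 0.43\cdot q^2$, there exists an element of $\mathbb{F}_{q^n}$ that is simultaneously primitive and completely normal over $\mathbb{F}_q$.
   Context: $\mathbb{F}_{q^n}$ denotes the degree-$n$ extension of the finite field $\mathbb{F}_q$. An element is primitive if it generates the cyclic group $\mathbb{F}_{q^n}^*$. For a divisor $l$ of $n$, an element $x\in\mathbb{F}_{q^n}$ is normal over $\mathbb{F}_{q^l}$ if $\{x, x^{q^l}, x^{q^{2l}},\ldots, x^{q^{l(n/l-1)}}\}$ is an $\mathbb{F}_{q^l}$-basis of $\mathbb{F}_{q^n}$. An element $x\in\mathbb{F}_{q^n}$ is completely normal over $\mathbb{F}_q$ if it is normal over $\mathbb{F}_{q^l}$ for every positive divisor $l$ of $n$. -}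

module Defs where

open import Level using (0ℓ)
open import Data.Nat using (ℕ; zero; suc; _^_; _≤_)
open import Data.Nat.Primality using (Prime)
open import Data.Fin using (Fin)
open import Data.Product using (Σ; ∃; _×_)
open import Relation.Nullary using (¬_)
open import Algebra.Bundles using (CommutativeRing)
open import Function.Bundles using (Inverse)
import Relation.Binary.PropositionalEquality as ≡

IsPrimePower : ℕ → Set
IsPrimePower q = Σ ℕ λ p → Σ ℕ λ k → Prime p × 1 ≤ k × q ≡.≡ p ^ k

record FiniteField (card : ℕ) : Set₁ where
  field
    commRing : CommutativeRing 0ℓ 0ℓ
  open CommutativeRing commRing public
  field
    1≉0     : ¬ (1# ≈ 0#)
    inverse : ∀ x → ¬ (x ≈ 0#) → ∃ λ y → x * y ≈ 1#
    count   : Inverse setoid (≡.setoid (Fin card))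

module _ {card : ℕ} (F : FiniteField card) where
  open FiniteField F

  pow : Carrier → ℕ → Carrier
  pow x zero    = 1#
  pow x (suc k) = x * pow x k

  sumF : (m : ℕ) → (Fin m → Carrier) → Carrier
  sumF zero    f = 0#
  sumF (suc m) f = f Fin.zero + sumF m (λ i → f (Fin.suc i))
    where import Data.Fin as Fin

  Primitive : Carrier → Set
  Primitive x = ¬ (x ≈ 0#) × (∀ y → ¬ (y ≈ 0#) → ∃ λ k → pow x k ≈ y)

  -- a ∈ F_{q^l}, the subfield of elements fixed by the q^l-Frobenius
  InSubfield : (q l : ℕ) → Carrier → Set
  InSubfield q l a = pow a (q ^ l) ≈ a

  -- x is normal over F_{q^l}, where n = l * m:
  -- {x, x^{q^l}, ..., x^{q^{l(m-1)}}} is an F_{q^l}-basis of F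
  -- (linearly independent over F_{q^l} and spanning F over F_{q^l}).
  NormalOver : (q l m : ℕ) → Carrier → Set
  NormalOver q l m x =
    ((a : Fin m → Carrier) → (∀ i → InSubfield q l (a i)) →
       sumF m (λ i → a i * pow x (q ^ (l ℕ.* Data.Fin.toℕ i))) ≈ 0# →
       ∀ i → a i ≈ 0#)
    × (∀ y → ∃ λ (a : Fin m → Carrier) → (∀ i → InSubfield q l (a i)) ×
         (sumF m (λ i → a i * pow x (q ^ (l ℕ.* Data.Fin.toℕ i))) ≈ y))
    where import Data.Nat as ℕ
          import Data.Fin

  CompletelyNormal : (q n : ℕ) → Carrier → Set
  CompletelyNormal q n x =
    ∀ l m → l Data.Nat.* m ≡.≡ n → NormalOver q l m x
    where import Data.Nat

{-# OPTIONS --safe #-}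

-- Write Q = qⁿ, K_l for the subfield with q^l elements, and orthogonality for the trace form over F_q.
-- An element x is not normal over K_l exactly when it is orthogonal to some simple K_l[Frob^l]-submodule M of
-- the field. For fixed l these submodules are independent, because the minimal polynomial of M, evaluated at
-- Frob^l, is a polynomial function of degree |M| and so has kernel M; hence the product of their sizes is at most
-- Q. Among those for l = 1 there are at most gcd(n, q - 1) lines, since the lines lie in the fixed field of
-- Frob^gcd(n, q - 1).
--
-- The e-th roots of unity H_e (e | Q - 1) are equidistributed with respect to orthogonal complements:
-- |H_e ∩ M^⊥| = e/|M| + O(√(qQ)). This needs no characters: the indicator of M^⊥ is an average over z ∈ M of the
-- functions w(Tr(z x)), w(t) = q[t = 0] - 1, and the sums of w(Tr(z x)) over H_e are bounded by their second moment
-- in z, in which only proportional pairs contribute.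
--
-- Inclusion-exclusion over the primes dividing Q - 1 and over the simple modules for l = 1, together with the union
-- bound for l ≥ 2, then counts primitive completely normal elements. The density is about
-- (1 - 1/q)^#lines (1 - n/2q²), minus n/2q² for l = 2 when n is even, minus O(1/q); it is bounded below by a
-- positive constant, while the number of terms times √(qQ) is of smaller order than Q because the number ω of
-- primes dividing Q - 1 satisfies 256^ω ≤ 256^256 Q.

module Submission where

open import Level using (0ℓ)
open import Algebra.Bundles using (AbelianGroup; CommutativeRing; RawRing)
open import Algebra.Morphism.Structures using (IsRingMonomorphism)
open import Algebra.Structures using (IsCommutativeRing)
open import Data.Fin as Fin using (Fin)
open import Data.Fin.Permutation using (permutation)
open import Data.Integer.Tactic.RingSolver using (solve-∀)
open import Data.List using (List; []; _∷_; _++_; length; map; take; drop; allFin)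
open import Data.List.Membership.Propositional using (_∈_)
open import Data.List.Membership.Propositional.Properties using (∈-allFin)
open import Data.List.Properties using (++-identityʳ; length-++; length-drop; length-map; length-take; map-++; take++drop≡id)
open import Data.List.Relation.Unary.All as All using (All; []; _∷_)
open import Data.List.Relation.Unary.AllPairs using (AllPairs; []; _∷_)
open import Data.List.Relation.Unary.Any as Any using (Any; here; there)
open import Data.Maybe using (Maybe; just; nothing)
open import Data.Nat as ℕ using (ℕ; zero; suc; _!)
open import Data.Nat.Combinatorics using (nCn≡1; k![n∸k]!∣n!) renaming (_C_ to _choose_)
open import Data.Nat.Combinatorics.Specification using (nCk≡n!/k![n-k]!)
open import Data.Nat.Divisibility using (_∣_; _∣?_; divides; m∣m*n; ∣⇒≤; 1∣_)
open import Data.Nat.DivMod using (m/n*n≡m)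
open import Data.Nat.GCD using (gcd; gcd-GCD; gcd[m,n]∣m; gcd[m,n]∣n; gcd[m,n]≡0⇒m≡0; module Bézout)
open import Data.Nat.ListAction using (product)
open import Data.Nat.Primality using (Prime; prime?; euclidsLemma; prime⇒irreducible; prime⇒nonTrivial; prime⇒nonZero; ¬prime[0]; ¬prime[1])
open import Data.Nat.Primality.Factorisation using (PrimeFactorisation; factorise)
open import Data.Nat.Solver using (module +-*-Solver)
open import Data.Product using (Σ; ∃; _×_; _,_; proj₁; proj₂)
open import Data.Sum using (_⊎_; inj₁; inj₂; [_,_]′)
open import Data.Unit using (tt)
open import Function using (_∘_)
open import Function.Bundles using (Inverse)
open import Relation.Binary.PropositionalEquality as ≡ using (_≡_; _≢_; refl; sym; trans; cong; cong₂; subst; module ≡-Reasoning)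
open import Relation.Nullary using (¬_; Dec; yes; no; contradiction; _×-dec_; _→-dec_; ¬?)
import Algebra.Morphism.RingMonomorphism
import Algebra.Properties.CommutativeMonoid.Sum
import Algebra.Properties.CommutativeSemiring.Binomial
import Algebra.Properties.Group
import Algebra.Properties.Ring
import Algebra.Properties.Semiring.Exp
import Algebra.Properties.Semiring.Mult
import Algebra.Properties.Semiring.Sum
import Algebra.Solver.Ring
import Algebra.Solver.Ring.AlmostCommutativeRing as ACR
import Data.Fin.Properties as FinP
open import Data.Integer as ℤ using (ℤ)
import Data.Integer.Properties as ℤP
import Data.List.Relation.Unary.All.Properties as AllP
import Data.List.Relation.Unary.Any.Properties as AnyP
import Data.Nat.Properties as ℕP
import Relation.Binary.Definitions as Tri
import Relation.Binary.Reasoning.Setoid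
open ℤP using (≤-refl; ≤-trans; ≤-reflexive)

-- Independence holds only among modules for the same l, so only l = 1 is sieved exactly. There a
-- union bound would fail: q - 1 lines of density 1/q each nearly exhaust it, whereas the product (1
-- - 1/q)^(q-1) stays above 1/4. For l ≥ 2 a module has density at most q^(-l), and n ≤ q² makes all
-- l ≥ 3 together contribute O(1/q); only l = 2 costs a constant. The hypothesis that q - 1 does not
-- divide n halves the possible number of lines, which pays for l = 2 when n is even. All counts
-- stay in the integers: a density 1/d enters as d - 1 against d, √(qQ) is replaced by a power T of
-- q with qQ ≤ T², and roots are avoided by comparing fourth powers. The sieve runs over all subsets
-- of up to n modules and ω primes, so its error has order 2ⁿ 2^ω √(qQ), up to one more factor 2^ω
-- from the primes; this is small against Q once q ≥ 2^20 and n ≥ q.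

module IntegerCoefficients (R : CommutativeRing 0ℓ 0ℓ) where
  open CommutativeRing R renaming (refl to ≈-refl; sym to ≈-sym; trans to ≈-trans)
  open Algebra.Properties.Ring ring
  open Algebra.Properties.Semiring.Mult semiring using (×-homo-+; ×1-homo-*) renaming (_×_ to _·_)
  open Relation.Binary.Reasoning.Setoid setoid
  open import Data.Integer using (+_; -[1+_])

  -- Integer coefficients have negatives and decidable equality, so the ring solver can cancel terms
  -- in any commutative ring.
  ⟦_⟧ℤ : ℤ → Carrier
  ⟦ + n ⟧ℤ      = n · 1#
  ⟦ -[1+ n ] ⟧ℤ = - (suc n · 1#)

  ⟦-⟧ℤ : ∀ i → ⟦ ℤ.- i ⟧ℤ ≈ - ⟦ i ⟧ℤ
  ⟦-⟧ℤ (+ zero)  = ≈-sym -0#≈0#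
  ⟦-⟧ℤ (+ suc n) = ≈-refl
  ⟦-⟧ℤ -[1+ n ]  = ≈-sym (-‿involutive _)

  ⟦⊖⟧ℤ : ∀ m n → ⟦ m ℤ.⊖ n ⟧ℤ ≈ m · 1# + - (n · 1#)
  ⟦⊖⟧ℤ m       zero    = ≈-sym (≈-trans (+-congˡ -0#≈0#) (+-identityʳ _))
  ⟦⊖⟧ℤ zero    (suc n) = ≈-sym (+-identityˡ _)
  ⟦⊖⟧ℤ (suc m) (suc n) = begin
    ⟦ suc m ℤ.⊖ suc n ⟧ℤ  ≡⟨ ≡.cong ⟦_⟧ℤ (ℤP.[1+m]⊖[1+n]≡m⊖n m n) ⟩
    ⟦ m ℤ.⊖ n ⟧ℤ  ≈⟨ ⟦⊖⟧ℤ m n ⟩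
    a + - b  ≈⟨ +-congʳ (+-identityʳ a) ⟨
    (a + 0#) + - b  ≈⟨ +-congʳ (+-congˡ (-‿inverseʳ 1#)) ⟨
    (a + (1# + - 1#)) + - b  ≈⟨ +-congʳ (+-assoc _ _ _) ⟨
    ((a + 1#) + - 1#) + - b  ≈⟨ +-assoc _ _ _ ⟩
    (a + 1#) + (- 1# + - b)  ≈⟨ +-cong (+-comm a 1#) (-‿+-comm 1# b) ⟩
    (1# + a) + - (1# + b)  ∎
    where a = m · 1#
          b = n · 1#

  ⟦+⟧ℤ : ∀ i j → ⟦ i ℤ.+ j ⟧ℤ ≈ ⟦ i ⟧ℤ + ⟦ j ⟧ℤ
  ⟦+⟧ℤ (+ m)    (+ n)    = ×-homo-+ 1# m n
  ⟦+⟧ℤ (+ m)    -[1+ n ] = ⟦⊖⟧ℤ m (suc n)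
  ⟦+⟧ℤ -[1+ m ] (+ n)    = ≈-trans (⟦⊖⟧ℤ n (suc m)) (+-comm _ _)
  ⟦+⟧ℤ -[1+ m ] -[1+ n ] = begin
    - (suc (suc (m ℕ.+ n)) · 1#)  ≡⟨ ≡.cong (λ k → - (suc k · 1#)) (ℕP.+-suc m n) ⟨
    - ((suc m ℕ.+ suc n) · 1#)  ≈⟨ -‿cong (×-homo-+ 1# (suc m) (suc n)) ⟩
    - (suc m · 1# + suc n · 1#)  ≈⟨ -‿+-comm _ _ ⟨
    - (suc m · 1#) + - (suc n · 1#)  ∎

  ⟦*⟧ℕ : ∀ m n → ⟦ + m ℤ.* + n ⟧ℤ ≈ m · 1# * n · 1#
  ⟦*⟧ℕ m n = ≈-trans (reflexive (≡.cong ⟦_⟧ℤ (≡.sym (ℤP.pos-* m n)))) (×1-homo-* m n)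

  ⟦*⟧ℤ : ∀ i j → ⟦ i ℤ.* j ⟧ℤ ≈ ⟦ i ⟧ℤ * ⟦ j ⟧ℤ
  ⟦*⟧ℤ (+ m)    (+ n)    = ⟦*⟧ℕ m n
  ⟦*⟧ℤ (+ m)    -[1+ n ] = begin
    ⟦ + m ℤ.* -[1+ n ] ⟧ℤ  ≡⟨ ≡.cong ⟦_⟧ℤ (ℤP.neg-distribʳ-* (+ m) (+ suc n)) ⟨
    ⟦ ℤ.- (+ m ℤ.* + suc n) ⟧ℤ  ≈⟨ ⟦-⟧ℤ (+ m ℤ.* + suc n) ⟩
    - ⟦ + m ℤ.* + suc n ⟧ℤ  ≈⟨ -‿cong (⟦*⟧ℕ m (suc n)) ⟩
    - (m · 1# * suc n · 1#)  ≈⟨ -‿distribʳ-* _ _ ⟩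
    m · 1# * - (suc n · 1#)  ∎
  ⟦*⟧ℤ -[1+ m ] (+ n)    = begin
    ⟦ -[1+ m ] ℤ.* + n ⟧ℤ  ≡⟨ ≡.cong ⟦_⟧ℤ (ℤP.neg-distribˡ-* (+ suc m) (+ n)) ⟨
    ⟦ ℤ.- (+ suc m ℤ.* + n) ⟧ℤ  ≈⟨ ⟦-⟧ℤ (+ suc m ℤ.* + n) ⟩
    - ⟦ + suc m ℤ.* + n ⟧ℤ  ≈⟨ -‿cong (⟦*⟧ℕ (suc m) n) ⟩
    - (suc m · 1# * n · 1#)  ≈⟨ -‿distribˡ-* _ _ ⟩
    - (suc m · 1#) * n · 1#  ∎
  ⟦*⟧ℤ -[1+ m ] -[1+ n ] = begin
    (suc m ℕ.* suc n) · 1#  ≈⟨ ×1-homo-* (suc m) (suc n) ⟩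
    suc m · 1# * suc n · 1#  ≈⟨ -‿involutive _ ⟨
    - - (suc m · 1# * suc n · 1#)  ≈⟨ -‿cong (-‿distribˡ-* _ _) ⟩
    - (- (suc m · 1#) * suc n · 1#)  ≈⟨ -‿distribʳ-* _ _ ⟩
    - (suc m · 1#) * - (suc n · 1#)  ∎

  coefficients : RawRing 0ℓ 0ℓ
  coefficients = CommutativeRing.rawRing ℤP.+-*-commutativeRing

  morphism : coefficients ACR.-Raw-AlmostCommutative⟶ ACR.fromCommutativeRing R
  morphism = record
    { ⟦_⟧ = ⟦_⟧ℤ ; +-homo = ⟦+⟧ℤ ; *-homo = ⟦*⟧ℤ ; -‿homo = ⟦-⟧ℤ
    ; 0-homo = ≈-refl ; 1-homo = +-identityʳ 1# }

  _coeff≟_ : ∀ i j → Maybe (⟦ i ⟧ℤ ≈ ⟦ j ⟧ℤ)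
  i coeff≟ j with i ℤ.≟ j
  ... | yes i≡j = just (reflexive (≡.cong ⟦_⟧ℤ i≡j))
  ... | no  _   = nothing

  open Algebra.Solver.Ring coefficients (ACR.fromCommutativeRing R) morphism _coeff≟_ public
    using (solve; _:=_; _:+_; _:*_; _:-_; :-_; con)

-- Integer sums over finite sets, and indicators.

module FiniteSums where
  open import Data.Integer using (+_; -[1+_]; 0ℤ; 1ℤ; _+_; _*_; -_; _-_; _≤_; _<_; +≤+; +<+)
  module Sum = Algebra.Properties.Semiring.Sum ℤP.+-*-semiring

  private variable
    n m : ℕ

  opaque
    ∑ : ∀ {n} → (Fin n → ℤ) → ℤ
    ∑ = Sum.sum

    ∑-suc : (f : Fin (suc n) → ℤ) → ∑ f ≡ f Fin.zero + ∑ (f ∘ Fin.suc)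
    ∑-suc f = refl

    ∑-cong : {f g : Fin n → ℤ} → (∀ i → f i ≡ g i) → ∑ f ≡ ∑ g
    ∑-cong = Sum.sum-cong-≗

    ∑-+ : (f g : Fin n → ℤ) → ∑ (λ i → f i + g i) ≡ ∑ f + ∑ g
    ∑-+ = Sum.∑-distrib-+

    ∑-*ˡ : ∀ c (f : Fin n → ℤ) → ∑ (λ i → c * f i) ≡ c * ∑ f
    ∑-*ˡ c f = sym (Sum.*-distribˡ-sum c f)

    ∑-*ʳ : ∀ c (f : Fin n → ℤ) → ∑ (λ i → f i * c) ≡ ∑ f * c
    ∑-*ʳ c f = sym (Sum.*-distribʳ-sum c f)

    ∑-swap : (f : Fin m → Fin n → ℤ) → ∑ (λ i → ∑ (f i)) ≡ ∑ (λ j → ∑ (λ i → f i j))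
    ∑-swap = Sum.∑-comm

    ∑-reindex : (f : Fin n → ℤ) (φ : Fin m → Fin n) (ψ : Fin n → Fin m) →
                (∀ i → φ (ψ i) ≡ i) → (∀ i → ψ (φ i) ≡ i) → ∑ (f ∘ φ) ≡ ∑ f
    ∑-reindex f φ ψ φψ ψφ = sym (Sum.sum-permute f (permutation φ ψ φψ ψφ))

    ∑-const : ∀ n c → ∑ {n} (λ _ → c) ≡ + n * c
    ∑-const zero    c = sym (ℤP.*-zeroˡ c)
    ∑-const (suc n) c = trans (cong (λ s → c + s) (∑-const n c)) (sym (ℤP.suc-* (+ n) c))

  opaque
    unfolding ∑
    ∑-mono : {f g : Fin n → ℤ} → (∀ i → f i ≤ g i) → ∑ f ≤ ∑ g
    ∑-mono {zero}  h = ≤-refl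
    ∑-mono {suc n} h = ℤP.+-mono-≤ (h Fin.zero) (∑-mono (h ∘ Fin.suc))

  ∑-0 : {f : Fin n → ℤ} → (∀ i → f i ≡ 0ℤ) → ∑ f ≡ 0ℤ
  ∑-0 {n} h = trans (∑-cong h) (trans (∑-const n 0ℤ) (ℤP.*-zeroʳ (+ n)))

  ∑-nonneg : {f : Fin n → ℤ} → (∀ i → 0ℤ ≤ f i) → 0ℤ ≤ ∑ f
  ∑-nonneg h = ≤-trans (≤-reflexive (sym (∑-0 {f = λ _ → 0ℤ} (λ _ → refl)))) (∑-mono h)

  opaque
    unfolding ∑
    term≤∑ : {f : Fin n → ℤ} → (∀ i → 0ℤ ≤ f i) → ∀ i → f i ≤ ∑ f
    term≤∑ {suc n} {f} h Fin.zero    = subst (_≤ ∑ f) (ℤP.+-identityʳ _) (ℤP.+-monoʳ-≤ (f Fin.zero) (∑-nonneg (h ∘ Fin.suc)))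
    term≤∑ {suc n} {f} h (Fin.suc i) = subst (_≤ ∑ f) (ℤP.+-identityˡ _) (ℤP.+-mono-≤ (h Fin.zero) (term≤∑ (h ∘ Fin.suc) i))

  ∑≤0⇒term≡0 : {f : Fin n → ℤ} → (∀ i → 0ℤ ≤ f i) → ∑ f ≤ 0ℤ → ∀ i → f i ≡ 0ℤ
  ∑≤0⇒term≡0 h s i = ℤP.≤-antisym (≤-trans (term≤∑ h i) s) (h i)

  ∑-positive : (f : Fin n → ℤ) → 0ℤ < ∑ f → ∃ λ i → 0ℤ < f i
  ∑-positive f s with FinP.any? (λ i → 0ℤ ℤP.<? f i)
  ... | yes p = p
  ... | no ¬p = contradiction s (ℤP.≤⇒≯ (≤-trans (∑-mono (λ i → ℤP.≮⇒≥ (λ q → ¬p (i , q)))) (≤-reflexive (∑-0 {f = λ _ → 0ℤ} (λ _ → refl)))))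

  ind : ∀ {a} {P : Set a} → Dec P → ℤ
  ind (yes _) = 1ℤ
  ind (no  _) = 0ℤ

  private variable
    P P′ : Set

  ind-yes : (d : Dec P) → P → ind d ≡ 1ℤ
  ind-yes (yes _) p = refl
  ind-yes (no ¬p) p = contradiction p ¬p

  ind-no : (d : Dec P) → ¬ P → ind d ≡ 0ℤ
  ind-no (yes p) ¬p = contradiction p ¬p
  ind-no (no _)  ¬p = refl

  0≤ind : (d : Dec P) → 0ℤ ≤ ind d
  0≤ind (yes _) = +≤+ ℕ.z≤n
  0≤ind (no _)  = ≤-refl

  ind≤1 : (d : Dec P) → ind d ≤ 1ℤ
  ind≤1 (yes _) = ≤-refl
  ind≤1 (no _)  = +≤+ ℕ.z≤n

  ind-mono : (d : Dec P) (d′ : Dec P′) → (P → P′) → ind d ≤ ind d′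
  ind-mono (yes p) d′ f = ≤-reflexive (sym (ind-yes d′ (f p)))
  ind-mono (no _)  d′ f = 0≤ind d′

  ind-cong : (d : Dec P) (d′ : Dec P′) → (P → P′) → (P′ → P) → ind d ≡ ind d′
  ind-cong d d′ f g = ℤP.≤-antisym (ind-mono d d′ f) (ind-mono d′ d g)

  ind-× : (d : Dec P) (d′ : Dec P′) → ind d * ind d′ ≡ ind (d ×-dec d′)
  ind-× (yes p) (yes q) = refl
  ind-× (yes p) (no q)  = refl
  ind-× (no p)  (yes q) = refl
  ind-× (no p)  (no q)  = refl

  ind-* : ∀ {Q : Set} (d : Dec P) (d′ : Dec P′) (e : Dec Q) → (P → P′ → Q) → (Q → P × P′) → ind d * ind d′ ≡ ind e
  ind-* d d′ e f g = trans (ind-× d d′) (ind-cong (d ×-dec d′) e (λ (p , q) → f p q) g)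

  opaque
    unfolding ∑
    ∑-δ : (a : Fin n) (f : Fin n → ℤ) → ∑ (λ x → ind (x FinP.≟ a) * f x) ≡ f a
    ∑-δ Fin.zero    f = trans (cong₂ _+_ (ℤP.*-identityˡ (f Fin.zero)) (∑-0 (λ i → cong (_* f (Fin.suc i)) (ind-no (Fin.suc i FinP.≟ Fin.zero) (λ ()))))) (ℤP.+-identityʳ _)
    ∑-δ (Fin.suc a) f = trans (ℤP.+-identityˡ _) (trans (∑-cong (λ i → cong (_* f (Fin.suc i)) (ind-cong (Fin.suc i FinP.≟ Fin.suc a) (i FinP.≟ a) FinP.suc-injective (cong Fin.suc)))) (∑-δ a (f ∘ Fin.suc)))

  *-monoˡ : ∀ {a b c} → 0ℤ ≤ a → b ≤ c → a * b ≤ a * c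
  *-monoˡ {a} 0≤a = ℤP.*-monoˡ-≤-nonNeg a {{ℤ.nonNegative 0≤a}}

  *-monoʳ : ∀ {a b c} → 0ℤ ≤ a → b ≤ c → b * a ≤ c * a
  *-monoʳ {a} 0≤a = ℤP.*-monoʳ-≤-nonNeg a {{ℤ.nonNegative 0≤a}}

  *-nonneg : ∀ {a b} → 0ℤ ≤ a → 0ℤ ≤ b → 0ℤ ≤ a * b
  *-nonneg {a} {b} 0≤a 0≤b = subst (_≤ a * b) (ℤP.*-zeroʳ a) (*-monoˡ {a} {0ℤ} {b} 0≤a 0≤b)

  +-nonneg : ∀ {a b} → 0ℤ ≤ a → 0ℤ ≤ b → 0ℤ ≤ a + b
  +-nonneg = ℤP.+-mono-≤

  square-nonneg : ∀ a → 0ℤ ≤ a * a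
  square-nonneg (+ n)    = *-nonneg {+ n} {+ n} (+≤+ ℕ.z≤n) (+≤+ ℕ.z≤n)
  square-nonneg -[1+ n ] = +≤+ ℕ.z≤n

  ≤-from-difference : ∀ {a b} s → b - a ≡ s → 0ℤ ≤ s → a ≤ b
  ≤-from-difference s eq 0≤s = ℤP.0≤i-j⇒j≤i (subst (0ℤ ≤_) (sym eq) 0≤s)

  difference : ∀ {a b} → a ≤ b → 0ℤ ≤ b - a
  difference = ℤP.i≤j⇒0≤j-i

  -- The bound |a - b| ≤ e without absolute values.
  Near : ℤ → ℤ → ℤ → Set
  Near e a b = a ≤ b + e × b ≤ a + e

  square-cancel-≤ : ∀ {a b} → 0ℤ ≤ b → a * a ≤ b * b → a ≤ b
  square-cancel-≤ {a} {b} 0≤b h with a ℤP.≤? b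
  ... | yes p = p
  ... | no ¬p = contradiction h (ℤP.<⇒≱ (ℤP.≤-<-trans (*-monoʳ {b} 0≤b (ℤP.<⇒≤ b<a)) (ℤP.*-monoˡ-<-pos a {{ℤ.positive (ℤP.≤-<-trans 0≤b b<a)}} b<a)))
    where b<a = ℤP.≰⇒> ¬p

  +-cancelˡ : ∀ a b c → a + b ≡ a + c → b ≡ c
  +-cancelˡ = Algebra.Properties.Group.∙-cancelˡ (AbelianGroup.group ℤP.+-0-abelianGroup)

  pos-*-≤ : ∀ a b c d → a ℕ.* b ℕ.≤ c ℕ.* d → + a * + b ≤ + c * + d
  pos-*-≤ a b c d h = subst (_≤ + c * + d) (ℤP.pos-* a b) (subst (+ (a ℕ.* b) ≤_) (ℤP.pos-* c d) (+≤+ h))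

-- With `Fin Q` itself as carrier, equality is propositional and every predicate quantifying over
-- elements is decided by search. An arbitrary `FiniteField` is brought to this form in `Transport`.
record FinField (Q : ℕ) : Set where
  infixl 6 _⊕_
  infixl 7 _⊗_
  infix  8 ⊖_
  field
    _⊕_ _⊗_ : Fin Q → Fin Q → Fin Q
    ⊖_      : Fin Q → Fin Q
    0# 1#   : Fin Q
    isCommutativeRing : IsCommutativeRing _≡_ _⊕_ _⊗_ ⊖_ 0# 1#
    1≢0     : 1# ≢ 0#
    inverse : ∀ x → x ≢ 0# → ∃ λ y → x ⊗ y ≡ 1#

-- Field arithmetic, polynomial functions and their roots.

module FieldBasics {Q : ℕ} (F : FinField Q) where
  open import Data.Integer using (+_; -[1+_]; 0ℤ; 1ℤ; _+_; _*_; -_; _-_; _≤_; _<_; +≤+; +<+)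
  open FiniteSums
  open FinField F public

  A : Set
  A = Fin Q

  commutativeRing : CommutativeRing 0ℓ 0ℓ
  commutativeRing = record { isCommutativeRing = isCommutativeRing }

  module R = CommutativeRing commutativeRing
  open IntegerCoefficients commutativeRing public using (solve; _:=_; _:+_; _:*_; _:-_; :-_)
  module RP = Algebra.Properties.Ring R.ring

  infixl 6 _⊝_
  _⊝_ : A → A → A
  x ⊝ y = x ⊕ ⊖ y

  infix 4 _≟_
  _≟_ : (x y : A) → Dec (x ≡ y)
  _≟_ = FinP._≟_

  ⊝≡0⇒≡ : ∀ {x y} → x ⊝ y ≡ 0# → x ≡ y
  ⊝≡0⇒≡ {x} {y} = RP.x∙y⁻¹≈ε⇒x≈y x y

  ≡⇒⊝≡0 : ∀ {x y} → x ≡ y → x ⊝ y ≡ 0#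
  ≡⇒⊝≡0 {x} refl = R.-‿inverseʳ x

  ⊗-cancelˡ : ∀ {x y z} → x ≢ 0# → x ⊗ y ≡ x ⊗ z → y ≡ z
  ⊗-cancelˡ {x} {y} {z} x≢0 eq = let (x′ , xx′) = inverse x x≢0 in
    begin
      y  ≡⟨ R.*-identityˡ y ⟨
      1# ⊗ y  ≡⟨ cong (_⊗ y) (trans (R.*-comm x′ x) xx′) ⟨
      x′ ⊗ x ⊗ y  ≡⟨ R.*-assoc x′ x y ⟩
      x′ ⊗ (x ⊗ y)  ≡⟨ cong (x′ ⊗_) eq ⟩
      x′ ⊗ (x ⊗ z)  ≡⟨ R.*-assoc x′ x z ⟨
      x′ ⊗ x ⊗ z  ≡⟨ cong (_⊗ z) (trans (R.*-comm x′ x) xx′) ⟩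
      1# ⊗ z  ≡⟨ R.*-identityˡ z ⟩
      z  ∎
    where open ≡-Reasoning

  ⊗≡0 : ∀ {x y} → x ⊗ y ≡ 0# → x ≡ 0# ⊎ y ≡ 0#
  ⊗≡0 {x} {y} eq with x ≟ 0#
  ... | yes p = inj₁ p
  ... | no ¬p = inj₂ (⊗-cancelˡ ¬p (trans eq (sym (R.zeroʳ x))))

  ⊗≢0 : ∀ {x y} → x ≢ 0# → y ≢ 0# → x ⊗ y ≢ 0#
  ⊗≢0 x≢0 y≢0 eq with ⊗≡0 eq
  ... | inj₁ p = x≢0 p
  ... | inj₂ p = y≢0 p

  pow : A → ℕ → A
  pow x zero    = 1#
  pow x (suc k) = x ⊗ pow x k

  pow-+ : ∀ x a b → pow x (a ℕ.+ b) ≡ pow x a ⊗ pow x b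
  pow-+ x zero    b = sym (R.*-identityˡ _)
  pow-+ x (suc a) b = trans (cong (x ⊗_) (pow-+ x a b)) (sym (R.*-assoc x _ _))

  pow-1# : ∀ k → pow 1# k ≡ 1#
  pow-1# zero    = refl
  pow-1# (suc k) = trans (R.*-identityˡ _) (pow-1# k)

  pow-⊗ : ∀ x y k → pow (x ⊗ y) k ≡ pow x k ⊗ pow y k
  pow-⊗ x y zero    = sym (R.*-identityˡ _)
  pow-⊗ x y (suc k) = trans (cong (x ⊗ y ⊗_) (pow-⊗ x y k))
    (solve 4 (λ x y a b → x :* y :* (a :* b) := x :* a :* (y :* b)) refl x y (pow x k) (pow y k))

  pow-* : ∀ x a b → pow x (a ℕ.* b) ≡ pow (pow x a) b
  pow-* x a zero    = cong (pow x) (ℕP.*-zeroʳ a)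
  pow-* x a (suc b) = begin
    pow x (a ℕ.* suc b)  ≡⟨ cong (pow x) (ℕP.*-suc a b) ⟩
    pow x (a ℕ.+ a ℕ.* b)  ≡⟨ pow-+ x a (a ℕ.* b) ⟩
    pow x a ⊗ pow x (a ℕ.* b)  ≡⟨ cong (pow x a ⊗_) (pow-* x a b) ⟩
    pow x a ⊗ pow (pow x a) b  ∎
    where open ≡-Reasoning

  pow-0# : ∀ k → 1 ℕ.≤ k → pow 0# k ≡ 0#
  pow-0# (suc k) _ = R.zeroˡ _

  pow-1 : ∀ x → pow x 1 ≡ x
  pow-1 = R.*-identityʳ

  pow≢0 : ∀ {x} k → x ≢ 0# → pow x k ≢ 0#
  pow≢0 zero    x≢0 = 1≢0
  pow≢0 (suc k) x≢0 = ⊗≢0 x≢0 (pow≢0 k x≢0)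

  -- Low d: polynomial functions of degree < d, in Horner form; Monic d: monic ones of degree d.
  Low : ℕ → (A → A) → Set
  Low zero    f = ∀ x → f x ≡ 0#
  Low (suc d) f = ∃ λ c → ∃ λ g → Low d g × (∀ x → f x ≡ x ⊗ g x ⊕ c)

  Monic : ℕ → (A → A) → Set
  Monic d f = ∃ λ g → Low d g × (∀ x → f x ≡ pow x d ⊕ g x)

  Low-cong : ∀ d {f g} → (∀ x → f x ≡ g x) → Low d f → Low d g
  Low-cong zero    eq l = λ x → trans (sym (eq x)) (l x)
  Low-cong (suc d) eq (c , h , l , p) = c , h , l , λ x → trans (sym (eq x)) (p x)

  Low-⊕ : ∀ d {f g} → Low d f → Low d g → Low d (λ x → f x ⊕ g x)
  Low-⊕ zero    l l′ = λ x → trans (cong₂ _⊕_ (l x) (l′ x)) (R.+-identityʳ 0#)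
  Low-⊕ (suc d) (c , h , l , p) (c′ , h′ , l′ , p′) =
    c ⊕ c′ , _ , Low-⊕ d l l′ , λ x → trans (cong₂ _⊕_ (p x) (p′ x))
      (solve 5 (λ x a c b e → x :* a :+ c :+ (x :* b :+ e) := x :* (a :+ b) :+ (c :+ e)) refl x (h x) c (h′ x) c′)

  Low-⊗ : ∀ d {f} a → Low d f → Low d (λ x → a ⊗ f x)
  Low-⊗ zero    a l = λ x → trans (cong (a ⊗_) (l x)) (R.zeroʳ a)
  Low-⊗ (suc d) a (c , h , l , p) = a ⊗ c , _ , Low-⊗ d a l , λ x → trans (cong (a ⊗_) (p x))
      (solve 4 (λ x h c a → a :* (x :* h :+ c) := x :* (a :* h) :+ a :* c) refl x (h x) c a)

  Low-0 : ∀ d {f} → (∀ x → f x ≡ 0#) → Low d f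
  Low-0 zero    p = p
  Low-0 (suc d) p = 0# , (λ _ → 0#) , Low-0 d (λ _ → refl) , λ x →
    trans (p x) (sym (trans (cong (_⊕ 0#) (R.zeroʳ x)) (R.+-identityʳ 0#)))

  Low-suc : ∀ d {f} → Low d f → Low (suc d) f
  Low-suc zero    l = Low-0 1 l
  Low-suc (suc d) (c , h , l , p) = c , h , Low-suc d l , p

  Low-≤ : ∀ {d e f} → d ℕ.≤ e → Low d f → Low e f
  Low-≤ {d} d≤e l = go (ℕP.≤⇒≤′ d≤e)
    where
    go : ∀ {e} → d ℕ.≤′ e → Low e _
    go ℕ.≤′-refl     = l
    go (ℕ.≤′-step p) = Low-suc _ (go p)

  Low-shift : ∀ d {f} → Low d f → Low (suc d) (λ x → x ⊗ f x)
  Low-shift d l = 0# , _ , l , λ x → sym (R.+-identityʳ _)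

  Low-const : ∀ c → Low 1 (λ _ → c)
  Low-const c = c , (λ _ → 0#) , (λ _ → refl) , λ x → sym (trans (cong (_⊕ c) (R.zeroʳ x)) (R.+-identityˡ c))

  Low-pow : ∀ k → Low (suc k) (λ x → pow x k)
  Low-pow zero    = Low-const 1#
  Low-pow (suc k) = Low-shift (suc k) (Low-pow k)

  Monic-pow⊕ : ∀ d {g} → Low d g → Monic d (λ x → pow x d ⊕ g x)
  Monic-pow⊕ d l = _ , l , λ _ → refl

  Monic⇒Low : ∀ d {f} → Monic d f → Low (suc d) f
  Monic⇒Low d (g , l , p) = Low-cong (suc d) (λ x → sym (p x)) (Low-⊕ (suc d) (Low-pow d) (Low-suc d l))

  private
    factor-step : ∀ x a g h c ga → g ≡ (x ⊝ a) ⊗ h ⊕ ga →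
                  x ⊗ g ⊕ c ≡ (x ⊝ a) ⊗ (g ⊕ a ⊗ h) ⊕ (a ⊗ ga ⊕ c)
    factor-step x a g h c ga refl =
      solve 5 (λ x a h c ga → x :* ((x :- a) :* h :+ ga) :+ c
                 := (x :- a) :* ((x :- a) :* h :+ ga :+ a :* h) :+ (a :* ga :+ c)) refl x a h c ga

  -- Horner division by x - a: if f = x g + c and g = (x - a) h + g(a), then f has quotient g + a h
  -- and remainder a g(a) + c = f(a).
  Monic-factor : ∀ d {f} → Monic (suc d) f → ∀ a →
                 ∃ λ h → Monic d h × (∀ x → f x ≡ (x ⊝ a) ⊗ h x ⊕ f a)
  Monic-factor zero {f} (g , (c , k , k≡0 , p) , r) a = (λ _ → 1#) , (_ , (λ _ → refl) , λ _ → sym (R.+-identityʳ 1#)) , λ x →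
    trans (f≡ x) (trans (cong (_⊕ c) (solve 2 (λ x a → x := (x :- a) :+ a) refl x a))
      (trans (R.+-assoc _ a c) (cong₂ _⊕_ (sym (R.*-identityʳ (x ⊝ a))) (sym (f≡ a)))))
    where
    f≡ : ∀ x → f x ≡ x ⊕ c
    f≡ x = trans (r x) (cong₂ _⊕_ (pow-1 x) (trans (p x) (trans (cong (λ z → x ⊗ z ⊕ c) (k≡0 x)) (trans (cong (_⊕ c) (R.zeroʳ x)) (R.+-identityˡ c)))))
  Monic-factor (suc d) {f} (g , (c , k , l , p) , r) a with Monic-factor d (Monic-pow⊕ (suc d) l) a
  ... | h , mh , q = (λ x → (pow x (suc d) ⊕ k x) ⊕ a ⊗ h x)
      , (_ , Low-⊕ (suc d) l (Low-⊗ (suc d) a (Monic⇒Low d mh)) , λ x → R.+-assoc _ _ _)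
      , λ x → trans (f≡ x) (trans (factor-step x a _ (h x) c _ (q x)) (cong (_ ⊕_) (sym (f≡ a))))
    where
    f≡ : ∀ x → f x ≡ x ⊗ (pow x (suc d) ⊕ k x) ⊕ c
    f≡ x = trans (r x) (trans (cong (pow x (suc (suc d)) ⊕_) (p x))
      (solve 4 (λ x a b c → x :* a :+ (x :* b :+ c) := x :* (a :+ b) :+ c) refl x (pow x (suc d)) (k x) c))

  roots : (A → A) → ℤ
  roots f = ∑ λ x → ind (f x ≟ 0#)

  roots-≤ : ∀ d {f} → Monic d f → roots f ≤ + d
  roots-≤ zero    {f} (g , g≡0 , p) = ≤-reflexive (∑-0 λ x → ind-no (f x ≟ 0#)
    (λ fx≡0 → 1≢0 (trans (sym (trans (p x) (trans (cong (1# ⊕_) (g≡0 x)) (R.+-identityʳ 1#)))) fx≡0)))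
  roots-≤ (suc d) {f} m with FinP.any? (λ a → f a ≟ 0#)
  ... | no ¬r = ≤-trans (≤-reflexive (∑-0 λ x → ind-no (f x ≟ 0#) (λ fx≡0 → ¬r (x , fx≡0)))) (+≤+ ℕ.z≤n)
  ... | yes (a , fa≡0) with Monic-factor d m a
  ...   | h , mh , q = ≤-trans (∑-mono bound) (≤-trans (≤-reflexive eq) (ℤP.+-monoʳ-≤ 1ℤ (roots-≤ d mh)))
    where
    bound : ∀ x → ind (f x ≟ 0#) ≤ ind (x ≟ a) * 1ℤ + ind (h x ≟ 0#)
    bound x with f x ≟ 0#
    ... | no _ = +-nonneg (*-nonneg (0≤ind (x ≟ a)) (+≤+ ℕ.z≤n)) (0≤ind (h x ≟ 0#))
    ... | yes fx≡0 with ⊗≡0 {x ⊝ a} {h x} (trans (sym (trans (q x) (trans (cong (_ ⊕_) fa≡0) (R.+-identityʳ _)))) fx≡0)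
    ...   | inj₁ x-a = ℤP.+-mono-≤ (≤-reflexive (cong (_* 1ℤ) (sym (ind-yes (x ≟ a) (⊝≡0⇒≡ x-a))))) (0≤ind (h x ≟ 0#))
    ...   | inj₂ hx = ℤP.+-mono-≤ (*-nonneg (0≤ind (x ≟ a)) (+≤+ ℕ.z≤n)) (≤-reflexive (sym (ind-yes (h x ≟ 0#) hx)))
    eq : ∑ (λ x → ind (x ≟ a) * 1ℤ + ind (h x ≟ 0#)) ≡ 1ℤ + roots h
    eq = trans (∑-+ _ _) (cong (_+ roots h) (∑-δ a (λ _ → 1ℤ)))

  Q≢0 : Q ≢ 0
  Q≢0 refl with 0#
  ... | ()

  N : ℕ
  N = Q ℕ.∸ 1

  Q≡1+N : Q ≡ suc N
  Q≡1+N = sym (ℕP.m+[n∸m]≡n (ℕP.n≢0⇒n>0 Q≢0))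

  ∑-⊕ : ∀ (f : A → ℤ) a → ∑ (λ x → f (x ⊕ a)) ≡ ∑ f
  ∑-⊕ f a = ∑-reindex f (_⊕ a) (_⊝ a)
    (λ x → solve 2 (λ x a → x :- a :+ a := x) refl x a)
    (λ x → solve 2 (λ x a → x :+ a :- a := x) refl x a)

  ∑-⊗ : ∀ (f : A → ℤ) {a} → a ≢ 0# → ∑ (λ x → f (a ⊗ x)) ≡ ∑ f
  ∑-⊗ f {a} a≢0 = let (b , ab≡1) = inverse a a≢0 in ∑-reindex f (a ⊗_) (b ⊗_)
    (λ x → trans (sym (R.*-assoc a b x)) (trans (cong (_⊗ x) ab≡1) (R.*-identityˡ x)))
    (λ x → trans (sym (R.*-assoc b a x)) (trans (cong (_⊗ x) (trans (R.*-comm b a) ab≡1)) (R.*-identityˡ x)))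

  ∑-nonzero : ∑ (λ x → ind (¬? (x ≟ 0#))) ≡ + N
  ∑-nonzero = +-cancelˡ 1ℤ _ _ (begin
    1ℤ + ∑ (λ x → ind (¬? (x ≟ 0#)))  ≡⟨ cong (_+ ∑ (λ x → ind (¬? (x ≟ 0#)))) (∑-δ 0# (λ _ → 1ℤ)) ⟨
    ∑ (λ x → ind (x ≟ 0#) * 1ℤ) + ∑ (λ x → ind (¬? (x ≟ 0#)))  ≡⟨ ∑-+ _ _ ⟨
    ∑ (λ x → ind (x ≟ 0#) * 1ℤ + ind (¬? (x ≟ 0#)))  ≡⟨ ∑-cong (λ x → eq (x ≟ 0#)) ⟩
    ∑ {Q} (λ x → 1ℤ)  ≡⟨ ∑-const Q 1ℤ ⟩
    + Q * 1ℤ  ≡⟨ ℤP.*-identityʳ (+ Q) ⟩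
    + Q  ≡⟨ cong +_ Q≡1+N ⟩
    1ℤ + + N  ∎)
    where
    open ≡-Reasoning
    eq : ∀ {P : Set} (d : Dec P) → ind d * 1ℤ + ind (¬? d) ≡ 1ℤ
    eq (yes _) = refl
    eq (no _)  = refl

module _ (S : ℕ → Set) (S-0 : S 0) (S-+ : ∀ {a b} → S a → S b → S (a ℕ.+ b))
         (S-∸ : ∀ {a b} → S a → S (b ℕ.+ a) → S b) where
  multiple-closed : ∀ k {a} → S a → S (k ℕ.* a)
  multiple-closed zero    s = S-0
  multiple-closed (suc k) s = S-+ s (multiple-closed k s)

  -- Bézout presents the gcd as a difference of two natural multiples, and `S-∸` removes the smaller
  -- one. It serves both exponents that kill an element and Frobenius powers that fix one.
  gcd-closed : ∀ {a b} → S a → S b → S (gcd a b)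
  gcd-closed {a} {b} sa sb with Bézout.identity (gcd-GCD a b)
  ... | Bézout.+- x y eq = S-∸ (multiple-closed y sb) (subst S (sym eq) (multiple-closed x sa))
  ... | Bézout.-+ x y eq = S-∸ (multiple-closed x sa) (subst S (sym eq) (multiple-closed y sb))

prime-divisor : ∀ c → 2 ℕ.≤ c → ∃ λ r → Prime r × r ∣ c
prime-divisor (suc (suc c)) (ℕ.s≤s (ℕ.s≤s _)) = go (PrimeFactorisation.factors f) (PrimeFactorisation.isFactorisation f) (PrimeFactorisation.factorsPrime f)
  where
  f = factorise (suc (suc c))
  go : ∀ rs → suc (suc c) ≡ product rs → All Prime rs → ∃ λ r → Prime r × r ∣ suc (suc c)
  go (r ∷ rs) eq (pr ∷ _) = r , pr , subst (r ∣_) (sym eq) (m∣m*n (product rs))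

-- Roots of unity and a criterion for primitivity.

module MultiplicativeGroup {Q : ℕ} (F : FinField Q) where
  open import Data.Integer using (+_; -[1+_]; 0ℤ; 1ℤ; _+_; _*_; -_; _-_; _≤_; _<_; +≤+; +<+)
  open FiniteSums
  open FieldBasics F

  private
    module Prod = Algebra.Properties.CommutativeMonoid.Sum R.*-commutativeMonoid

    select : ∀ {P : Set} → A → Dec P → A
    select a (yes _) = 1#
    select a (no  _) = a

    prod-select : ∀ {n} {P : Fin n → Set} (a : A) (d : ∀ i → Dec (P i)) →
                  ∃ λ c → Prod.sum (λ i → select a (d i)) ≡ pow a c × ∑ (λ i → ind (¬? (d i))) ≡ + c
    prod-select {zero}  a d = 0 , refl , ∑-0 (λ ())
    prod-select {suc n} a d with d Fin.zero in eq | prod-select a (d ∘ Fin.suc)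
    ... | yes _ | c , p , s = c , trans (R.*-identityˡ _) p , trans (∑-suc _) (trans (cong₂ _+_ (cong (ind ∘ ¬?) eq) s) (ℤP.+-identityˡ (+ c)))
    ... | no _  | c , p , s = suc c , cong (a ⊗_) p , trans (∑-suc _) (cong₂ _+_ (cong (ind ∘ ¬?) eq) s)

    prod≢0 : ∀ {n} (f : Fin n → A) → (∀ i → f i ≢ 0#) → Prod.sum f ≢ 0#
    prod≢0 {zero}  f h = 1≢0
    prod≢0 {suc n} f h = ⊗≢0 (h Fin.zero) (prod≢0 (f ∘ Fin.suc) (h ∘ Fin.suc))

    -- Replacing 0 by 1 turns a product over the whole field into the product of its nonzero
    -- elements.
    unit : A → A
    unit x = select x (x ≟ 0#)

    unit≢0 : ∀ x → unit x ≢ 0#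
    unit≢0 x with x ≟ 0#
    ... | yes _ = 1≢0
    ... | no ¬p = ¬p

    unit-⊗ : ∀ a x → a ≢ 0# → unit (a ⊗ x) ≡ select a (x ≟ 0#) ⊗ unit x
    unit-⊗ a x a≢0 with a ⊗ x ≟ 0# | x ≟ 0#
    ... | yes _ | yes _   = sym (R.*-identityˡ 1#)
    ... | yes p | no x≢0  = contradiction p (⊗≢0 a≢0 x≢0)
    ... | no ¬p | yes x≡0 = contradiction (trans (cong (a ⊗_) x≡0) (R.zeroʳ a)) ¬p
    ... | no _  | no _    = refl

  -- Multiplication by a permutes the nonzero elements; their product thus equals itself times one
  -- factor a for each of them, and it can be cancelled.
  pow-N : ∀ {a} → a ≢ 0# → pow a N ≡ 1#
  pow-N {a} a≢0 with prod-select a (λ x → x ≟ 0#) | inverse a a≢0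
  ... | c , p , s | b , ab≡1 = trans (cong (pow a) N≡c) (⊗-cancelˡ (prod≢0 unit unit≢0)
      (begin
        Prod.sum unit ⊗ pow a c  ≡⟨ R.*-comm _ _ ⟩
        pow a c ⊗ Prod.sum unit  ≡⟨ cong (_⊗ Prod.sum unit) p ⟨
        Prod.sum (λ x → select a (x ≟ 0#)) ⊗ Prod.sum unit  ≡⟨ Prod.∑-distrib-+ (λ x → select a (x ≟ 0#)) unit ⟨
        Prod.sum (λ x → select a (x ≟ 0#) ⊗ unit x)  ≡⟨ Prod.sum-cong-≗ (λ x → sym (unit-⊗ a x a≢0)) ⟩
        Prod.sum (λ x → unit (a ⊗ x))  ≡⟨ Prod.sum-permute unit (permutation (a ⊗_) (b ⊗_) ab ba) ⟨
        Prod.sum unit  ≡⟨ R.*-identityʳ _ ⟨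
        Prod.sum unit ⊗ 1#  ∎))
    where
    open ≡-Reasoning
    N≡c : N ≡ c
    N≡c = ℤP.+-injective (trans (sym ∑-nonzero) s)
    ab : ∀ x → a ⊗ (b ⊗ x) ≡ x
    ab x = trans (sym (R.*-assoc a b x)) (trans (cong (_⊗ x) ab≡1) (R.*-identityˡ x))
    ba : ∀ x → b ⊗ (a ⊗ x) ≡ x
    ba x = trans (sym (R.*-assoc b a x)) (trans (cong (_⊗ x) (trans (R.*-comm b a) ab≡1)) (R.*-identityˡ x))

  pow≡1⇒≢0 : ∀ {x e} → 1 ℕ.≤ e → pow x e ≡ 1# → x ≢ 0#
  pow≡1⇒≢0 {e = e} 1≤e eq refl = 1≢0 (trans (sym eq) (pow-0# e 1≤e))

  pow≡1-gcd : ∀ {x a b} → pow x a ≡ 1# → pow x b ≡ 1# → pow x (gcd a b) ≡ 1#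
  pow≡1-gcd {x} {a} {b} = gcd-closed (λ a → pow x a ≡ 1#) refl
    (λ {a} {b} p q → trans (pow-+ x a b) (trans (cong₂ _⊗_ p q) (R.*-identityˡ 1#)))
    (λ {a} {b} p q → trans (sym (R.*-identityʳ _)) (trans (cong (pow x b ⊗_) (sym p)) (trans (sym (pow-+ x b a)) q))) {a} {b}

  pow≡1-* : ∀ {x} a b → pow x a ≡ 1# → pow x (a ℕ.* b) ≡ 1#
  pow≡1-* {x} a b p = trans (pow-* x a b) (trans (cong (λ y → pow y b) p) (pow-1# b))

  module _ (e : ℕ) (1≤e : 1 ℕ.≤ e) where
    private
      -- The geometric sum (x^(eD) - 1)/(x^e - 1).
      cofactor : ℕ → A → A
      cofactor zero    x = 0#
      cofactor (suc D) x = pow x (e ℕ.* D) ⊕ cofactor D x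

      e*D<e*[1+D] : ∀ D → suc (e ℕ.* D) ℕ.≤ e ℕ.* suc D
      e*D<e*[1+D] D = ℕP.≤-trans (ℕP.+-monoˡ-≤ (e ℕ.* D) 1≤e) (ℕP.≤-reflexive (sym (ℕP.*-suc e D)))

      Low-cofactor : ∀ D → Low (e ℕ.* D) (cofactor D)
      Low-cofactor zero    = subst (λ k → Low k (cofactor 0)) (sym (ℕP.*-zeroʳ e)) (λ x → refl)
      Low-cofactor (suc D) = Low-⊕ (e ℕ.* suc D)
        (Low-≤ (e*D<e*[1+D] D) (Low-pow (e ℕ.* D)))
        (Low-≤ (ℕP.≤-trans (ℕP.n≤1+n _) (e*D<e*[1+D] D)) (Low-cofactor D))

      cofactor-identity : ∀ D x → pow x (e ℕ.* D) ≡ (pow x e ⊝ 1#) ⊗ cofactor D x ⊕ 1#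
      cofactor-identity zero    x = trans (cong (pow x) (ℕP.*-zeroʳ e)) (sym (trans (cong (_⊕ 1#) (R.zeroʳ _)) (R.+-identityˡ 1#)))
      cofactor-identity (suc D) x = begin
        pow x (e ℕ.* suc D)  ≡⟨ cong (pow x) (ℕP.*-suc e D) ⟩
        pow x (e ℕ.+ e ℕ.* D)  ≡⟨ pow-+ x e (e ℕ.* D) ⟩
        y ⊗ z  ≡⟨ solve 3 (λ y z o → y :* z := (y :- o) :* z :+ o :* z) refl y z 1# ⟩
        (y ⊝ 1#) ⊗ z ⊕ 1# ⊗ z  ≡⟨ cong ((y ⊝ 1#) ⊗ z ⊕_) (trans (R.*-identityˡ z) (cofactor-identity D x)) ⟩
        (y ⊝ 1#) ⊗ z ⊕ ((y ⊝ 1#) ⊗ c ⊕ 1#)  ≡⟨ solve 4 (λ a z c o → a :* z :+ (a :* c :+ o) := a :* (z :+ c) :+ o) refl (y ⊝ 1#) z c 1# ⟩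
        (y ⊝ 1#) ⊗ (z ⊕ c) ⊕ 1#  ∎
        where
        open ≡-Reasoning
        y = pow x e
        z = pow x (e ℕ.* D)
        c = cofactor D x

    Monic-pow⊝1 : Monic e (λ x → pow x e ⊝ 1#)
    Monic-pow⊝1 = (λ _ → ⊖ 1#) , Low-≤ 1≤e (Low-const (⊖ 1#)) , λ x → refl

    count-pow≡1-≤ : ∑ (λ x → ind (pow x e ≟ 1#)) ≤ + e
    count-pow≡1-≤ = ≤-trans (∑-mono (λ x → ind-mono (pow x e ≟ 1#) (pow x e ⊝ 1# ≟ 0#) ≡⇒⊝≡0)) (roots-≤ e Monic-pow⊝1)

    -- For the lower bound, all N nonzero elements are roots of (x^e - 1) times the cofactor. The
    -- latter has degree N - e and takes at most that many of them, so at least e remain for x^e -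
    -- 1. The existence of a generator is not presupposed.
    count-pow≡1 : ∀ D → e ℕ.* D ≡ N → ∑ (λ x → ind (pow x e ≟ 1#)) ≡ + e
    count-pow≡1 zero    eD≡N = contradiction (trans (cong suc (trans (sym (ℕP.*-zeroʳ e)) eD≡N)) (sym Q≡1+N))
        (λ 1≡Q → 1≢0 (only 1≡Q 1# 0#))
      where
      only : ∀ {k} → 1 ≡ k → (x y : Fin k) → x ≡ y
      only refl Fin.zero Fin.zero = refl
    count-pow≡1 (suc D) eD≡N = ℤP.≤-antisym count-pow≡1-≤ (≤-from-difference _ eq (difference total))
      where
      X = ∑ (λ x → ind (pow x e ≟ 1#))
      bound : ∀ x → ind (¬? (x ≟ 0#)) ≤ ind (pow x e ≟ 1#) + ind (cofactor (suc D) x ≟ 0#)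
      bound x with x ≟ 0#
      ... | yes _   = +-nonneg (0≤ind (pow x e ≟ 1#)) (0≤ind (cofactor (suc D) x ≟ 0#))
      ... | no x≢0 with ⊗≡0 {pow x e ⊝ 1#} {cofactor (suc D) x} (RP.+-cancelʳ 1# _ _
                  (trans (sym (cofactor-identity (suc D) x)) (trans (cong (pow x) eD≡N) (trans (pow-N x≢0) (sym (R.+-identityˡ 1#))))))
      ...   | inj₁ p = ℤP.+-mono-≤ (≤-reflexive (sym (ind-yes (pow x e ≟ 1#) (⊝≡0⇒≡ p)))) (0≤ind (cofactor (suc D) x ≟ 0#))
      ...   | inj₂ p = ℤP.+-mono-≤ (0≤ind (pow x e ≟ 1#)) (≤-reflexive (sym (ind-yes (cofactor (suc D) x ≟ 0#) p)))
      total : + N ≤ X + + (e ℕ.* D)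
      total = ≤-trans (≤-reflexive (sym ∑-nonzero)) (≤-trans (∑-mono bound) (≤-trans (≤-reflexive (∑-+ _ _))
        (ℤP.+-monoʳ-≤ X (roots-≤ (e ℕ.* D) (Monic-pow⊕ (e ℕ.* D) (Low-cofactor D))))))
      eq : X - + e ≡ X + + (e ℕ.* D) - + N
      eq = begin
        X - + e  ≡⟨ ring X (+ e) (+ (e ℕ.* D)) ⟩
        X + + (e ℕ.* D) - (+ e + + (e ℕ.* D))  ≡⟨ cong (λ z → X + + (e ℕ.* D) - z) (trans (sym (ℤP.pos-+ e (e ℕ.* D))) (cong +_ (trans (sym (ℕP.*-suc e D)) eD≡N))) ⟩
        X + + (e ℕ.* D) - + N  ∎
        where
        open ≡-Reasoning
        ring : ∀ x a b → x - a ≡ x + b - (a + b)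
        ring = solve-∀

  module _ (x : A) (x≢0 : x ≢ 0#) (maximal : ∀ r f → Prime r → f ℕ.* r ≡ N → pow x f ≢ 1#) where
    private
      N≢0 : N ≢ 0
      N≢0 N≡0 = 1≢0 (only (trans (cong suc (sym N≡0)) (sym Q≡1+N)) 1# 0#)
        where
        only : ∀ {k} → 1 ≡ k → (x y : Fin k) → x ≡ y
        only refl Fin.zero Fin.zero = refl

    -- A smaller exponent k could be replaced by g = gcd k N. Then N/g is at least 2, a prime r
    -- divides it, and N/r is a multiple of g, against `maximal`.
    order-N : ∀ k → 1 ℕ.≤ k → k ℕ.< N → pow x k ≢ 1#
    order-N k 1≤k k<N xᵏ≡1 with gcd[m,n]∣n k N
    ... | divides c N≡cg with prime-divisor c 2≤c
      where
      g = gcd k N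
      g≤k : g ℕ.≤ k
      g≤k = ∣⇒≤ {{ℕ.>-nonZero 1≤k}} (gcd[m,n]∣m k N)
      2≤ : ∀ c → N ≡ c ℕ.* g → 2 ℕ.≤ c
      2≤ zero          N≡cg = contradiction N≡cg N≢0
      2≤ (suc zero)    N≡cg = contradiction (ℕP.≤-trans (ℕP.≤-reflexive (trans N≡cg (ℕP.*-identityˡ g))) g≤k) (ℕP.<⇒≱ k<N)
      2≤ (suc (suc _)) _    = ℕ.s≤s (ℕ.s≤s ℕ.z≤n)
      2≤c = 2≤ c N≡cg
    ...   | r , pr , divides c′ c≡c′r = maximal r (c′ ℕ.* g) pr
              (trans (trans (ℕP.*-assoc c′ g r) (trans (cong (c′ ℕ.*_) (ℕP.*-comm g r)) (trans (sym (ℕP.*-assoc c′ r g)) (cong (ℕ._* g) (sym c≡c′r))))) (sym N≡cg))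
              (trans (cong (pow x) (ℕP.*-comm c′ g)) (pow≡1-* g c′ (pow≡1-gcd {a = k} {N} xᵏ≡1 (pow-N x≢0))))
      where g = gcd k N

    pow-injective-< : ∀ {i j} → i ℕ.< j → j ℕ.< N → pow x i ≢ pow x j
    pow-injective-< {i} {j} i<j j<N eq = order-N (j ℕ.∸ i) (ℕP.m<n⇒0<n∸m i<j) (ℕP.≤-<-trans (ℕP.m∸n≤m j i) j<N)
      (⊗-cancelˡ (pow≢0 i x≢0) (trans (sym (pow-+ x i (j ℕ.∸ i))) (trans (cong (pow x) (ℕP.m+[n∸m]≡n (ℕP.<⇒≤ i<j))) (trans (sym eq) (sym (R.*-identityʳ _))))))

    pow-injective : ∀ (i j : Fin N) → pow x (Fin.toℕ i) ≡ pow x (Fin.toℕ j) → i ≡ j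
    pow-injective i j eq with ℕP.<-cmp (Fin.toℕ i) (Fin.toℕ j)
    ... | Tri.tri< i<j _ _ = contradiction eq (pow-injective-< i<j (FinP.toℕ<n j))
    ... | Tri.tri≈ _ i≡j _ = FinP.toℕ-injective i≡j
    ... | Tri.tri> _ _ j<i = contradiction (sym eq) (pow-injective-< j<i (FinP.toℕ<n i))

    -- Pigeonhole in summed form: each nonzero y is hit at most once by the N powers, 0 never, and
    -- the hits total N, so no nonzero y can be missed.
    generates : ∀ y → y ≢ 0# → ∃ λ k → pow x k ≡ y
    generates y y≢0 with ∑-positive (hits y) (subst (0ℤ <_) (sym hits≡1) (+<+ (ℕ.s≤s ℕ.z≤n)))
      where
      hit? : ∀ y (i : Fin N) → Dec (pow x (Fin.toℕ i) ≡ y)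
      hit? y i = pow x (Fin.toℕ i) ≟ y
      hits : A → Fin N → ℤ
      hits y i = ind (hit? y i)
      hits≤ : ∀ y → ∑ (hits y) ≤ ind (¬? (y ≟ 0#))
      hits≤ y with FinP.any? (hit? y)
      ... | no ¬h = ≤-trans (≤-reflexive (∑-0 (λ i → ind-no (hit? y i) (λ h → ¬h (i , h))))) (0≤ind (¬? (y ≟ 0#)))
      ... | yes (i , h) = ≤-reflexive (trans (∑-cong (λ j → trans (ind-cong (hit? y j) (j FinP.≟ i) (λ h′ → pow-injective j i (trans h′ (sym h))) (λ { refl → h })) (sym (ℤP.*-identityʳ _))))
           (trans (∑-δ i (λ _ → 1ℤ)) (sym (ind-yes (¬? (y ≟ 0#)) (λ y≡0 → pow≢0 (Fin.toℕ i) x≢0 (trans h y≡0))))))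
      all-hits : ∑ (λ y → ∑ (hits y)) ≡ + N
      all-hits = trans (∑-swap hits) (trans (∑-cong {g = λ _ → 1ℤ} (λ i → trans (∑-cong (λ y → trans (ind-cong (hit? y i) (y ≟ pow x (Fin.toℕ i)) sym sym) (sym (ℤP.*-identityʳ _)))) (∑-δ _ (λ _ → 1ℤ))))
          (trans (∑-const N 1ℤ) (ℤP.*-identityʳ (+ N))))
      defect : ∑ (λ y → ind (¬? (y ≟ 0#)) - ∑ (hits y)) ≤ 0ℤ
      defect = ≤-reflexive (trans (trans (∑-cong (λ y → cong (λ s → ind (¬? (y ≟ 0#)) + s) (sym (ℤP.-1*i≡-i (∑ (hits y)))))) (∑-+ _ _))
          (trans (cong₂ _+_ ∑-nonzero (trans (∑-*ˡ -[1+ 0 ] (λ y → ∑ (hits y))) (trans (cong (-[1+ 0 ] *_) all-hits) (ℤP.-1*i≡-i (+ N))))) (ℤP.+-inverseʳ (+ N))))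
      hits≡1 : ∑ (hits y) ≡ 1ℤ
      hits≡1 = trans (sym (ℤP.i-j≡0⇒i≡j _ _ (∑≤0⇒term≡0 (λ y → difference (hits≤ y)) defect y))) (ind-yes (¬? (y ≟ 0#)) y≢0)
    ... | i , 0<h with pow x (Fin.toℕ i) ≟ y
    ...   | yes p = Fin.toℕ i , p
    ...   | no _  = contradiction 0<h (λ { (+<+ ()) })

-- Primes, binomial coefficients and the prime divisors of N.

prime∤! : ∀ {p} → Prime p → ∀ k → k ℕ.< p → ¬ (p ∣ k !)
prime∤! {p} pr zero    k<p p∣1 = contradiction (∣⇒≤ p∣1) (ℕP.<⇒≱ (ℕ.nonTrivial⇒n>1 p {{prime⇒nonTrivial pr}}))
prime∤! {p} pr (suc k) k<p p∣! with euclidsLemma (suc k) (k !) pr p∣!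
... | inj₁ p∣k = contradiction (∣⇒≤ p∣k) (ℕP.<⇒≱ k<p)
... | inj₂ p∣! = prime∤! pr k (ℕP.<⇒≤ k<p) p∣!

prime∣choose : ∀ {p} → Prime p → ∀ k → 1 ℕ.≤ k → k ℕ.< p → p ∣ (p choose k)
prime∣choose {suc p} pr k 1≤k k<p with euclidsLemma (suc p choose k) (k ! ℕ.* (suc p ℕ.∸ k) !) pr p∣prod
  where
  eq : (suc p choose k) ℕ.* (k ! ℕ.* (suc p ℕ.∸ k) !) ≡ suc p !
  eq = trans (cong (ℕ._* (k ! ℕ.* (suc p ℕ.∸ k) !)) (nCk≡n!/k![n-k]! (ℕP.<⇒≤ k<p)))
    (m/n*n≡m {{ _ }} (k![n∸k]!∣n! (ℕP.<⇒≤ k<p)))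
  p∣prod : suc p ∣ (suc p choose k) ℕ.* (k ! ℕ.* (suc p ℕ.∸ k) !)
  p∣prod = subst (suc p ∣_) (sym eq) (m∣m*n (p !))
... | inj₁ d = d
... | inj₂ d with euclidsLemma (k !) ((suc p ℕ.∸ k) !) pr d
...   | inj₁ d′ = contradiction d′ (prime∤! pr k k<p)
...   | inj₂ d′ = contradiction d′ (prime∤! pr (suc p ℕ.∸ k) (ℕ.s≤s (ℕP.∸-monoʳ-≤ (suc p) 1≤k)))

b-1∣bᵐ-1 : ∀ b m → ∃ λ c → suc b ℕ.^ m ≡ suc (b ℕ.* c)
b-1∣bᵐ-1 b zero    = 0 , cong suc (sym (ℕP.*-zeroʳ b))
b-1∣bᵐ-1 b (suc m) with b-1∣bᵐ-1 b m
... | c , eq = c ℕ.+ suc (b ℕ.* c) , trans (cong (suc b ℕ.*_) eq) (cong suc (sym (ℕP.*-distribˡ-+ b c (suc (b ℕ.* c)))))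

prime-gcd≡1 : ∀ {r D} → Prime r → ¬ (r ∣ D) → gcd r D ≡ 1
prime-gcd≡1 {r} {D} pr r∤D =
  [ (λ eq → eq) , (λ eq → contradiction (subst (_∣ D) eq (gcd[m,n]∣n r D)) r∤D) ]′ (prime⇒irreducible pr (gcd[m,n]∣m r D))

least : ∀ {P : ℕ → Set} → (∀ i → Dec (P i)) → ∀ b →
        (∀ i → i ℕ.< b → ¬ P i) ⊎ (∃ λ d → d ℕ.< b × P d × (∀ i → i ℕ.< d → ¬ P i))
least P? zero    = inj₁ (λ i ())
least P? (suc b) with least P? b
... | inj₂ (d , d<b , r) = inj₂ (d , ℕP.m<n⇒m<1+n d<b , r)
... | inj₁ none with P? b
...   | yes pb = inj₂ (b , ℕP.n<1+n b , pb , none)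
...   | no ¬pb = inj₁ λ i i<1+b pi → case i (ℕP.m≤n⇒m<n∨m≡n (ℕ.s≤s⁻¹ i<1+b)) pi
  where
  case : ∀ i → i ℕ.< b ⊎ i ≡ b → ¬ _
  case i (inj₁ i<b) = none i i<b
  case i (inj₂ refl) = ¬pb

record PrimeDivisor (N : ℕ) : Set where
  field
    r cofactor : ℕ
    prime      : Prime r
    factors    : cofactor ℕ.* r ≡ N

module PrimeDivisors (N : ℕ) (1≤N : 1 ℕ.≤ N) where
  open PrimeDivisor

  divisors : ℕ → List (PrimeDivisor N)
  divisors zero    = []
  divisors (suc b) with prime? (suc b) | suc b ∣? N
  ... | yes pr | yes (divides c eq) = record { r = suc b ; cofactor = c ; prime = pr ; factors = sym eq } ∷ divisors b
  ... | yes _  | no _               = divisors b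
  ... | no _   | _                  = divisors b

  divisors-≤ : ∀ b → All (λ d → r d ℕ.≤ b) (divisors b)
  divisors-≤ zero    = []
  divisors-≤ (suc b) with prime? (suc b) | suc b ∣? N
  ... | yes pr | yes (divides c eq) = ℕP.≤-refl ∷ All.map ℕP.m≤n⇒m≤1+n (divisors-≤ b)
  ... | yes _  | no _               = All.map ℕP.m≤n⇒m≤1+n (divisors-≤ b)
  ... | no _   | _                  = All.map ℕP.m≤n⇒m≤1+n (divisors-≤ b)

  -- Strict decrease records that the primes are distinct. This keeps a new prime coprime to the
  -- product of the others, in `radical∣N` and again in the sieve.
  divisors-sorted : ∀ b → AllPairs (λ d d′ → r d′ ℕ.< r d) (divisors b)
  divisors-sorted zero    = []
  divisors-sorted (suc b) with prime? (suc b) | suc b ∣? N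
  ... | yes pr | yes (divides c eq) = All.map ℕ.s≤s (divisors-≤ b) ∷ divisors-sorted b
  ... | yes _  | no _               = divisors-sorted b
  ... | no _   | _                  = divisors-sorted b

  divisors-complete : ∀ b {s f} → Prime s → f ℕ.* s ≡ N → s ℕ.≤ b → Any (λ d → r d ≡ s) (divisors b)
  divisors-complete zero    pr eq z≤ = contradiction (subst Prime (ℕP.n≤0⇒n≡0 z≤) pr) ¬prime[0]
  divisors-complete (suc b) {s} {f} pr eq s≤ with prime? (suc b) | suc b ∣? N | ℕP.m≤n⇒m<n∨m≡n s≤
  ... | yes pr′ | yes (divides c _) | inj₂ refl = here refl
  ... | yes pr′ | yes (divides c _) | inj₁ s<   = there (divisors-complete b {f = f} pr eq (ℕ.s≤s⁻¹ s<))
  ... | yes _   | no ¬d             | inj₂ refl = contradiction (divides f (sym eq)) ¬d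
  ... | yes _   | no _              | inj₁ s<   = divisors-complete b {f = f} pr eq (ℕ.s≤s⁻¹ s<)
  ... | no ¬p   | _                 | inj₂ refl = contradiction pr ¬p
  ... | no _    | _                 | inj₁ s<   = divisors-complete b {f = f} pr eq (ℕ.s≤s⁻¹ s<)

  divisors-length : ∀ b → length (divisors b) ℕ.≤ b
  divisors-length zero    = ℕ.z≤n
  divisors-length (suc b) with prime? (suc b) | suc b ∣? N
  ... | yes _ | yes _ = ℕ.s≤s (divisors-length b)
  ... | yes _ | no _  = ℕP.m≤n⇒m≤1+n (divisors-length b)
  ... | no _  | _     = ℕP.m≤n⇒m≤1+n (divisors-length b)

  radical : List (PrimeDivisor N) → ℕ
  radical []       = 1
  radical (d ∷ ds) = r d ℕ.* radical ds

  prime∤radical : ∀ {s} → Prime s → ∀ ds → All (λ d → r d ℕ.< s) ds → ¬ (s ∣ radical ds)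
  prime∤radical {s} pr [] [] s∣1 = contradiction (∣⇒≤ s∣1) (ℕP.<⇒≱ (ℕ.nonTrivial⇒n>1 s {{prime⇒nonTrivial pr}}))
  prime∤radical {s} pr (d ∷ ds) (lt ∷ lts) s∣ with euclidsLemma (r d) (radical ds) pr s∣
  ... | inj₁ s∣r = contradiction (∣⇒≤ {{prime⇒nonZero (prime d)}} s∣r) (ℕP.<⇒≱ lt)
  ... | inj₂ s∣R = prime∤radical pr ds lts s∣R

  radical∣N : ∀ ds → AllPairs (λ d d′ → r d′ ℕ.< r d) ds → radical ds ∣ N
  radical∣N []       _ = 1∣ N
  radical∣N (d ∷ ds) (lts ∷ sorted) with radical∣N ds sorted
  ... | divides c N≡cR with euclidsLemma c (radical ds) (prime d) (subst (r d ∣_) N≡cR (divides (cofactor d) (sym (factors d))))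
  ...   | inj₁ (divides c′ refl) = divides c′ (trans N≡cR (ℕP.*-assoc c′ (r d) (radical ds)))
  ...   | inj₂ d∣R = contradiction d∣R (prime∤radical (prime d) ds lts)

  radical≥1 : ∀ ds → 1 ℕ.≤ radical ds
  radical≥1 []       = ℕP.≤-refl
  radical≥1 (d ∷ ds) = ℕP.*-mono-≤ {1} {r d} {1} {radical ds} (ℕ.>-nonZero⁻¹ (r d) {{prime⇒nonZero (prime d)}}) (radical≥1 ds)

  radical-≤ : ∀ b → radical (divisors b) ℕ.≤ N
  radical-≤ b = ∣⇒≤ {{ℕ.>-nonZero 1≤N}} (radical∣N (divisors b) (divisors-sorted b))

  -- Prime divisors above B contribute at least B to the radical; there are at most B others.
  few-divisors : ∀ B → 1 ℕ.≤ B → ∀ b → B ℕ.^ length (divisors b) ℕ.≤ B ℕ.^ B ℕ.* radical (divisors b)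
  few-divisors B 1≤B zero    = ℕP.≤-trans (ℕP.m^n>0 B {{ℕ.>-nonZero 1≤B}} B) (ℕP.≤-reflexive (sym (ℕP.*-identityʳ _)))
  few-divisors B 1≤B (suc b) with suc b ℕP.≤? B
  ... | yes b≤B = ℕP.≤-trans (ℕP.^-monoʳ-≤ B {{ℕ.>-nonZero 1≤B}} (ℕP.≤-trans (divisors-length (suc b)) b≤B))
                    (ℕP.≤-trans (ℕP.≤-reflexive (sym (ℕP.*-identityʳ _))) (ℕP.*-monoʳ-≤ (B ℕ.^ B) (radical≥1 (divisors (suc b)))))
  ... | no b≰B with prime? (suc b) | suc b ∣? N
  ...   | yes _ | no _ = few-divisors B 1≤B b
  ...   | no _  | _    = few-divisors B 1≤B b
  ...   | yes _ | yes _ = ℕP.≤-trans (ℕP.*-mono-≤ (ℕP.<⇒≤ (ℕP.≰⇒> b≰B)) (few-divisors B 1≤B b))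
          (ℕP.≤-reflexive (+-*-Solver.solve 3 (λ s x y → s :* (x :* y) := x :* (s :* y)) refl (suc b) (B ℕ.^ B) (radical (divisors b))))
    where open +-*-Solver using (_:*_; _:=_)

-- Size of the total error against Q.

^-cancel-< : ∀ k {a b} → a ℕ.^ k ℕ.< b ℕ.^ k → a ℕ.< b
^-cancel-< k {a} {b} h with b ℕP.≤? a
... | no ¬p = ℕP.≰⇒> ¬p
... | yes p = contradiction h (ℕP.≤⇒≯ (ℕP.^-monoˡ-≤ k p))

^-distribʳ-* : ∀ k a b → (a ℕ.* b) ℕ.^ k ≡ a ℕ.^ k ℕ.* b ℕ.^ k
^-distribʳ-* zero    a b = refl
^-distribʳ-* (suc k) a b = trans (cong (a ℕ.* b ℕ.*_) (^-distribʳ-* k a b))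
  (+-*-Solver.solve 4 (λ a b x y → a :* b :* (x :* y) := a :* x :* (b :* y)) refl a b (a ℕ.^ k) (b ℕ.^ k))
  where open +-*-Solver using (_:*_; _:=_)

n*n≤2^n : ∀ n → 4 ℕ.≤ n → n ℕ.* n ℕ.≤ 2 ℕ.^ n
n*n≤2^n n 4≤n = go (ℕP.≤⇒≤′ 4≤n)
  where
  open ℕP.≤-Reasoning
  go : ∀ {n} → 4 ℕ.≤′ n → n ℕ.* n ℕ.≤ 2 ℕ.^ n
  go ℕ.≤′-refl = ℕP.≤-refl
  go (ℕ.≤′-step {n} 4≤′n) = begin
    suc n ℕ.* suc n  ≡⟨ solve 1 (λ n → (con 1 :+ n) :* (con 1 :+ n) := n :* n :+ (con 2 :* n :+ con 1)) refl n ⟩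
    n ℕ.* n ℕ.+ (2 ℕ.* n ℕ.+ 1)  ≤⟨ ℕP.+-monoʳ-≤ (n ℕ.* n) (ℕP.+-monoʳ-≤ (2 ℕ.* n) (ℕP.≤-trans (ℕ.s≤s ℕ.z≤n) 4≤n′)) ⟩
    n ℕ.* n ℕ.+ (2 ℕ.* n ℕ.+ n)  ≡⟨ solve 1 (λ n → n :* n :+ (con 2 :* n :+ n) := n :* n :+ con 3 :* n) refl n ⟩
    n ℕ.* n ℕ.+ 3 ℕ.* n  ≤⟨ ℕP.+-monoʳ-≤ (n ℕ.* n) (ℕP.*-monoˡ-≤ n (ℕP.≤-trans (ℕP.n≤1+n 3) 4≤n′)) ⟩
    n ℕ.* n ℕ.+ n ℕ.* n  ≤⟨ ℕP.+-mono-≤ (go 4≤′n) (go 4≤′n) ⟩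
    2 ℕ.^ n ℕ.+ 2 ℕ.^ n  ≡⟨ cong (2 ℕ.^ n ℕ.+_) (ℕP.+-identityʳ _) ⟨
    2 ℕ.^ suc n  ∎
    where
    open +-*-Solver
    4≤n′ = ℕP.≤′⇒≤ 4≤′n

module ErrorTerm (q n Q T W t K v s a b i : ℕ) (2ˢ≤q : 2 ℕ.^ s ℕ.≤ q) (n≡4+i : n ≡ 4 ℕ.+ i) (Q≡qⁿ : Q ≡ q ℕ.^ n)
                 (T≡qᵗ : T ≡ q ℕ.^ t) (t≤ : 2 ℕ.* t ℕ.≤ n ℕ.+ 2) (1≤W : 1 ℕ.≤ W) (W⁴≤ : W ℕ.^ 4 ℕ.≤ K ℕ.* Q)
                 (1≤v : 1 ℕ.≤ v) (v⁴≤ : (v ℕ.+ v) ℕ.^ 4 ℕ.≤ 2 ℕ.^ a) (K≤ : K ℕ.≤ 2 ℕ.^ b)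
                 (exponents : a ℕ.+ b ℕ.+ (n ℕ.+ 1) ℕ.* 4 ℕ.< s ℕ.* i) where
  open ℕP.≤-Reasoning

  private
    1≤q : 1 ℕ.≤ q
    1≤q = ℕP.≤-trans (ℕP.m^n>0 2 s) 2ˢ≤q

    instance
      q≢0 : ℕ.NonZero q
      q≢0 = ℕ.>-nonZero 1≤q

    4≤n : 4 ℕ.≤ n
    4≤n = subst (4 ℕ.≤_) (sym n≡4+i) (ℕP.m≤m+n 4 i)

    instance
      Q≢0 : ℕ.NonZero Q
      Q≢0 = subst ℕ.NonZero (sym Q≡qⁿ) (ℕP.m^n≢0 q n)

    fourth : ∀ x → x ℕ.^ 4 ≡ x ℕ.* x ℕ.* x ℕ.* x
    fourth = solve 1 (λ x → x :* (x :* (x :* (x :* con 1))) := x :* x :* x :* x) refl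
      where open +-*-Solver

    T⁴≤ : T ℕ.^ 4 ℕ.≤ Q ℕ.* Q ℕ.* q ℕ.^ 4
    T⁴≤ = begin
      T ℕ.^ 4  ≡⟨ cong (ℕ._^ 4) T≡qᵗ ⟩
      (q ℕ.^ t) ℕ.^ 4  ≡⟨ ℕP.^-*-assoc q t 4 ⟩
      q ℕ.^ (t ℕ.* 4)  ≤⟨ ℕP.^-monoʳ-≤ q (ℕP.≤-trans (ℕP.≤-reflexive (solve 1 (λ t → t :* con 4 := con 2 :* (con 2 :* t)) refl t)) (ℕP.*-monoʳ-≤ 2 t≤)) ⟩
      q ℕ.^ (2 ℕ.* (n ℕ.+ 2))  ≡⟨ cong (q ℕ.^_) (solve 1 (λ n → con 2 :* (n :+ con 2) := n :+ n :+ con 4) refl n) ⟩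
      q ℕ.^ (n ℕ.+ n ℕ.+ 4)  ≡⟨ ℕP.^-distribˡ-+-* q (n ℕ.+ n) 4 ⟩
      q ℕ.^ (n ℕ.+ n) ℕ.* q ℕ.^ 4  ≡⟨ cong (ℕ._* q ℕ.^ 4) (ℕP.^-distribˡ-+-* q n n) ⟩
      q ℕ.^ n ℕ.* q ℕ.^ n ℕ.* q ℕ.^ 4  ≡⟨ cong (λ z → z ℕ.* z ℕ.* q ℕ.^ 4) Q≡qⁿ ⟨
      Q ℕ.* Q ℕ.* q ℕ.^ 4  ∎
      where open +-*-Solver

    slack : 2 ℕ.^ (a ℕ.+ b ℕ.+ (n ℕ.+ 1) ℕ.* 4) ℕ.* q ℕ.^ 4 ℕ.< Q
    slack = begin-strict
      2 ℕ.^ (a ℕ.+ b ℕ.+ (n ℕ.+ 1) ℕ.* 4) ℕ.* q ℕ.^ 4  <⟨ ℕP.*-monoˡ-< (q ℕ.^ 4) {{ℕP.m^n≢0 q 4}} (ℕP.^-monoʳ-< 2 (ℕ.s≤s (ℕ.s≤s ℕ.z≤n)) exponents) ⟩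
      2 ℕ.^ (s ℕ.* i) ℕ.* q ℕ.^ 4  ≡⟨ cong (ℕ._* q ℕ.^ 4) (ℕP.^-*-assoc 2 s i) ⟨
      (2 ℕ.^ s) ℕ.^ i ℕ.* q ℕ.^ 4  ≤⟨ ℕP.*-monoˡ-≤ (q ℕ.^ 4) (ℕP.^-monoˡ-≤ i 2ˢ≤q) ⟩
      q ℕ.^ i ℕ.* q ℕ.^ 4  ≡⟨ ℕP.*-comm (q ℕ.^ i) (q ℕ.^ 4) ⟩
      q ℕ.^ 4 ℕ.* q ℕ.^ i  ≡⟨ ℕP.^-distribˡ-+-* q 4 i ⟨
      q ℕ.^ (4 ℕ.+ i)  ≡⟨ trans Q≡qⁿ (cong (q ℕ.^_) n≡4+i) ⟨
      Q  ∎

    Z : ℕ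
    Z = (v ℕ.+ v) ℕ.* W ℕ.* T ℕ.* 2 ℕ.^ (n ℕ.+ 1)

    -- Fourth powers clear the roots: W^4 ≤ K Q and T^4 ≤ Q² q^4, so Z^4 is at most Q³ times 2^(a +
    -- b + 4(n + 1)) q^4, and `exponents` puts the last product below Q = q^(4+i).
    Z<Q : Z ℕ.< Q
    Z<Q = ^-cancel-< 4 (begin-strict
      Z ℕ.^ 4  ≡⟨ trans (^-distribʳ-* 4 (u ℕ.* W ℕ.* T) P) (cong (ℕ._* P ℕ.^ 4) (trans (^-distribʳ-* 4 (u ℕ.* W) T) (cong (ℕ._* T ℕ.^ 4) (^-distribʳ-* 4 u W)))) ⟩
      u ℕ.^ 4 ℕ.* W ℕ.^ 4 ℕ.* T ℕ.^ 4 ℕ.* P ℕ.^ 4  ≤⟨ ℕP.*-mono-≤ (ℕP.*-mono-≤ (ℕP.*-mono-≤ v⁴≤ (ℕP.≤-trans W⁴≤ (ℕP.*-monoˡ-≤ Q K≤))) T⁴≤) (ℕP.≤-reflexive (ℕP.^-*-assoc 2 (n ℕ.+ 1) 4)) ⟩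
      2 ℕ.^ a ℕ.* (2 ℕ.^ b ℕ.* Q) ℕ.* (Q ℕ.* Q ℕ.* q ℕ.^ 4) ℕ.* 2 ℕ.^ e  ≡⟨ rearrange (2 ℕ.^ a) (2 ℕ.^ b) Q (q ℕ.^ 4) (2 ℕ.^ e) ⟩
      Q ℕ.* Q ℕ.* Q ℕ.* (2 ℕ.^ a ℕ.* 2 ℕ.^ b ℕ.* 2 ℕ.^ e ℕ.* q ℕ.^ 4)  ≡⟨ cong (λ z → Q ℕ.* Q ℕ.* Q ℕ.* (z ℕ.* q ℕ.^ 4)) (trans (cong (ℕ._* 2 ℕ.^ e) (sym (ℕP.^-distribˡ-+-* 2 a b))) (sym (ℕP.^-distribˡ-+-* 2 (a ℕ.+ b) e))) ⟩
      Q ℕ.* Q ℕ.* Q ℕ.* (2 ℕ.^ (a ℕ.+ b ℕ.+ e) ℕ.* q ℕ.^ 4)  <⟨ ℕP.*-monoʳ-< (Q ℕ.* Q ℕ.* Q) {{ℕP.m*n≢0 (Q ℕ.* Q) Q {{ℕP.m*n≢0 Q Q}}}} slack ⟩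
      Q ℕ.* Q ℕ.* Q ℕ.* Q  ≡⟨ fourth Q ⟨
      Q ℕ.^ 4  ∎)
      where
      u = v ℕ.+ v
      P = 2 ℕ.^ (n ℕ.+ 1)
      e = (n ℕ.+ 1) ℕ.* 4
      rearrange : ∀ a b Q c d → a ℕ.* (b ℕ.* Q) ℕ.* (Q ℕ.* Q ℕ.* c) ℕ.* d ≡ Q ℕ.* Q ℕ.* Q ℕ.* (a ℕ.* b ℕ.* d ℕ.* c)
      rearrange = solve 5 (λ a b Q c d → a :* (b :* Q) :* (Q :* Q :* c) :* d := Q :* Q :* Q :* (a :* b :* d :* c)) refl
        where open +-*-Solver

  -- Since n² ≤ 2^n, the left side is at most Y = v W T 2^(n+1). `Z` is twice Y and Y ≥ 1, hence Y +
  -- 1 ≤ Z < Q: the spare factor 2 absorbs the passage from Q to Q - 1.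
  error-small : v ℕ.* W ℕ.* T ℕ.* (2 ℕ.^ n ℕ.+ n ℕ.* n) ℕ.< Q ℕ.∸ 1
  error-small = ℕP.≤-trans (ℕ.s≤s (ℕP.*-monoʳ-≤ (v ℕ.* W ℕ.* T) (ℕP.+-monoʳ-≤ (2 ℕ.^ n) (n*n≤2^n n 4≤n))))
    (ℕP.∸-monoˡ-≤ {2 ℕ.+ Y} {Q} 1 (ℕP.≤-trans (ℕ.s≤s (ℕP.≤-trans (ℕP.+-monoˡ-≤ Y 1≤Y) (ℕP.≤-reflexive double))) Z<Q))
    where
    Y = v ℕ.* W ℕ.* T ℕ.* (2 ℕ.^ n ℕ.+ 2 ℕ.^ n)
    1≤T : 1 ℕ.≤ T
    1≤T = subst (1 ℕ.≤_) (sym T≡qᵗ) (ℕP.m^n>0 q t)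
    1≤Y : 1 ℕ.≤ Y
    1≤Y = ℕP.*-mono-≤ {1} {v ℕ.* W ℕ.* T} {1} (ℕP.*-mono-≤ {1} {v ℕ.* W} {1} (ℕP.*-mono-≤ {1} {v} {1} 1≤v 1≤W) 1≤T) (ℕP.≤-trans (ℕP.m^n>0 2 n) (ℕP.m≤m+n _ _))
    double : Y ℕ.+ Y ≡ Z
    double = trans (rearrange v W T (2 ℕ.^ n)) (cong ((v ℕ.+ v) ℕ.* W ℕ.* T ℕ.*_) (cong (2 ℕ.^_) (ℕP.+-comm 1 n)))
      where
      open +-*-Solver
      rearrange : ∀ v W T P → v ℕ.* W ℕ.* T ℕ.* (P ℕ.+ P) ℕ.+ v ℕ.* W ℕ.* T ℕ.* (P ℕ.+ P) ≡ (v ℕ.+ v) ℕ.* W ℕ.* T ℕ.* (2 ℕ.* P)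
      rearrange = solve 4 (λ v W T P → v :* W :* T :* (P :+ P) :+ v :* W :* T :* (P :+ P) := (v :+ v) :* W :* T :* (con 2 :* P)) refl

-- At m = n + 1 this makes q^t an integer substitute for √(qQ), with qQ ≤ q^(2t) ≤ q²Q.
ceil-half : ∀ m → ∃ λ t → m ℕ.≤ t ℕ.+ t × t ℕ.+ t ℕ.≤ suc m
ceil-half m = ℕ.⌈ m /2⌉
  , ℕP.≤-trans (ℕP.≤-reflexive (sym (ℕP.⌊n/2⌋+⌈n/2⌉≡n m))) (ℕP.+-monoˡ-≤ ℕ.⌈ m /2⌉ (ℕP.⌊n/2⌋≤⌈n/2⌉ m))
  , ℕP.≤-trans (ℕP.+-monoʳ-≤ ℕ.⌈ m /2⌉ (ℕP.⌊n/2⌋≤⌈n/2⌉ (suc m))) (ℕP.≤-reflexive (ℕP.⌊n/2⌋+⌈n/2⌉≡n (suc m)))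

-- On the left, 18 covers the numerical factor, 8 B is the binary exponent of 256^B, and (n + 1) 4
-- with n = 4 + i is that of the fourth power of 2^(n+1). On the right is the exponent of (2^20)^i,
-- a lower bound for q^i.
exponent-inequality : ∀ B i → B ≡ 256 → 1000 ℕ.≤ i → 18 ℕ.+ 8 ℕ.* B ℕ.+ (4 ℕ.+ i ℕ.+ 1) ℕ.* 4 ℕ.< 20 ℕ.* i
exponent-inequality B i B≡256 1000≤i = begin-strict
  18 ℕ.+ 8 ℕ.* B ℕ.+ (4 ℕ.+ i ℕ.+ 1) ℕ.* 4  ≡⟨ solve 2 (λ e i → e :+ (con 4 :+ i :+ con 1) :* con 4 := e :+ con 20 :+ con 4 :* i) refl (18 ℕ.+ 8 ℕ.* B) i ⟩
  18 ℕ.+ 8 ℕ.* B ℕ.+ 20 ℕ.+ 4 ℕ.* i  <⟨ ℕP.+-monoˡ-< (4 ℕ.* i) (ℕP.<-≤-trans (subst (λ B → 18 ℕ.+ 8 ℕ.* B ℕ.+ 20 ℕ.< 16000) (sym B≡256) (ℕP.≤ᵇ⇒≤ 2087 16000 tt)) (ℕP.*-monoʳ-≤ 16 1000≤i)) ⟩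
  16 ℕ.* i ℕ.+ 4 ℕ.* i  ≡⟨ ℕP.*-distribʳ-+ i 16 4 ⟨
  20 ℕ.* i  ∎
  where
  open ℕP.≤-Reasoning
  open +-*-Solver

telescope : ∀ r n X W → r ℕ.* (n ℕ.* X ℕ.+ W) ℕ.+ n ℕ.* X ≡ r ℕ.* W ℕ.+ n ℕ.* ((1 ℕ.+ r) ℕ.* X)
telescope = solve 4 (λ r n X W → r :* (n :* X :+ W) :+ n :* X := r :* W :+ n :* ((con 1 :+ r) :* X)) refl
  where open +-*-Solver

square^4≡^8 : ∀ x → (x ℕ.* x) ℕ.^ 4 ≡ x ℕ.^ 8
square^4≡^8 = solve 1 (λ x → (x :* x) :* ((x :* x) :* ((x :* x) :* ((x :* x) :* con 1)))
                          := x :* (x :* (x :* (x :* (x :* (x :* (x :* (x :* con 1)))))))) refl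
  where open +-*-Solver

-- Inclusion-exclusion with cleared denominators.

module Sieve {n : ℕ} (X T : ℤ) where
  open import Data.Integer using (+_; -[1+_]; 0ℤ; 1ℤ; _+_; _*_; -_; _-_; _≤_; _<_; +≤+; +<+)
  open FiniteSums

  -- An event, given by its indicator, together with the reciprocal of its expected density. The
  -- expected proportion avoiding all events is then `survivors` over `modulus`.
  Item : Set
  Item = (Fin n → ℤ) × ℤ

  sift : List Item → Fin n → ℤ
  sift []            x = 1ℤ
  sift ((a , d) ∷ L) x = (1ℤ - a x) * sift L x

  modulus : List Item → ℤ
  modulus []            = 1ℤ
  modulus ((a , d) ∷ L) = d * modulus L

  survivors : List Item → ℤ
  survivors []            = 1ℤ
  survivors ((a , d) ∷ L) = (d - 1ℤ) * survivors L

  2^_ : List Item → ℤ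
  2^ []      = 1ℤ
  2^ (_ ∷ L) = + 2 * 2^ L

  -- Every intersection of the events in L with b has mass X/δ, δ the product of the denominators, up to an error T.
  Sieveable : (Fin n → ℤ) → ℤ → List Item → Set
  Sieveable b δ []            = Near (δ * T) (δ * ∑ b) X
  Sieveable b δ ((a , d) ∷ L) = 0ℤ ≤ d × Sieveable b δ L × Sieveable (λ x → b x * a x) (δ * d) L

  -- Peeling off one event gives S₁ - S₂, without and with that event. At scale δ d m the expected
  -- values are d X f and X f, whose difference is X (d - 1) f. The two errors become equal at this
  -- scale and add up, so every event doubles the error.
  sieve : ∀ L b δ → 0ℤ ≤ δ → Sieveable b δ L →
          Near (δ * modulus L * 2^ L * T) (δ * modulus L * ∑ (λ x → b x * sift L x)) (X * survivors L)
  sieve [] b δ 0≤δ (up , lo) =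
      ≤-trans (≤-reflexive lhs) (≤-trans up (≤-reflexive (rhs₁ X δ T)))
    , ≤-trans (≤-reflexive (ℤP.*-identityʳ X)) (≤-trans lo (≤-reflexive (sym (cong₂ _+_ lhs (rhs₂ δ T)))))
    where
    lhs : δ * 1ℤ * ∑ (λ x → b x * 1ℤ) ≡ δ * ∑ b
    lhs = cong₂ _*_ (ℤP.*-identityʳ δ) (∑-cong (λ x → ℤP.*-identityʳ (b x)))
    rhs₁ : ∀ X δ T → X + δ * T ≡ X * 1ℤ + δ * 1ℤ * 1ℤ * T
    rhs₁ = solve-∀
    rhs₂ : ∀ δ T → δ * 1ℤ * 1ℤ * T ≡ δ * T
    rhs₂ = solve-∀
  sieve ((a , d) ∷ L) b δ 0≤δ (0≤d , s₁ , s₂) with sieve L b δ 0≤δ s₁ | sieve L (λ x → b x * a x) (δ * d) (*-nonneg 0≤δ 0≤d) s₂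
  ... | up₁ , lo₁ | up₂ , lo₂ =
      ≤-from-difference _ (trans (cong (λ s → X * ((d - 1ℤ) * f) + δ * (d * m) * (+ 2 * t) * T - δ * (d * m) * s) split) (ring₁ X d f δ m t T S₁ S₂))
        (+-nonneg (*-nonneg 0≤d (difference up₁)) (difference lo₂))
    , ≤-from-difference _ (trans (cong (λ s → δ * (d * m) * s + δ * (d * m) * (+ 2 * t) * T - X * ((d - 1ℤ) * f)) split) (ring₂ X d f δ m t T S₁ S₂))
        (+-nonneg (*-nonneg 0≤d (difference lo₁)) (difference up₂))
    where
    m = modulus L
    f = survivors L
    t = 2^ L
    S₁ = ∑ (λ x → b x * sift L x)
    S₂ = ∑ (λ x → b x * a x * sift L x)
    ring₀ : ∀ b a s → b * ((1ℤ - a) * s) ≡ b * s + - 1ℤ * (b * a * s)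
    ring₀ = solve-∀
    split : ∑ (λ x → b x * ((1ℤ - a x) * sift L x)) ≡ S₁ + - 1ℤ * S₂
    split = trans (∑-cong (λ x → ring₀ (b x) (a x) (sift L x))) (trans (∑-+ _ _) (cong (λ s → S₁ + s) (∑-*ˡ (- 1ℤ) _)))
    ring₁ : ∀ X d f δ m t T S₁ S₂ → X * ((d - 1ℤ) * f) + δ * (d * m) * (+ 2 * t) * T - δ * (d * m) * (S₁ + - 1ℤ * S₂)
          ≡ d * (X * f + δ * m * t * T - δ * m * S₁) + (δ * d * m * S₂ + δ * d * m * t * T - X * f)
    ring₁ = solve-∀
    ring₂ : ∀ X d f δ m t T S₁ S₂ → δ * (d * m) * (S₁ + - 1ℤ * S₂) + δ * (d * m) * (+ 2 * t) * T - X * ((d - 1ℤ) * f)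
          ≡ d * (δ * m * S₁ + δ * m * t * T - X * f) + (X * f + δ * d * m * t * T - δ * d * m * S₂)
    ring₂ = solve-∀

  sift-++ : ∀ L L′ x → sift (L ++ L′) x ≡ sift L x * sift L′ x
  sift-++ []            L′ x = sym (ℤP.*-identityˡ _)
  sift-++ ((a , d) ∷ L) L′ x = trans (cong ((1ℤ - a x) *_) (sift-++ L L′ x)) (sym (ℤP.*-assoc (1ℤ - a x) _ _))

  modulus-++ : ∀ L L′ → modulus (L ++ L′) ≡ modulus L * modulus L′
  modulus-++ []            L′ = sym (ℤP.*-identityˡ _)
  modulus-++ ((a , d) ∷ L) L′ = trans (cong (d *_) (modulus-++ L L′)) (sym (ℤP.*-assoc d _ _))

  survivors-++ : ∀ L L′ → survivors (L ++ L′) ≡ survivors L * survivors L′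
  survivors-++ []            L′ = sym (ℤP.*-identityˡ _)
  survivors-++ ((a , d) ∷ L) L′ = trans (cong ((d - 1ℤ) *_) (survivors-++ L L′)) (sym (ℤP.*-assoc (d - 1ℤ) _ _))

  2^-++ : ∀ L L′ → 2^ (L ++ L′) ≡ 2^ L * 2^ L′
  2^-++ []      L′ = sym (ℤP.*-identityˡ _)
  2^-++ (_ ∷ L) L′ = trans (cong (+ 2 *_) (2^-++ L L′)) (sym (ℤP.*-assoc (+ 2) (2^ L) (2^ L′)))

  Indicator : Item → Set
  Indicator (a , _) = ∀ x → a x ≡ 0ℤ ⊎ a x ≡ 1ℤ

  sift-01 : ∀ {L} → All Indicator L → ∀ x → sift L x ≡ 0ℤ ⊎ sift L x ≡ 1ℤ
  sift-01 []                x = inj₂ refl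
  sift-01 {(a , d) ∷ L} (i ∷ is) x with i x | sift-01 is x
  ... | inj₂ eq | _        = inj₁ (cong (λ s → (1ℤ - s) * sift L x) eq)
  ... | inj₁ eq | inj₁ eq′ = inj₁ (trans (cong ((1ℤ - a x) *_) eq′) (ℤP.*-zeroʳ (1ℤ - a x)))
  ... | inj₁ eq | inj₂ eq′ = inj₂ (cong₂ (λ s t → (1ℤ - s) * t) eq eq′)

  sift≡1 : ∀ {L} → All Indicator L → ∀ x → sift L x ≡ 1ℤ → All (λ (a , _) → a x ≡ 0ℤ) L
  sift≡1 []                x eq = []
  sift≡1 {(a , d) ∷ L} (i ∷ is) x eq with i x | sift-01 is x
  ... | inj₂ e | _       = contradiction (trans (sym eq) (cong (λ s → (1ℤ - s) * sift L x) e)) (λ ())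
  ... | inj₁ e | inj₁ e′ = contradiction (trans (sym eq) (trans (cong ((1ℤ - a x) *_) e′) (ℤP.*-zeroʳ (1ℤ - a x)))) (λ ())
  ... | inj₁ e | inj₂ e′ = e ∷ sift≡1 is x e′

-- Lower bounds for the surviving proportion.

module SieveDensity {n : ℕ} (X T : ℤ) where
  open import Data.Integer using (+_; -[1+_]; 0ℤ; 1ℤ; _+_; _*_; -_; _-_; _≤_; _<_; +≤+; +<+)
  open FiniteSums
  open Sieve {n} X T

  module _ (c : ℕ) (1≤c : 1 ℕ.≤ c) where
    Large : Item → Set
    Large (_ , d) = + c ≤ d

    modulus-nonneg : ∀ {L} → All Large L → 0ℤ ≤ modulus L
    modulus-nonneg []       = +≤+ ℕ.z≤n
    modulus-nonneg (h ∷ hs) = *-nonneg (≤-trans (+≤+ ℕ.z≤n) h) (modulus-nonneg hs)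

    -- Bernoulli's inequality ∏ (1 - 1/d) ≥ 1 - k/c for k denominators d ≥ c, after clearing
    -- denominators.
    bernoulli : ∀ {L} → All Large L → (+ c - + length L) * modulus L ≤ + c * survivors L
    bernoulli []                = ≤-reflexive (cong (_* 1ℤ) (ℤP.+-identityʳ (+ c)))
    bernoulli {(_ , d) ∷ L} (h ∷ hs) = ≤-from-difference _ (ring (+ c) d (survivors L) (modulus L) (+ length L))
      (+-nonneg (*-nonneg (difference (≤-trans (+≤+ 1≤c) h)) (difference (bernoulli hs)))
                (*-nonneg (+-nonneg (difference h) (+≤+ (ℕ.z≤n {length L}))) (modulus-nonneg hs)))
      where
      ring : ∀ c d s m k → c * ((d - 1ℤ) * s) - (c - (1ℤ + k)) * (d * m) ≡ (d - 1ℤ) * (c * s - (c - k) * m) + (d - c + k) * m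
      ring = solve-∀

    half : ∀ {L} → All Large L → 2 ℕ.* length L ℕ.≤ c → modulus L ≤ + 2 * survivors L
    half {L} hs short = ℤP.*-cancelˡ-≤-pos _ _ (+ c) {{ℤ.positive (+<+ 1≤c)}} (≤-from-difference _ (ring (+ c) (survivors L) (modulus L) (+ length L))
      (+-nonneg (*-nonneg {+ 2} (+≤+ ℕ.z≤n) (difference (bernoulli hs))) (*-nonneg (difference (subst (_≤ + c) (ℤP.pos-* 2 (length L)) (+≤+ short))) (modulus-nonneg hs))))
      where
      ring : ∀ c s m k → c * (+ 2 * s) - c * m ≡ + 2 * (c * s - (c - k) * m) + (c - + 2 * k) * m
      ring = solve-∀

    survivors-nonneg : ∀ {L} → All Large L → 0ℤ ≤ survivors L
    survivors-nonneg []       = +≤+ ℕ.z≤n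
    survivors-nonneg (h ∷ hs) = *-nonneg (difference (≤-trans (+≤+ 1≤c) h)) (survivors-nonneg hs)

    -- With c - 1 items Bernoulli alone yields only 1/c. Each half of the list has at most c/2 items
    -- and keeps at least one half, and the two proportions multiply.
    quarter : ∀ {L} → All Large L → suc (length L) ℕ.≤ c → modulus L ≤ + 4 * survivors L
    quarter {L} hs short = subst (λ M → modulus M ≤ + 4 * survivors M) (take++drop≡id k L)
        (≤-trans (≤-reflexive (modulus-++ L₁ L₂)) (≤-trans (*-monoʳ (modulus-nonneg hs₂) (half hs₁ short₁))
          (≤-trans (*-monoˡ (*-nonneg {+ 2} (+≤+ ℕ.z≤n) (survivors-nonneg hs₁)) (half hs₂ short₂)) (≤-reflexive (trans (ring (survivors L₁) (survivors L₂)) (cong (+ 4 *_) (sym (survivors-++ L₁ L₂))))))))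
      where
      k = ℕ.⌊ length L /2⌋
      L₁ = take k L
      L₂ = drop k L
      hs₁ = AllP.take⁺ k hs
      hs₂ = AllP.drop⁺ k hs
      ring : ∀ s t → + 2 * s * (+ 2 * t) ≡ + 4 * (s * t)
      ring = solve-∀
      k+k≤ : k ℕ.+ k ℕ.≤ length L
      k+k≤ = ℕP.≤-trans (ℕP.+-monoʳ-≤ k (ℕP.⌊n/2⌋≤⌈n/2⌉ (length L))) (ℕP.≤-reflexive (ℕP.⌊n/2⌋+⌈n/2⌉≡n (length L)))
      short₁ : 2 ℕ.* length L₁ ℕ.≤ c
      short₁ = ℕP.≤-trans (ℕP.*-monoʳ-≤ 2 (ℕP.≤-trans (ℕP.≤-reflexive (length-take k L)) (ℕP.m⊓n≤m k (length L))))
        (ℕP.≤-trans (ℕP.≤-reflexive (cong (k ℕ.+_) (ℕP.+-identityʳ k))) (ℕP.≤-trans k+k≤ (ℕP.≤-trans (ℕP.n≤1+n _) short)))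
      rest : length L₂ ≡ ℕ.⌈ length L /2⌉
      rest = trans (length-drop k L) (trans (cong (ℕ._∸ k) (sym (ℕP.⌊n/2⌋+⌈n/2⌉≡n (length L)))) (ℕP.m+n∸m≡n k _))
      -- The longer half has ⌈k/2⌉ items and 2⌈k/2⌉ ≤ k + 1, which is why the hypothesis bounds
      -- `suc (length L)`.
      short₂ : 2 ℕ.* length L₂ ℕ.≤ c
      short₂ = ℕP.≤-trans (ℕP.≤-reflexive (trans (cong (2 ℕ.*_) rest) (cong (ℕ.⌈ length L /2⌉ ℕ.+_) (ℕP.+-identityʳ _))))
        (ℕP.≤-trans (ℕP.+-monoʳ-≤ ℕ.⌈ length L /2⌉ (ℕP.⌊n/2⌋≤⌈n/2⌉ (suc (length L)))) (ℕP.≤-trans (ℕP.≤-reflexive (ℕP.⌊n/2⌋+⌈n/2⌉≡n (suc (length L)))) short))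

-- Main terms against error terms.

module FinalInequality where
  open import Data.Integer using (+_; -[1+_]; 0ℤ; 1ℤ; _+_; _*_; -_; _-_; _≤_; _<_; +≤+; +<+)
  open FiniteSums

  positive-factor : ∀ {a b} → 0ℤ ≤ a → 0ℤ < a * b → 0ℤ < b
  positive-factor {a} {b} 0≤a 0<ab = ℤP.≰⇒> (λ b≤0 → ℤP.<⇒≱ 0<ab (≤-trans (*-monoˡ 0≤a b≤0) (≤-reflexive (ℤP.*-zeroʳ a))))

  *-positive : ∀ {a b} → 0ℤ < a → 0ℤ < b → 0ℤ < a * b
  *-positive {a} {b} 0<a 0<b = subst (_< a * b) (ℤP.*-zeroʳ a) (ℤP.*-monoˡ-<-pos a {{ℤ.positive 0<a}} 0<b)

  -- Here `φ`/`m` and `sM`/`mM` are the surviving proportions for the primes and for the modules at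
  -- l = 1, `t` and `tM` the numbers of subsets, `C` the sieved count, `Σ` the loss to l ≥ 2, and
  -- `ρ`, `β` bounds in thousandths for the proportion surviving at l = 1 and for the loss.
  -- `identity` is a certificate writing 1000 Q m (C - Σ) as a combination of the hypotheses with
  -- nonnegative coefficients. The gap of 100 thousandths is left for the errors, whence the factor
  -- 10 = 1000/100; `m ≤ t φ` replaces m/φ by a second factor `t`.
  combine : ∀ {Q N φ m mM sM t tM T C Σ wt len ρ β : ℤ} →
            0ℤ < Q → 0ℤ < φ → 0ℤ ≤ N → 0ℤ < mM → 0ℤ ≤ m → 0ℤ ≤ t → 0ℤ ≤ tM → 0ℤ ≤ len → 0ℤ ≤ T →
            N * (φ * sM) ≤ m * mM * C + m * mM * (t * tM) * T →
            ρ * mM ≤ + 1000 * sM →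
            Q * m * Σ ≤ wt * (N * φ) + len * (Q * m * t * T) →
            + 1000 * wt ≤ β * Q → β + + 100 ≤ ρ → m ≤ t * φ →
            + 10 * (t * t) * T * (tM + len) < N → 0ℤ < C - Σ
  combine {Q} {N} {φ} {m} {mM} {sM} {t} {tM} {T} {C} {Σ} {wt} {len} {ρ} {β} 0<Q 0<φ 0≤N 0<mM 0≤m 0≤t 0≤tM 0≤len 0≤T h₁ h₂ h₃ h₄ h₅ h₆ h₇ =
    positive-factor (*-nonneg (*-nonneg {+ 1000} (+≤+ ℕ.z≤n) 0≤Q) 0≤m)
      (subst (0ℤ <_) (sym (identity Q N φ m t tM T C Σ wt len ρ β))
        (ℤP.+-mono-≤-< {0ℤ} (+-nonneg (+-nonneg (+-nonneg (+-nonneg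
            (*-nonneg 0≤Q (difference main))
            (*-nonneg {+ 1000} (+≤+ ℕ.z≤n) (difference h₃)))
            (*-nonneg 0≤Nφ (difference h₄)))
            (*-nonneg (*-nonneg 0≤Q 0≤Nφ) (difference h₅)))
            (*-nonneg (*-nonneg (*-nonneg (*-nonneg (*-nonneg {+ 1000} (+≤+ ℕ.z≤n) 0≤Q) 0≤t) 0≤T) (+-nonneg 0≤tM 0≤len)) (difference h₆)))
          (*-positive (*-positive (*-positive {+ 100} (+<+ (ℕ.s≤s ℕ.z≤n)) 0<Q) 0<φ) (subst (_< N - E) (ℤP.+-inverseʳ E) (ℤP.+-monoˡ-< (- E) h₇)))))
    where
    E = + 10 * (t * t) * T * (tM + len)
    0≤Q = ℤP.<⇒≤ 0<Q
    0≤Nφ = *-nonneg 0≤N (ℤP.<⇒≤ 0<φ)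
    ring₁ : ∀ mM ρ N φ → mM * (ρ * (N * φ)) ≡ N * φ * (ρ * mM)
    ring₁ = solve-∀
    ring₂ : ∀ N φ sM → N * φ * (+ 1000 * sM) ≡ + 1000 * (N * (φ * sM))
    ring₂ = solve-∀
    ring₃ : ∀ m mM C t tM T → + 1000 * (m * mM * C + m * mM * (t * tM) * T) ≡ mM * (+ 1000 * m * C + + 1000 * m * (t * tM) * T)
    ring₃ = solve-∀
    main : ρ * (N * φ) ≤ + 1000 * m * C + + 1000 * m * (t * tM) * T
    main = ℤP.*-cancelˡ-≤-pos _ _ mM {{ℤ.positive 0<mM}} (≤-trans (≤-reflexive (ring₁ mM ρ N φ)) (≤-trans (*-monoˡ 0≤Nφ h₂)
      (≤-trans (≤-reflexive (ring₂ N φ sM)) (≤-trans (*-monoˡ {+ 1000} (+≤+ ℕ.z≤n) h₁) (≤-reflexive (ring₃ m mM C t tM T))))))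
    identity : ∀ Q N φ m t tM T C Σ wt len ρ β → + 1000 * Q * m * (C - Σ) ≡
      Q * (+ 1000 * m * C + + 1000 * m * (t * tM) * T - ρ * (N * φ))
      + + 1000 * (wt * (N * φ) + len * (Q * m * t * T) - Q * m * Σ)
      + N * φ * (β * Q - + 1000 * wt)
      + Q * (N * φ) * (ρ - (β + + 100))
      + + 1000 * Q * t * T * (tM + len) * (t * φ - m)
      + + 100 * Q * φ * (N - + 10 * (t * t) * T * (tM + len))
    identity = solve-∀

  -- For modules of dimension at least 2 over F_q one has c = q² and k ≤ n/2 ≤ 0.215 q², and 1 -
  -- 0.215 = 0.785.
  scaled-bernoulli : ∀ c s m k → 0ℤ < c → 0ℤ ≤ m → (c - k) * m ≤ c * s → + 200 * k ≤ + 43 * c → + 785 * m ≤ + 1000 * s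
  scaled-bernoulli c s m k 0<c 0≤m bern few = ℤP.*-cancelˡ-≤-pos (+ 785 * m) (+ 1000 * s) c {{ℤ.positive 0<c}}
      (≤-from-difference (+ 1000 * x + + 5 * y) (ring c s m k)
        (+-nonneg {+ 1000 * x} {+ 5 * y} (*-nonneg {+ 1000} {x} (+≤+ ℕ.z≤n) (difference bern))
          (*-nonneg {+ 5} {y} (+≤+ ℕ.z≤n) (*-nonneg {+ 43 * c - + 200 * k} {m} (difference few) 0≤m))))
    where
    x = c * s - (c - k) * m
    y = (+ 43 * c - + 200 * k) * m
    ring : ∀ c s m k → c * (+ 1000 * s) - c * (+ 785 * m) ≡ + 1000 * (c * s - (c - k) * m) + + 5 * ((+ 43 * c - + 200 * k) * m)
    ring = solve-∀

  product-density₁ : ∀ {a b c d} → 0ℤ ≤ b → 0ℤ ≤ c → a ≤ + 2 * c → b ≤ + 4 * d → + 125 * (a * b) ≤ + 1000 * (c * d)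
  product-density₁ {a} {b} {c} {d} 0≤b 0≤c ac bd = ≤-trans (*-monoˡ {+ 125} {a * b} {+ 2 * c * (+ 4 * d)} (+≤+ ℕ.z≤n)
      (≤-trans {a * b} {+ 2 * c * b} (*-monoʳ {b} {a} {+ 2 * c} 0≤b ac) (*-monoˡ {+ 2 * c} {b} {+ 4 * d} (*-nonneg {+ 2} {c} (+≤+ ℕ.z≤n) 0≤c) bd)))
      (≤-reflexive (ring c d))
    where
    ring : ∀ c d → + 125 * (+ 2 * c * (+ 4 * d)) ≡ + 1000 * (c * d)
    ring = solve-∀

  product-density₂ : ∀ {a b c d} → 0ℤ ≤ a → 0ℤ ≤ b → 0ℤ ≤ c → + 785 * a ≤ + 1000 * c → b ≤ + 2 * d → + 392 * (a * b) ≤ + 1000 * (c * d)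
  product-density₂ {a} {b} {c} {d} 0≤a 0≤b 0≤c ac bd = ℤP.*-cancelˡ-≤-pos (+ 392 * (a * b)) (+ 1000 * (c * d)) (+ 2)
      (≤-from-difference (a * b + x * b + + 1000 * c * y) (ring a b c d)
        (+-nonneg {a * b + x * b} {+ 1000 * c * y} (+-nonneg {a * b} {x * b} (*-nonneg {a} {b} 0≤a 0≤b) (*-nonneg {x} {b} (difference ac) 0≤b))
          (*-nonneg {+ 1000 * c} {y} (*-nonneg {+ 1000} {c} (+≤+ ℕ.z≤n) 0≤c) (difference bd))))
    where
    x = + 1000 * c - + 785 * a
    y = + 2 * d - b
    ring : ∀ a b c d → + 2 * (+ 1000 * (c * d)) - + 2 * (+ 392 * (a * b)) ≡ a * b + (+ 1000 * c - + 785 * a) * b + + 1000 * c * (+ 2 * d - b)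
    ring = solve-∀

Range : ℕ → ℕ → Set
Range q n = (¬ (2 ∣ n) × q ℕ.≤ n × n ℕ.≤ q ℕ.* q)
          ⊎ (2 ∣ n × ¬ ((q ℕ.∸ 1) ∣ n) × q ℕ.≤ n × 100 ℕ.* n ℕ.≤ 43 ℕ.* (q ℕ.* q))

-- Characteristic, Frobenius powers and their fixed subfields.

module FrobeniusField {Q : ℕ} (F : FinField Q) (p k q n : ℕ) (p-prime : Prime p)
                      (q≡pᵏ : q ≡ p ℕ.^ k) (Q≡qⁿ : Q ≡ q ℕ.^ n) (1≤n : 1 ℕ.≤ n) (2≤q : 2 ℕ.≤ q) where
  open import Data.Integer using (+_; -[1+_]; 0ℤ; 1ℤ; _+_; _*_; -_; _-_; _≤_; _<_; +≤+; +<+)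
  open FiniteSums
  open FieldBasics F
  open MultiplicativeGroup F

  private
    module FS = Algebra.Properties.CommutativeMonoid.Sum R.+-commutativeMonoid
    module Mul = Algebra.Properties.Semiring.Mult R.semiring
    module Exp = Algebra.Properties.Semiring.Exp R.semiring
    module Bin = Algebra.Properties.CommutativeSemiring.Binomial R.commutativeSemiring

    -- Translation by 1 permutes the field, so it preserves the sum of all elements while adding Q
    -- copies of 1.
    Q×1≡0 : Q Mul.× 1# ≡ 0#
    Q×1≡0 = RP.+-cancelˡ (FS.sum {Q} (λ x → x)) _ _ (begin
      FS.sum {Q} (λ x → x) ⊕ Q Mul.× 1#  ≡⟨ cong (FS.sum {Q} (λ x → x) ⊕_) (FS.sum-replicate Q) ⟨
      FS.sum {Q} (λ x → x) ⊕ FS.sum {Q} (λ x → 1#) ≡⟨ FS.∑-distrib-+ {Q} (λ x → x) (λ _ → 1#) ⟨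
      FS.sum {Q} (λ x → x ⊕ 1#)  ≡⟨ FS.sum-permute (λ x → x) (permutation (_⊕ 1#) (_⊝ 1#)
                                                        (λ x → solve 2 (λ x a → x :- a :+ a := x) refl x 1#)
                                                        (λ x → solve 2 (λ x a → x :+ a :- a := x) refl x 1#)) ⟨
      FS.sum {Q} (λ x → x)  ≡⟨ R.+-identityʳ _ ⟨
      FS.sum {Q} (λ x → x) ⊕ 0#  ∎)
      where open ≡-Reasoning

    pʲ×1 : ∀ j → (p ℕ.^ j) Mul.× 1# ≡ pow (p Mul.× 1#) j
    pʲ×1 zero    = R.+-identityʳ 1#
    pʲ×1 (suc j) = trans (Mul.×1-homo-* p (p ℕ.^ j)) (cong ((p Mul.× 1#) ⊗_) (pʲ×1 j))

    qʲ≡p : ∀ j → q ℕ.^ j ≡ p ℕ.^ (k ℕ.* j)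
    qʲ≡p j = trans (cong (ℕ._^ j) q≡pᵏ) (ℕP.^-*-assoc p k j)

  -- Q is a power of p, so a power of p · 1 is Q · 1 = 0, and a field has no nilpotents.
  characteristic : p Mul.× 1# ≡ 0#
  characteristic with p Mul.× 1# ≟ 0#
  ... | yes eq = eq
  ... | no neq = contradiction (trans (sym (pʲ×1 (k ℕ.* n))) (trans (cong (Mul._× 1#) (sym (trans Q≡qⁿ (qʲ≡p n)))) Q×1≡0)) (pow≢0 (k ℕ.* n) neq)

  private
    multiple≡0 : ∀ m x → p ∣ m → m Mul.× x ≡ 0#
    multiple≡0 m x (divides c refl) = begin
      (c ℕ.* p) Mul.× x  ≡⟨ cong (Mul._× x) (ℕP.*-comm c p) ⟩
      (p ℕ.* c) Mul.× x  ≡⟨ Mul.×-assocˡ x p c ⟨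
      p Mul.× (c Mul.× x)  ≡⟨ cong (p Mul.×_) (R.*-identityˡ _) ⟨
      p Mul.× (1# ⊗ (c Mul.× x))  ≡⟨ Mul.×-assoc-* p 1# _ ⟨
      (p Mul.× 1#) ⊗ (c Mul.× x)  ≡⟨ cong (_⊗ (c Mul.× x)) characteristic ⟩
      0# ⊗ (c Mul.× x)  ≡⟨ R.zeroˡ _ ⟩
      0#  ∎
      where open ≡-Reasoning

    ^≡pow : ∀ x m → x Exp.^ m ≡ pow x m
    ^≡pow x zero    = refl
    ^≡pow x (suc m) = cong (x ⊗_) (^≡pow x m)

    sum≡0 : ∀ {m} (f : Fin m → A) → (∀ i → f i ≡ 0#) → FS.sum f ≡ 0#
    sum≡0 {m} f h = trans (FS.sum-cong-≗ h) (FS.sum-replicate-zero m)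

    pow-p-⊕ : ∀ x y → pow (x ⊕ y) p ≡ pow x p ⊕ pow y p
    pow-p-⊕ x y = go p refl
      where
      open ≡-Reasoning
      go : ∀ m → m ≡ p → pow (x ⊕ y) m ≡ pow x m ⊕ pow y m
      go zero    eq = contradiction (subst Prime (sym eq) p-prime) ¬prime[0]
      go (suc m) eq = begin
        pow (x ⊕ y) (suc m)  ≡⟨ ^≡pow (x ⊕ y) (suc m) ⟨
        (x ⊕ y) Exp.^ suc m  ≡⟨ Bin.theorem (suc m) x y ⟩
        FS.sum t  ≡⟨ cong (t Fin.zero ⊕_) (FS.sum-init-last (t ∘ Fin.suc)) ⟩
        t Fin.zero ⊕ (FS.sum mid ⊕ t (Fin.suc (Fin.fromℕ m)))  ≡⟨ cong₂ (λ a b → a ⊕ (b ⊕ t (Fin.suc (Fin.fromℕ m)))) first (sum≡0 mid mid≡0) ⟩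
        pow y (suc m) ⊕ (0# ⊕ t (Fin.suc (Fin.fromℕ m)))  ≡⟨ cong (pow y (suc m) ⊕_) (trans (R.+-identityˡ _) last′) ⟩
        pow y (suc m) ⊕ pow x (suc m)  ≡⟨ R.+-comm _ _ ⟩
        pow x (suc m) ⊕ pow y (suc m)  ∎
        where
        t : Fin (suc (suc m)) → A
        t = Bin.binomialTerm x y (suc m)
        mid : Fin m → A
        mid i = t (Fin.suc (Fin.inject₁ i))
        first : t Fin.zero ≡ pow y (suc m)
        first = trans (R.+-identityʳ _) (trans (R.*-identityˡ _) (^≡pow y (suc m)))
        last′ : t (Fin.suc (Fin.fromℕ m)) ≡ pow x (suc m)
        last′ rewrite FinP.toℕ-fromℕ m | nCn≡1 (suc m) | ℕP.n∸n≡0 m = trans (R.+-identityʳ _) (trans (R.*-identityʳ _) (^≡pow x (suc m)))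
        mid≡0 : ∀ i → mid i ≡ 0#
        mid≡0 i = multiple≡0 _ _ (subst (λ z → z ∣ (suc m choose suc (Fin.toℕ (Fin.inject₁ i)))) eq
          (prime∣choose (subst Prime (sym eq) p-prime) _ (ℕ.s≤s ℕ.z≤n) (ℕ.s≤s (subst (ℕ._< m) (sym (FinP.toℕ-inject₁ i)) (FinP.toℕ<n i)))))

    pow-pʲ-⊕ : ∀ j x y → pow (x ⊕ y) (p ℕ.^ j) ≡ pow x (p ℕ.^ j) ⊕ pow y (p ℕ.^ j)
    pow-pʲ-⊕ zero    x y = trans (pow-1 _) (sym (cong₂ _⊕_ (pow-1 x) (pow-1 y)))
    pow-pʲ-⊕ (suc j) x y = begin
      pow (x ⊕ y) (p ℕ.* p ℕ.^ j)  ≡⟨ pow-* (x ⊕ y) p (p ℕ.^ j) ⟩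
      pow (pow (x ⊕ y) p) (p ℕ.^ j)  ≡⟨ cong (λ z → pow z (p ℕ.^ j)) (pow-p-⊕ x y) ⟩
      pow (pow x p ⊕ pow y p) (p ℕ.^ j)  ≡⟨ pow-pʲ-⊕ j (pow x p) (pow y p) ⟩
      pow (pow x p) (p ℕ.^ j) ⊕ pow (pow y p) (p ℕ.^ j)  ≡⟨ cong₂ _⊕_ (pow-* x p (p ℕ.^ j)) (pow-* y p (p ℕ.^ j)) ⟨
      pow x (p ℕ.* p ℕ.^ j) ⊕ pow y (p ℕ.* p ℕ.^ j)  ∎
      where open ≡-Reasoning

  1≤q : 1 ℕ.≤ q
  1≤q = subst (1 ℕ.≤_) (sym q≡pᵏ) (ℕP.m^n>0 p {{prime⇒nonZero p-prime}} k)

  1≤qʲ : ∀ j → 1 ℕ.≤ q ℕ.^ j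
  1≤qʲ j = ℕP.m^n>0 q {{ℕ.>-nonZero 1≤q}} j

  frob : ℕ → A → A
  frob j x = pow x (q ℕ.^ j)

  frob-⊕ : ∀ j x y → frob j (x ⊕ y) ≡ frob j x ⊕ frob j y
  frob-⊕ j x y rewrite qʲ≡p j = pow-pʲ-⊕ (k ℕ.* j) x y

  frob-⊗ : ∀ j x y → frob j (x ⊗ y) ≡ frob j x ⊗ frob j y
  frob-⊗ j x y = pow-⊗ x y (q ℕ.^ j)

  frob-0# : ∀ j → frob j 0# ≡ 0#
  frob-0# j = pow-0# (q ℕ.^ j) (1≤qʲ j)

  frob-1# : ∀ j → frob j 1# ≡ 1#
  frob-1# j = pow-1# (q ℕ.^ j)

  frob-⊖ : ∀ j x → frob j (⊖ x) ≡ ⊖ frob j x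
  frob-⊖ j x = RP.+-inverseʳ-unique (frob j x) (frob j (⊖ x))
    (trans (sym (frob-⊕ j x (⊖ x))) (trans (cong (frob j) (R.-‿inverseʳ x)) (frob-0# j)))

  frob-id : ∀ x → frob 0 x ≡ x
  frob-id = pow-1

  frob-+ : ∀ i j x → frob (i ℕ.+ j) x ≡ frob i (frob j x)
  frob-+ i j x = trans (cong (pow x) (trans (ℕP.^-distribˡ-+-* q i j) (ℕP.*-comm (q ℕ.^ i) (q ℕ.^ j)))) (pow-* x (q ℕ.^ j) (q ℕ.^ i))

  frob-comm : ∀ i j x → frob i (frob j x) ≡ frob j (frob i x)
  frob-comm i j x = trans (sym (frob-+ i j x)) (trans (cong (λ m → frob m x) (ℕP.+-comm i j)) (frob-+ j i x))

  frob-n : ∀ x → frob n x ≡ x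
  frob-n x with x ≟ 0#
  ... | yes refl = frob-0# n
  ... | no x≢0   = trans (cong (pow x) (trans (sym Q≡qⁿ) Q≡1+N)) (trans (cong (x ⊗_) (pow-N x≢0)) (R.*-identityʳ x))

  frob≡0 : ∀ j {x} → frob j x ≡ 0# → x ≡ 0#
  frob≡0 j {x} eq with x ≟ 0#
  ... | yes p = p
  ... | no x≢0 = contradiction eq (pow≢0 (q ℕ.^ j) x≢0)

  frob-fixed-* : ∀ l i {x} → frob l x ≡ x → frob (i ℕ.* l) x ≡ x
  frob-fixed-* l zero    {x} eq = frob-id x
  frob-fixed-* l (suc i) {x} eq = trans (frob-+ l (i ℕ.* l) x) (trans (cong (frob l) (frob-fixed-* l i eq)) eq)

  InK : ℕ → A → Set
  InK l c = frob l c ≡ c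

  K? : ∀ l c → Dec (InK l c)
  K? l c = frob l c ≟ c

  module _ {l : ℕ} where
    K-0# : InK l 0#
    K-0# = frob-0# l

    K-1# : InK l 1#
    K-1# = frob-1# l

    K-⊕ : ∀ {a b} → InK l a → InK l b → InK l (a ⊕ b)
    K-⊕ {a} {b} ka kb = trans (frob-⊕ l a b) (cong₂ _⊕_ ka kb)

    K-⊗ : ∀ {a b} → InK l a → InK l b → InK l (a ⊗ b)
    K-⊗ {a} {b} ka kb = trans (frob-⊗ l a b) (cong₂ _⊗_ ka kb)

    K-⊖ : ∀ {a} → InK l a → InK l (⊖ a)
    K-⊖ {a} ka = trans (frob-⊖ l a) (cong ⊖_ ka)

    K-inverse : ∀ {a b} → a ≢ 0# → InK l a → a ⊗ b ≡ 1# → InK l b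
    K-inverse {a} {b} a≢0 ka ab≡1 = ⊗-cancelˡ a≢0
      (trans (cong (_⊗ frob l b) (sym ka)) (trans (sym (frob-⊗ l a b)) (trans (cong (frob l) ab≡1) (trans K-1# (sym ab≡1)))))

  K₁⊆K : ∀ l {c} → InK 1 c → InK l c
  K₁⊆K l {c} kc = subst (λ m → frob m c ≡ c) (ℕP.*-identityʳ l) (frob-fixed-* 1 l kc)

  -- The nonzero elements of K_l are the (q^l - 1)-th roots of unity, and q^l - 1 divides q^n - 1 =
  -- N.
  count-K : ∀ l m → 1 ℕ.≤ l → l ℕ.* m ≡ n → ∑ (λ x → ind (K? l x)) ≡ + (q ℕ.^ l)
  count-K l m 1≤l lm≡n = begin
      ∑ (λ x → ind (K? l x))  ≡⟨ ∑-cong split ⟩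
      ∑ (λ x → ind (x ≟ 0#) * 1ℤ + ind (pow x e ≟ 1#))  ≡⟨ ∑-+ _ _ ⟩
      ∑ (λ x → ind (x ≟ 0#) * 1ℤ) + ∑ (λ x → ind (pow x e ≟ 1#))  ≡⟨ cong₂ _+_ (∑-δ 0# (λ _ → 1ℤ)) (count-pow≡1 e 1≤e (proj₁ factor) (proj₂ factor)) ⟩
      + suc e  ≡⟨ cong +_ (sym qˡ≡1+e) ⟩
      + (q ℕ.^ l)  ∎
    where
    open ≡-Reasoning
    e = q ℕ.^ l ℕ.∸ 1
    qˡ≡1+e : q ℕ.^ l ≡ suc e
    qˡ≡1+e = sym (ℕP.m+[n∸m]≡n (1≤qʲ l))
    1≤e : 1 ℕ.≤ e
    1≤e = ℕP.∸-monoˡ-≤ {2} {q ℕ.^ l} 1 (ℕP.≤-trans 2≤q (subst (ℕ._≤ q ℕ.^ l) (ℕP.*-identityʳ q) (ℕP.^-monoʳ-≤ q {{ℕ.>-nonZero 1≤q}} 1≤l)))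
    factor : ∃ λ c → e ℕ.* c ≡ N
    factor with b-1∣bᵐ-1 e m
    ... | c , eq = c , sym (cong (ℕ._∸ 1) (trans Q≡qⁿ (trans (cong (q ℕ.^_) (sym lm≡n)) (trans (sym (ℕP.^-*-assoc q l m)) (trans (cong (ℕ._^ m) qˡ≡1+e) eq)))))
    frob≡ : ∀ x → frob l x ≡ x ⊗ pow x e
    frob≡ x = cong (pow x) qˡ≡1+e
    split : ∀ x → ind (K? l x) ≡ ind (x ≟ 0#) * 1ℤ + ind (pow x e ≟ 1#)
    split x with x ≟ 0#
    ... | yes refl = trans (ind-yes (K? l 0#) (frob-0# l)) (cong (λ z → 1ℤ + z) (sym (ind-no (pow 0# e ≟ 1#) (λ eq → 1≢0 (trans (sym eq) (pow-0# e 1≤e))))))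
    ... | no x≢0 = trans (ind-cong (K? l x) (pow x e ≟ 1#)
        (λ h → ⊗-cancelˡ x≢0 (trans (sym (frob≡ x)) (trans h (sym (R.*-identityʳ x)))))
        (λ h → trans (frob≡ x) (trans (cong (x ⊗_) h) (R.*-identityʳ x)))) (sym (ℤP.+-identityˡ _))

  -- The trace to F_q and its nondegeneracy.

  sumN : ℕ → (ℕ → A) → A
  sumN zero    f = 0#
  sumN (suc m) f = sumN m f ⊕ f m

  sumN-cong : ∀ m {f g} → (∀ i → f i ≡ g i) → sumN m f ≡ sumN m g
  sumN-cong zero    h = refl
  sumN-cong (suc m) h = cong₂ _⊕_ (sumN-cong m h) (h m)

  sumN-⊕ : ∀ m f g → sumN m (λ i → f i ⊕ g i) ≡ sumN m f ⊕ sumN m g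
  sumN-⊕ zero    f g = sym (R.+-identityʳ 0#)
  sumN-⊕ (suc m) f g = trans (cong (_⊕ (f m ⊕ g m)) (sumN-⊕ m f g))
    (solve 4 (λ a b c d → a :+ b :+ (c :+ d) := a :+ c :+ (b :+ d)) refl (sumN m f) (sumN m g) (f m) (g m))

  sumN-⊗ : ∀ m c f → sumN m (λ i → c ⊗ f i) ≡ c ⊗ sumN m f
  sumN-⊗ zero    c f = sym (R.zeroʳ c)
  sumN-⊗ (suc m) c f = trans (cong (_⊕ (c ⊗ f m)) (sumN-⊗ m c f)) (sym (R.distribˡ c _ _))

  sumN-suc : ∀ m f → sumN (suc m) f ≡ f 0 ⊕ sumN m (f ∘ suc)
  sumN-suc zero    f = R.+-comm _ _
  sumN-suc (suc m) f = trans (cong (_⊕ f (suc m)) (sumN-suc m f)) (R.+-assoc _ _ _)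

  frob-sumN : ∀ j m f → frob j (sumN m f) ≡ sumN m (λ i → frob j (f i))
  frob-sumN j zero    f = frob-0# j
  frob-sumN j (suc m) f = trans (frob-⊕ j (sumN m f) (f m)) (cong (_⊕ frob j (f m)) (frob-sumN j m f))

  Tr : A → A
  Tr x = sumN n (λ i → frob i x)

  Tr-⊕ : ∀ x y → Tr (x ⊕ y) ≡ Tr x ⊕ Tr y
  Tr-⊕ x y = trans (sumN-cong n (λ i → frob-⊕ i x y)) (sumN-⊕ n _ _)

  Tr-⊗ : ∀ {c} x → InK 1 c → Tr (c ⊗ x) ≡ c ⊗ Tr x
  Tr-⊗ {c} x kc = trans (sumN-cong n (λ i → trans (frob-⊗ i c x) (cong (_⊗ frob i x) (K₁⊆K i kc)))) (sumN-⊗ n c _)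

  Tr-0# : Tr 0# ≡ 0#
  Tr-0# = RP.+-cancelˡ (Tr 0#) _ _ (trans (sym (Tr-⊕ 0# 0#)) (trans (cong Tr (R.+-identityʳ 0#)) (sym (R.+-identityʳ _))))

  Tr-⊖ : ∀ x → Tr (⊖ x) ≡ ⊖ Tr x
  Tr-⊖ x = RP.+-inverseʳ-unique (Tr x) (Tr (⊖ x)) (trans (sym (Tr-⊕ x (⊖ x))) (trans (cong Tr (R.-‿inverseʳ x)) Tr-0#))

  Tr∈K : ∀ x → InK 1 (Tr x)
  Tr∈K x = RP.+-cancelˡ x _ _ (begin
    x ⊕ frob 1 (Tr x)  ≡⟨ cong₂ _⊕_ (sym (frob-id x)) (trans (frob-sumN 1 n _) (sumN-cong n (λ i → sym (frob-+ 1 i x)))) ⟩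
    frob 0 x ⊕ sumN n (λ i → frob (suc i) x)  ≡⟨ sumN-suc n (λ i → frob i x) ⟨
    Tr x ⊕ frob n x  ≡⟨ cong (Tr x ⊕_) (frob-n x) ⟩
    Tr x ⊕ x  ≡⟨ R.+-comm _ _ ⟩
    x ⊕ Tr x  ∎)
    where open ≡-Reasoning

  Tr-frob : ∀ j x → Tr (frob j x) ≡ Tr x
  Tr-frob j x = trans (sumN-cong n (λ i → frob-comm i j x)) (trans (sym (frob-sumN j n _)) (K₁⊆K j (Tr∈K x)))

  q^-mono : ∀ {i j} → i ℕ.≤ j → q ℕ.^ i ℕ.≤ q ℕ.^ j
  q^-mono = ℕP.^-monoʳ-≤ q {{ℕ.>-nonZero 1≤q}}

  q^-mono-< : ∀ {i j} → i ℕ.< j → q ℕ.^ i ℕ.< q ℕ.^ j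
  q^-mono-< = ℕP.^-monoʳ-< q 2≤q

  private
    Low-frobs : ∀ m → Low (q ℕ.^ m) (λ x → sumN m (λ i → frob i x))
    Low-frobs zero    = Low-0 1 (λ x → refl)
    Low-frobs (suc m) = Low-⊕ (q ℕ.^ suc m) (Low-≤ (q^-mono (ℕP.n≤1+n m)) (Low-frobs m)) (Low-≤ (q^-mono-< (ℕP.n<1+n m)) (Low-pow (q ℕ.^ m)))

  all-roots : ∀ {f : A → A} → (∀ x → f x ≡ 0#) → roots f ≡ + Q
  all-roots {f} h = trans (∑-cong (λ x → ind-yes (f x ≟ 0#) (h x))) (trans (∑-const Q 1ℤ) (ℤP.*-identityʳ (+ Q)))

  -- As a polynomial function the trace is monic of degree q^(n-1), which is too few roots for all
  -- q^n elements.
  Tr-nonzero : ∃ λ x → Tr x ≢ 0#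
  Tr-nonzero with FinP.any? (λ x → ¬? (Tr x ≟ 0#))
  ... | yes p = p
  ... | no ¬p = contradiction (all-roots {Tr} Tr≡0) (λ eq → ℕP.<⇒≱ (q^-mono-< (n∸1<n)) (subst (ℕ._≤ q ℕ.^ (n ℕ.∸ 1)) Q≡qⁿ (ℤP.drop‿+≤+ (subst (_≤ + (q ℕ.^ (n ℕ.∸ 1))) eq (roots-≤ _ monic)))))
    where
    n≡ : n ≡ suc (n ℕ.∸ 1)
    n≡ = sym (ℕP.m+[n∸m]≡n 1≤n)
    n∸1<n : n ℕ.∸ 1 ℕ.< n
    n∸1<n = subst (n ℕ.∸ 1 ℕ.<_) (sym n≡) (ℕP.n<1+n _)
    Tr≡0 : ∀ x → Tr x ≡ 0#
    Tr≡0 x with Tr x ≟ 0#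
    ... | yes e = e
    ... | no ¬e = contradiction (x , ¬e) ¬p
    monic : Monic (q ℕ.^ (n ℕ.∸ 1)) Tr
    monic = _ , Low-frobs (n ℕ.∸ 1) , λ x → trans (cong (λ m → sumN m (λ i → frob i x)) n≡) (R.+-comm _ _)

  dual : ∀ {z} → z ≢ 0# → ∃ λ a → Tr (a ⊗ z) ≡ 1#
  dual {z} z≢0 with Tr-nonzero
  ... | t , Trt≢0 with inverse z z≢0 | inverse (Tr t) Trt≢0
  ...   | y , zy≡1 | s , ts≡1 = s ⊗ t ⊗ y , trans (cong Tr eq) (trans (Tr-⊗ t (K-inverse {1} Trt≢0 (Tr∈K t) ts≡1)) (trans (R.*-comm s (Tr t)) ts≡1))
    where
    eq : s ⊗ t ⊗ y ⊗ z ≡ s ⊗ t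
    eq = trans (R.*-assoc (s ⊗ t) y z) (trans (cong (s ⊗ t ⊗_) (trans (R.*-comm y z) zy≡1)) (R.*-identityʳ _))

  nondegenerate : ∀ {z} → (∀ a → Tr (a ⊗ z) ≡ 0#) → z ≡ 0#
  nondegenerate {z} h with z ≟ 0#
  ... | yes p = p
  ... | no ¬p = let (a , eq) = dual ¬p in contradiction (trans (sym eq) (h a)) 1≢0

  -- Choose a₀ with Tr(a₀ x) = 1 and put c = Tr(a₀ y). If every a with Tr(a x) = 0 also had Tr(a y)
  -- = 0, then applying this to a - Tr(a x) a₀ would give Tr(a y) = Tr(a x) c for all a, and y = c x
  -- by nondegeneracy.
  dual-pair : ∀ {x y} → x ≢ 0# → (∀ c → InK 1 c → y ≢ c ⊗ x) → ∃ λ a → Tr (a ⊗ x) ≡ 0# × Tr (a ⊗ y) ≡ 1#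
  dual-pair {x} {y} x≢0 indep with FinP.any? (λ a → (Tr (a ⊗ x) ≟ 0#) ×-dec ¬? (Tr (a ⊗ y) ≟ 0#))
  ... | yes (a , ax≡0 , ay≢0) = let (s , ts≡1) = inverse (Tr (a ⊗ y)) ay≢0
                                    ks = K-inverse {1} ay≢0 (Tr∈K _) ts≡1 in
    s ⊗ a , trans (cong Tr (R.*-assoc s a x)) (trans (Tr-⊗ _ ks) (trans (cong (s ⊗_) ax≡0) (R.zeroʳ s)))
          , trans (cong Tr (R.*-assoc s a y)) (trans (Tr-⊗ _ ks) (trans (R.*-comm s _) ts≡1))
  ... | no ¬p = contradiction (⊝≡0⇒≡ (nondegenerate all0)) (indep c (Tr∈K _))
    where
    a₀ = proj₁ (dual x≢0)
    c = Tr (a₀ ⊗ y)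
    kills : ∀ a → Tr (a ⊗ x) ≡ 0# → Tr (a ⊗ y) ≡ 0#
    kills a ax≡0 with Tr (a ⊗ y) ≟ 0#
    ... | yes e = e
    ... | no ¬e = contradiction (a , ax≡0 , ¬e) ¬p
    open ≡-Reasoning
    shift : ∀ a z → Tr ((a ⊝ Tr (a ⊗ x) ⊗ a₀) ⊗ z) ≡ Tr (a ⊗ z) ⊝ Tr (a ⊗ x) ⊗ Tr (a₀ ⊗ z)
    shift a z = begin
      Tr ((a ⊝ t ⊗ a₀) ⊗ z)  ≡⟨ cong Tr (solve 4 (λ a t b z → (a :- t :* b) :* z := a :* z :- t :* (b :* z)) refl a t a₀ z) ⟩
      Tr (a ⊗ z ⊝ t ⊗ (a₀ ⊗ z))  ≡⟨ Tr-⊕ _ _ ⟩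
      Tr (a ⊗ z) ⊕ Tr (⊖ (t ⊗ (a₀ ⊗ z)))  ≡⟨ cong (Tr (a ⊗ z) ⊕_) (trans (Tr-⊖ _) (cong ⊖_ (Tr-⊗ _ (Tr∈K _)))) ⟩
      Tr (a ⊗ z) ⊝ t ⊗ Tr (a₀ ⊗ z)  ∎
      where t = Tr (a ⊗ x)
    proportional : ∀ a → Tr (a ⊗ y) ≡ Tr (a ⊗ x) ⊗ c
    proportional a = ⊝≡0⇒≡ (trans (sym (shift a y)) (kills _ (trans (shift a x)
      (trans (cong (λ s → Tr (a ⊗ x) ⊝ Tr (a ⊗ x) ⊗ s) (proj₂ (dual x≢0))) (trans (cong (Tr (a ⊗ x) ⊝_) (R.*-identityʳ _)) (R.-‿inverseʳ _))))))
    all0 : ∀ a → Tr (a ⊗ (y ⊝ c ⊗ x)) ≡ 0#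
    all0 a = begin
      Tr (a ⊗ (y ⊝ c ⊗ x))  ≡⟨ cong Tr (solve 4 (λ a y c x → a :* (y :- c :* x) := a :* y :- c :* (a :* x)) refl a y c x) ⟩
      Tr (a ⊗ y ⊝ c ⊗ (a ⊗ x))  ≡⟨ Tr-⊕ _ _ ⟩
      Tr (a ⊗ y) ⊕ Tr (⊖ (c ⊗ (a ⊗ x)))  ≡⟨ cong (Tr (a ⊗ y) ⊕_) (trans (Tr-⊖ _) (cong ⊖_ (Tr-⊗ _ (Tr∈K _)))) ⟩
      Tr (a ⊗ y) ⊝ c ⊗ Tr (a ⊗ x)  ≡⟨ cong₂ _⊝_ (proportional a) (R.*-comm c _) ⟩
      Tr (a ⊗ x) ⊗ c ⊝ Tr (a ⊗ x) ⊗ c  ≡⟨ R.-‿inverseʳ _ ⟩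
      0#  ∎

  -- The integer-valued substitute for the nontrivial additive characters of K₁: it has mean 0 over K₁.
  w : A → ℤ
  w t = + q * ind (t ≟ 0#) - 1ℤ

  w-0 : ∀ {t} → t ≡ 0# → w t ≡ + q - 1ℤ
  w-0 {t} t≡0 = cong (_- 1ℤ) (trans (cong (λ s → + q * s) (ind-yes (t ≟ 0#) t≡0)) (ℤP.*-identityʳ (+ q)))

  0≤q-1 : 0ℤ ≤ + q - 1ℤ
  0≤q-1 = difference (+≤+ 1≤q)

  q-1>0 : 0ℤ < + q - 1ℤ
  q-1>0 = subst (0ℤ <_) (sym (ℤP.⊖-≥ 1≤q)) (+<+ (ℕP.m<n⇒0<n∸m 2≤q))

  count-K₁ : ∑ (λ c → ind (K? 1 c)) ≡ + q
  count-K₁ = trans (count-K 1 n ℕP.≤-refl (ℕP.*-identityˡ n)) (cong +_ (ℕP.*-identityʳ q))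

  ∑-w : ∀ {t} → InK 1 t → ∑ (λ c → ind (K? 1 c) * w (t ⊕ c)) ≡ 0ℤ
  ∑-w {t} kt = begin
    ∑ (λ c → ind (K? 1 c) * w (t ⊕ c))  ≡⟨ ∑-cong (λ c → ring (ind (K? 1 c)) (+ q) (ind (t ⊕ c ≟ 0#))) ⟩
    ∑ (λ c → + q * (ind (t ⊕ c ≟ 0#) * ind (K? 1 c)) + - 1ℤ * ind (K? 1 c))  ≡⟨ ∑-+ _ _ ⟩
    ∑ (λ c → + q * (ind (t ⊕ c ≟ 0#) * ind (K? 1 c))) + ∑ (λ c → - 1ℤ * ind (K? 1 c))
        ≡⟨ cong₂ _+_ (trans (∑-*ˡ (+ q) _) (cong (λ s → + q * s) one)) (trans (∑-*ˡ (- 1ℤ) _) (cong (λ s → - 1ℤ * s) count-K₁)) ⟩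
    + q * 1ℤ + - 1ℤ * + q  ≡⟨ ring′ (+ q) ⟩
    0ℤ  ∎
    where
    open ≡-Reasoning
    ring : ∀ i q d → i * (q * d - 1ℤ) ≡ q * (d * i) + - 1ℤ * i
    ring = solve-∀
    ring′ : ∀ q → q * 1ℤ + - 1ℤ * q ≡ 0ℤ
    ring′ = solve-∀
    one : ∑ (λ c → ind (t ⊕ c ≟ 0#) * ind (K? 1 c)) ≡ 1ℤ
    one = trans (∑-cong (λ c → cong (_* ind (K? 1 c)) (ind-cong (t ⊕ c ≟ 0#) (c ≟ ⊖ t) (RP.+-inverseʳ-unique t c) (λ { refl → R.-‿inverseʳ t }))))
      (trans (∑-δ (⊖ t) (λ c → ind (K? 1 c))) (ind-yes (K? 1 (⊖ t)) (K-⊖ {1} kt)))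

  -- Averaging over the line K₁ z₀ replaces w by its mean over K₁, which is 0.
  cancellation : ∀ (g : A → ℤ) (λ′ : A → A) z₀ → (∀ z → InK 1 (λ′ z)) →
                 (∀ c z → InK 1 c → g (z ⊕ c ⊗ z₀) ≡ g z) →
                 (∀ c z → InK 1 c → λ′ (z ⊕ c ⊗ z₀) ≡ λ′ z ⊕ c) →
                 ∑ (λ z → g z * w (λ′ z)) ≡ 0ℤ
  cancellation g λ′ z₀ λ∈K g-inv λ-shift = ℤP.*-cancelˡ-≡ (+ q) _ _ {{ℕ.>-nonZero 1≤q}} (begin
    + q * ∑ (λ z → g z * w (λ′ z))  ≡⟨ cong (_* S) count-K₁ ⟨
    ∑ (λ c → ind (K? 1 c)) * S  ≡⟨ ∑-*ʳ S _ ⟨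
    ∑ (λ c → ind (K? 1 c) * S)  ≡⟨ ∑-cong shifted ⟩
    ∑ (λ c → ∑ (λ z → g z * (ind (K? 1 c) * w (λ′ z ⊕ c))))  ≡⟨ ∑-swap _ ⟩
    ∑ (λ z → ∑ (λ c → g z * (ind (K? 1 c) * w (λ′ z ⊕ c))))  ≡⟨ ∑-0 (λ z → trans (∑-*ˡ (g z) _) (trans (cong (g z *_) (∑-w (λ∈K z))) (ℤP.*-zeroʳ (g z)))) ⟩
    0ℤ  ≡⟨ ℤP.*-zeroʳ (+ q) ⟨
    + q * 0ℤ  ∎)
    where
    open ≡-Reasoning
    S = ∑ (λ z → g z * w (λ′ z))
    ring : ∀ a b c → a * (b * c) ≡ b * (a * c)
    ring = solve-∀
    shifted : ∀ c → ind (K? 1 c) * S ≡ ∑ (λ z → g z * (ind (K? 1 c) * w (λ′ z ⊕ c)))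
    shifted c = trans (cong (ind (K? 1 c) *_) (sym (∑-⊕ (λ z → g z * w (λ′ z)) (c ⊗ z₀))))
      (trans (sym (∑-*ˡ (ind (K? 1 c)) _)) (∑-cong step))
      where
      step : ∀ z → ind (K? 1 c) * (g (z ⊕ c ⊗ z₀) * w (λ′ (z ⊕ c ⊗ z₀))) ≡ g z * (ind (K? 1 c) * w (λ′ z ⊕ c))
      step z with K? 1 c
      ... | yes kc = trans (ring 1ℤ (g (z ⊕ c ⊗ z₀)) (w (λ′ (z ⊕ c ⊗ z₀)))) (cong₂ (λ a b → a * (1ℤ * w b)) (g-inv c z kc) (λ-shift c z kc))
      ... | no _   = ring 0ℤ (g z) (w (λ′ z ⊕ c))

  -- Subspaces over F_q and their orthogonal complements.

  record Subspace : Set₁ where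
    field
      Mem  : A → Set
      mem? : ∀ z → Dec (Mem z)
      0∈   : Mem 0#
      ⊕∈   : ∀ {y z} → Mem y → Mem z → Mem (y ⊕ z)
      ⊗∈   : ∀ {c z} → InK 1 c → Mem z → Mem (c ⊗ z)

    ⊖∈ : ∀ {z} → Mem z → Mem (⊖ z)
    ⊖∈ {z} z∈ = subst Mem (RP.-1*x≈-x z) (⊗∈ (K-⊖ {1} (K-1# {1})) z∈)

  module _ where
    open Subspace

    size : Subspace → ℤ
    size M = ∑ (λ z → ind (mem? M z))

    infix 4 _⟂_ _⟂?_
    _⟂_ : A → Subspace → Set
    x ⟂ M = ∀ z → Mem M z → Tr (z ⊗ x) ≡ 0#

    _⟂?_ : ∀ x M → Dec (x ⟂ M)
    x ⟂? M = FinP.all? (λ z → mem? M z →-dec (Tr (z ⊗ x) ≟ 0#))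

    not-⟂ : ∀ {x} M → ¬ (x ⟂ M) → ∃ λ z → Mem M z × Tr (z ⊗ x) ≡ 1#
    not-⟂ {x} M ¬⟂ with FinP.any? (λ z → mem? M z ×-dec ¬? (Tr (z ⊗ x) ≟ 0#))
    ... | no ¬p = contradiction (λ z z∈ → vanish z z∈) ¬⟂
      where
      vanish : ∀ z → Mem M z → Tr (z ⊗ x) ≡ 0#
      vanish z z∈ with Tr (z ⊗ x) ≟ 0#
      ... | yes e = e
      ... | no ¬e = contradiction (z , z∈ , ¬e) ¬p
    ... | yes (z , z∈ , t≢0) with inverse (Tr (z ⊗ x)) t≢0
    ...   | s , ts≡1 = s ⊗ z , ⊗∈ M ks z∈ , trans (cong Tr (R.*-assoc s z x)) (trans (Tr-⊗ _ ks) (trans (R.*-comm s _) ts≡1))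
      where ks = K-inverse {1} t≢0 (Tr∈K _) ts≡1

    Tr-shift : ∀ x z₀ → Tr (z₀ ⊗ x) ≡ 1# → ∀ c z → InK 1 c → Tr ((z ⊕ c ⊗ z₀) ⊗ x) ≡ Tr (z ⊗ x) ⊕ c
    Tr-shift x z₀ t≡1 c z kc = begin
      Tr ((z ⊕ c ⊗ z₀) ⊗ x)  ≡⟨ cong Tr (solve 4 (λ z c y x → (z :+ c :* y) :* x := z :* x :+ c :* (y :* x)) refl z c z₀ x) ⟩
      Tr (z ⊗ x ⊕ c ⊗ (z₀ ⊗ x))  ≡⟨ Tr-⊕ _ _ ⟩
      Tr (z ⊗ x) ⊕ Tr (c ⊗ (z₀ ⊗ x))  ≡⟨ cong (Tr (z ⊗ x) ⊕_) (trans (Tr-⊗ _ kc) (trans (cong (c ⊗_) t≡1) (R.*-identityʳ c))) ⟩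
      Tr (z ⊗ x) ⊕ c  ∎
      where open ≡-Reasoning

    -- If x is orthogonal to M, every weight is q - 1. Otherwise some z₀ in M has Tr(z₀ x) = 1, and
    -- averaging along its line gives 0.
    orthogonality : ∀ M x → ∑ (λ z → ind (mem? M z) * w (Tr (z ⊗ x))) ≡ size M * ((+ q - 1ℤ) * ind (x ⟂? M))
    orthogonality M x with x ⟂? M
    ... | yes ⟂ = trans (∑-cong term) (trans (∑-*ʳ (+ q - 1ℤ) _) (cong (size M *_) (sym (ℤP.*-identityʳ (+ q - 1ℤ)))))
      where
      term : ∀ z → ind (mem? M z) * w (Tr (z ⊗ x)) ≡ ind (mem? M z) * (+ q - 1ℤ)
      term z with mem? M z
      ... | yes z∈ = cong (1ℤ *_) (w-0 (⟂ z z∈))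
      ... | no _   = refl
    ... | no ¬⟂ with not-⟂ M ¬⟂
    ...   | z₀ , z₀∈ , t≡1 = trans (cancellation (λ z → ind (mem? M z)) (λ z → Tr (z ⊗ x)) z₀ (λ z → Tr∈K _)
              (λ c z kc → ind-cong (mem? M (z ⊕ c ⊗ z₀)) (mem? M z)
                (λ h → subst (Mem M) (solve 3 (λ z c y → z :+ c :* y :+ :- (c :* y) := z) refl z c z₀) (⊕∈ M h (⊖∈ M (⊗∈ M kc z₀∈))))
                (λ h → ⊕∈ M h (⊗∈ M kc z₀∈)))
              (Tr-shift x z₀ t≡1)) (sym (trans (cong (size M *_) (ℤP.*-zeroʳ (+ q - 1ℤ))) (ℤP.*-zeroʳ (size M))))

    ∑-w-Tr : ∀ z → ∑ (λ x → w (Tr (z ⊗ x))) ≡ ind (z ≟ 0#) * (+ Q * (+ q - 1ℤ))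
    ∑-w-Tr z with z ≟ 0#
    ... | yes refl = trans (∑-cong (λ x → w-0 (trans (cong Tr (R.zeroˡ x)) Tr-0#))) (trans (∑-const Q _) (sym (ℤP.*-identityˡ _)))
    ... | no z≢0 = let (a , t≡1) = dual z≢0 in
      trans (∑-cong (λ x → trans (cong (w ∘ Tr) (R.*-comm z x)) (sym (ℤP.*-identityˡ _))))
        (cancellation (λ _ → 1ℤ) (λ x → Tr (x ⊗ z)) a (λ _ → Tr∈K _) (λ _ _ _ → refl) (Tr-shift z a t≡1))

    -- Sum `orthogonality` over x and exchange the sums: only z = 0 contributes.
    perp-size : ∀ M → size M * ∑ (λ x → ind (x ⟂? M)) ≡ + Q
    perp-size M = ℤP.*-cancelˡ-≡ (+ q - 1ℤ) _ _ {{ℤ.>-nonZero q-1>0}} (begin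
      r * (size M * ∑ (λ x → ind (x ⟂? M)))  ≡⟨ ring r (size M) _ ⟩
      size M * (r * ∑ (λ x → ind (x ⟂? M)))  ≡⟨ cong (size M *_) (∑-*ˡ r _) ⟨
      size M * ∑ (λ x → r * ind (x ⟂? M))  ≡⟨ ∑-*ˡ (size M) _ ⟨
      ∑ (λ x → size M * (r * ind (x ⟂? M)))  ≡⟨ ∑-cong (λ x → orthogonality M x) ⟨
      ∑ (λ x → ∑ (λ z → ind (mem? M z) * w (Tr (z ⊗ x))))  ≡⟨ ∑-swap _ ⟩
      ∑ (λ z → ∑ (λ x → ind (mem? M z) * w (Tr (z ⊗ x))))  ≡⟨ ∑-cong (λ z → trans (∑-*ˡ (ind (mem? M z)) _) (trans (cong (ind (mem? M z) *_) (∑-w-Tr z)) (ring (ind (mem? M z)) (ind (z ≟ 0#)) _))) ⟩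
      ∑ (λ z → ind (z ≟ 0#) * (ind (mem? M z) * (+ Q * r)))  ≡⟨ ∑-δ 0# _ ⟩
      ind (mem? M 0#) * (+ Q * r)  ≡⟨ cong (_* (+ Q * r)) (ind-yes (mem? M 0#) (0∈ M)) ⟩
      1ℤ * (+ Q * r)  ≡⟨ ring′ (+ Q) r ⟩
      r * + Q  ∎)
      where
      open ≡-Reasoning
      r = + q - 1ℤ
      ring : ∀ a b c → a * (b * c) ≡ b * (a * c)
      ring = solve-∀
      ring′ : ∀ a b → 1ℤ * (a * b) ≡ b * a
      ring′ = solve-∀

    w-product-≤ : ∀ s t → w s * w t ≤ (+ q - 1ℤ) * (+ q - 1ℤ)
    w-product-≤ s t = go (s ≟ 0#) (t ≟ 0#)
      where
      r = + q - 1ℤ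
      1≤r : 1ℤ ≤ r
      1≤r = ℤP.i<j⇒suc[i]≤j q-1>0
      1≤rr : 1ℤ ≤ r * r
      1≤rr = ≤-trans 1≤r (subst (_≤ r * r) (ℤP.*-identityʳ r) (*-monoˡ {r} 0≤q-1 1≤r))
      ring1 : ∀ q → (q * 1ℤ - 1ℤ) * (q * 1ℤ - 1ℤ) ≡ (q - 1ℤ) * (q - 1ℤ)
      ring1 = solve-∀
      ring2 : ∀ q → (q * 1ℤ - 1ℤ) * (q * 0ℤ - 1ℤ) ≡ - (q - 1ℤ)
      ring2 = solve-∀
      ring3 : ∀ q → (q * 0ℤ - 1ℤ) * (q * 1ℤ - 1ℤ) ≡ - (q - 1ℤ)
      ring3 = solve-∀
      ring4 : ∀ q → (q * 0ℤ - 1ℤ) * (q * 0ℤ - 1ℤ) ≡ 1ℤ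
      ring4 = solve-∀
      -r≤rr : - r ≤ r * r
      -r≤rr = ≤-trans (ℤP.neg-mono-≤ 0≤q-1) (square-nonneg r)
      go : ∀ {P P′ : Set} (d : Dec P) (d′ : Dec P′) → (+ q * ind d - 1ℤ) * (+ q * ind d′ - 1ℤ) ≤ r * r
      go (yes _) (yes _) = ≤-reflexive (ring1 (+ q))
      go (yes _) (no _)  = ≤-trans (≤-reflexive (ring2 (+ q))) -r≤rr
      go (no _)  (yes _) = ≤-trans (≤-reflexive (ring3 (+ q))) -r≤rr
      go (no _)  (no _)  = ≤-trans (≤-reflexive (ring4 (+ q))) 1≤rr

    line? : ∀ x y → Dec (∃ λ c → InK 1 c × y ≡ c ⊗ x)
    line? x y = FinP.any? (λ c → K? 1 c ×-dec (y ≟ c ⊗ x))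

    line-size : ∀ x → ∑ (λ y → ind (line? x y)) ≤ + q
    line-size x = ≤-trans (∑-mono bound) (≤-reflexive (trans (∑-swap _) (trans (∑-cong (λ c → trans (∑-δ (c ⊗ x) (λ _ → ind (K? 1 c))) refl)) count-K₁)))
      where
      bound : ∀ y → ind (line? x y) ≤ ∑ (λ c → ind (y ≟ c ⊗ x) * ind (K? 1 c))
      bound y with line? x y
      ... | no _ = ∑-nonneg (λ c → *-nonneg (0≤ind (y ≟ c ⊗ x)) (0≤ind (K? 1 c)))
      ... | yes (c , kc , y≡) = ≤-trans (≤-reflexive (sym (cong₂ _*_ (ind-yes (y ≟ c ⊗ x) y≡) (ind-yes (K? 1 c) kc))))
              (term≤∑ (λ c → *-nonneg (0≤ind (y ≟ c ⊗ x)) (0≤ind (K? 1 c))) c)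

    moment : ℤ
    moment = + Q * ((+ q - 1ℤ) * (+ q - 1ℤ))

    -- Off the line of x, `dual-pair` supplies a direction in which Tr(a x) is constant while Tr(a
    -- y) runs through K₁, so the second factor averages to 0. On the line the trivial bound is
    -- used.
    correlation-≤ : ∀ {x} y → x ≢ 0# → ∑ (λ a → w (Tr (a ⊗ x)) * w (Tr (a ⊗ y))) ≤ ind (line? x y) * moment
    correlation-≤ {x} y x≢0 with line? x y
    ... | yes _ = ≤-trans (∑-mono (λ a → w-product-≤ (Tr (a ⊗ x)) (Tr (a ⊗ y)))) (≤-reflexive (trans (∑-const Q _) (sym (ℤP.*-identityˡ moment))))
    ... | no ¬line with dual-pair x≢0 (λ c kc y≡ → ¬line (c , kc , y≡))
    ...   | a , ax≡0 , ay≡1 = ≤-reflexive (cancellation (λ a → w (Tr (a ⊗ x))) (λ a → Tr (a ⊗ y)) a (λ _ → Tr∈K _)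
               (λ c z kc → cong w (invariant c z kc)) (Tr-shift y a ay≡1))
      where
      invariant : ∀ c z → InK 1 c → Tr ((z ⊕ c ⊗ a) ⊗ x) ≡ Tr (z ⊗ x)
      invariant c z kc = begin
        Tr ((z ⊕ c ⊗ a) ⊗ x)  ≡⟨ cong Tr (solve 4 (λ z c y x → (z :+ c :* y) :* x := z :* x :+ c :* (y :* x)) refl z c a x) ⟩
        Tr (z ⊗ x ⊕ c ⊗ (a ⊗ x))  ≡⟨ Tr-⊕ _ _ ⟩
        Tr (z ⊗ x) ⊕ Tr (c ⊗ (a ⊗ x))  ≡⟨ cong (Tr (z ⊗ x) ⊕_) (trans (Tr-⊗ _ kc) (trans (cong (c ⊗_) ax≡0) (R.zeroʳ c))) ⟩
        Tr (z ⊗ x) ⊕ 0#  ≡⟨ R.+-identityʳ _ ⟩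
        Tr (z ⊗ x)  ∎
        where open ≡-Reasoning

    -- Equidistribution of roots of unity in orthogonal complements.

    h : ℕ → A → ℤ
    h e x = ind (pow x e ≟ 1#)

    0≤h : ∀ e x → 0ℤ ≤ h e x
    0≤h e x = 0≤ind (pow x e ≟ 1#)

    h≤1 : ∀ e x → h e x ≤ 1ℤ
    h≤1 e x = ind≤1 (pow x e ≟ 1#)

    module _ (T : ℕ) (qQ≤TT : q ℕ.* Q ℕ.≤ T ℕ.* T) (e D : ℕ) (1≤e : 1 ℕ.≤ e) (eD≡N : e ℕ.* D ≡ N) where
      private
        r = + q - 1ℤ

      E : A → ℤ
      E a = ∑ (λ x → h e x * w (Tr (a ⊗ x)))

      -- |E| ≤ (q - 1) √(qQ) off 0: E is constant on the cosets of the subgroup, so e E(a)² is at most the second moment.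
      E-invariant : ∀ a {b} → pow b e ≡ 1# → E (a ⊗ b) ≡ E a
      E-invariant a {b} bᵉ≡1 = trans (∑-cong step) (∑-⊗ (λ x → h e x * w (Tr (a ⊗ x))) (pow≡1⇒≢0 1≤e bᵉ≡1))
        where
        step : ∀ x → h e x * w (Tr (a ⊗ b ⊗ x)) ≡ h e (b ⊗ x) * w (Tr (a ⊗ (b ⊗ x)))
        step x = cong₂ _*_ (cong (λ y → ind (y ≟ 1#)) (sym (trans (pow-⊗ b x e) (trans (cong (_⊗ pow x e) bᵉ≡1) (R.*-identityˡ _)))))
                           (cong (w ∘ Tr) (R.*-assoc a b x))

      -- Expanding the square leaves the correlations of pairs of e-th roots of unity. Each of the e
      -- choices of x has at most q proportional y, and each such pair costs at most `moment`.
      second-moment : ∑ (λ a → E a * E a) ≤ + e * (+ q * moment)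
      second-moment = ≤-trans (≤-reflexive expand) (≤-trans (∑-mono row) (≤-reflexive (trans (∑-*ʳ (+ q * moment) (h e)) (cong (_* (+ q * moment)) (count-pow≡1 e 1≤e D eD≡N)))))
        where
        open ≡-Reasoning
        ring : ∀ a b c d → a * b * (c * d) ≡ a * (c * (b * d))
        ring = solve-∀
        v : A → A → ℤ
        v a x = w (Tr (a ⊗ x))
        expand : ∑ (λ a → E a * E a) ≡ ∑ (λ x → h e x * ∑ (λ y → h e y * ∑ (λ a → v a x * v a y)))
        expand = begin
          ∑ (λ a → E a * E a)  ≡⟨ ∑-cong (λ a → sym (∑-*ʳ (E a) _)) ⟩
          ∑ (λ a → ∑ (λ x → h e x * v a x * E a))  ≡⟨ ∑-swap _ ⟩
          ∑ (λ x → ∑ (λ a → h e x * v a x * E a))  ≡⟨ ∑-cong (λ x → ∑-cong (λ a → trans (sym (∑-*ˡ (h e x * v a x) _)) (trans (∑-cong (λ y → ring (h e x) (v a x) (h e y) (v a y))) (∑-*ˡ (h e x) _)))) ⟩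
          ∑ (λ x → ∑ (λ a → h e x * ∑ (λ y → h e y * (v a x * v a y))))  ≡⟨ ∑-cong (λ x → trans (∑-*ˡ (h e x) _) (cong (h e x *_) (∑-swap _))) ⟩
          ∑ (λ x → h e x * ∑ (λ y → ∑ (λ a → h e y * (v a x * v a y))))  ≡⟨ ∑-cong (λ x → cong (h e x *_) (∑-cong (λ y → ∑-*ˡ (h e y) _))) ⟩
          ∑ (λ x → h e x * ∑ (λ y → h e y * ∑ (λ a → v a x * v a y)))  ∎
        0≤B : 0ℤ ≤ moment
        0≤B = *-nonneg {+ Q} (+≤+ ℕ.z≤n) (square-nonneg r)
        row : ∀ x → h e x * ∑ (λ y → h e y * ∑ (λ a → v a x * v a y)) ≤ h e x * (+ q * moment)
        row x with pow x e ≟ 1#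
        ... | no _ = ≤-refl
        ... | yes xᵉ≡1 = *-monoˡ {1ℤ} (+≤+ ℕ.z≤n) (≤-trans (∑-mono entry) (≤-trans (≤-reflexive (∑-*ʳ moment _)) (*-monoʳ {moment} 0≤B (line-size x))))
          where
          entry : ∀ y → h e y * ∑ (λ a → v a x * v a y) ≤ ind (line? x y) * moment
          entry y = ≤-trans (*-monoˡ (0≤h e y) (correlation-≤ y (pow≡1⇒≢0 1≤e xᵉ≡1)))
            (≤-trans (*-monoʳ (*-nonneg (0≤ind (line? x y)) 0≤B) (h≤1 e y)) (≤-reflexive (ℤP.*-identityˡ _)))

      E-square-≤ : ∀ {a} → a ≢ 0# → E a * E a ≤ (r * + T) * (r * + T)
      E-square-≤ {a} a≢0 = ≤-trans (ℤP.*-cancelˡ-≤-pos _ _ (+ e) {{ℤ.positive (+<+ 1≤e)}} (≤-trans orbit second-moment)) final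
        where
        orbit : + e * (E a * E a) ≤ ∑ (λ b → E b * E b)
        orbit = ≤-trans (≤-reflexive (trans (cong (_* (E a * E a)) (sym (count-pow≡1 e 1≤e D eD≡N))) (sym (∑-*ʳ (E a * E a) _))))
          (≤-trans (∑-mono step) (≤-reflexive (∑-⊗ (λ b → E b * E b) a≢0)))
          where
          step : ∀ b → h e b * (E a * E a) ≤ E (a ⊗ b) * E (a ⊗ b)
          step b with pow b e ≟ 1#
          ... | yes eq = ≤-reflexive (trans (ℤP.*-identityˡ _) (sym (cong₂ _*_ (E-invariant a eq) (E-invariant a eq))))
          ... | no _   = square-nonneg (E (a ⊗ b))
        ring : ∀ q Q r → q * (Q * (r * r)) ≡ r * r * (q * Q)
        ring = solve-∀
        ring′ : ∀ r T → r * r * (T * T) ≡ (r * T) * (r * T)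
        ring′ = solve-∀
        final : + q * moment ≤ (r * + T) * (r * + T)
        final = ≤-trans (≤-reflexive (ring (+ q) (+ Q) r)) (≤-trans (*-monoˡ (square-nonneg r)
          (subst (_≤ + T * + T) (ℤP.pos-* q Q) (subst (+ (q ℕ.* Q) ≤_) (ℤP.pos-* T T) (+≤+ qQ≤TT)))) (≤-reflexive (ring′ r (+ T))))

      E-upper : ∀ {a} → a ≢ 0# → E a ≤ r * + T
      E-upper {a} a≢0 = square-cancel-≤ (*-nonneg 0≤q-1 (+≤+ ℕ.z≤n)) (E-square-≤ a≢0)

      E-lower : ∀ {a} → a ≢ 0# → - (r * + T) ≤ E a
      E-lower {a} a≢0 = subst (- (r * + T) ≤_) (ℤP.neg-involutive (E a)) (ℤP.neg-mono-≤ (square-cancel-≤ { - E a} (*-nonneg 0≤q-1 (+≤+ ℕ.z≤n))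
        (≤-trans (≤-reflexive (ring (E a))) (E-square-≤ a≢0))))
        where
        ring : ∀ x → - x * - x ≡ x * x
        ring = solve-∀

      E-0# : E 0# ≡ r * + e
      E-0# = trans (∑-cong (λ x → cong (h e x *_) (w-0 (trans (cong Tr (R.zeroˡ x)) Tr-0#))))
        (trans (∑-*ʳ r (h e)) (trans (cong (_* r) (count-pow≡1 e 1≤e D eD≡N)) (ℤP.*-comm (+ e) r)))

      -- By `orthogonality`, (q - 1)|M| times the count is the sum of E(z) over z in M. The term z =
      -- 0 is exactly (q - 1) e, and every other one is at most (q - 1) T in absolute value.
      equidistribution : ∀ M → Near (size M * + T) (size M * ∑ (λ x → h e x * ind (x ⟂? M))) (+ e)
      equidistribution M =
          ℤP.*-cancelˡ-≤-pos _ _ r {{pos}} (≤-trans (≤-reflexive total) (≤-trans (∑-mono upper) (≤-reflexive (trans (∑-+ _ _) (trans (cong₂ _+_ (∑-δ 0# (λ _ → r * + e)) (∑-*ʳ (r * + T) _)) (ring r (+ e) (size M) (+ T)))))))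
        , ℤP.*-cancelˡ-≤-pos _ _ r {{pos}} (≤-from-difference _ lower-eq (∑-nonneg (λ z → difference (lower z))))
        where
        open ≡-Reasoning
        pos = ℤ.positive q-1>0
        G = ∑ (λ x → h e x * ind (x ⟂? M))
        ring : ∀ r e s T → r * e + s * (r * T) ≡ r * (e + s * T)
        ring = solve-∀
        ring3 : ∀ a b c d → a * (b * (c * d)) ≡ (b * c) * (a * d)
        ring3 = solve-∀
        ring4 : ∀ a b c → a * (b * c) ≡ b * (a * c)
        ring4 = solve-∀
        total : r * (size M * G) ≡ ∑ (λ z → ind (mem? M z) * E z)
        total = begin
          r * (size M * G)  ≡⟨ trans (ring4 r (size M) G) (sym (ℤP.*-assoc (size M) r G)) ⟩
          size M * r * G  ≡⟨ ∑-*ˡ (size M * r) _ ⟨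
          ∑ (λ x → size M * r * (h e x * ind (x ⟂? M)))  ≡⟨ ∑-cong (λ x → sym (ring3 (h e x) (size M) r (ind (x ⟂? M)))) ⟩
          ∑ (λ x → h e x * (size M * (r * ind (x ⟂? M))))  ≡⟨ ∑-cong (λ x → cong (h e x *_) (sym (orthogonality M x))) ⟩
          ∑ (λ x → h e x * ∑ (λ z → ind (mem? M z) * w (Tr (z ⊗ x))))  ≡⟨ ∑-cong (λ x → sym (∑-*ˡ (h e x) _)) ⟩
          ∑ (λ x → ∑ (λ z → h e x * (ind (mem? M z) * w (Tr (z ⊗ x)))))  ≡⟨ ∑-swap _ ⟩
          ∑ (λ z → ∑ (λ x → h e x * (ind (mem? M z) * w (Tr (z ⊗ x)))))  ≡⟨ ∑-cong (λ z → trans (∑-cong (λ x → ring4 (h e x) (ind (mem? M z)) (w (Tr (z ⊗ x))))) (∑-*ˡ (ind (mem? M z)) _)) ⟩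
          ∑ (λ z → ind (mem? M z) * E z)  ∎
        0≤rT : 0ℤ ≤ r * + T
        0≤rT = *-nonneg 0≤q-1 (+≤+ ℕ.z≤n)
        upper : ∀ z → ind (mem? M z) * E z ≤ ind (z ≟ 0#) * (r * + e) + ind (mem? M z) * (r * + T)
        upper z with z ≟ 0#
        ... | yes refl = subst (λ i → i * E 0# ≤ 1ℤ * (r * + e) + i * (r * + T)) (sym (ind-yes (mem? M 0#) (0∈ M)))
                           (≤-trans (≤-reflexive (cong (1ℤ *_) E-0#)) (subst (_≤ 1ℤ * (r * + e) + 1ℤ * (r * + T)) (ℤP.+-identityʳ _) (ℤP.+-monoʳ-≤ (1ℤ * (r * + e)) (subst (0ℤ ≤_) (sym (ℤP.*-identityˡ (r * + T))) 0≤rT))))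
        ... | no z≢0 = ≤-trans (*-monoˡ (0≤ind (mem? M z)) (E-upper z≢0)) (≤-reflexive (sym (ℤP.+-identityˡ _)))
        lower : ∀ z → ind (z ≟ 0#) * (r * + e) ≤ ind (mem? M z) * E z + ind (mem? M z) * (r * + T)
        lower z with z ≟ 0#
        ... | yes refl = subst (λ i → 1ℤ * (r * + e) ≤ i * E 0# + i * (r * + T)) (sym (ind-yes (mem? M 0#) (0∈ M)))
                           (≤-trans (≤-reflexive (cong (1ℤ *_) (sym E-0#))) (subst (_≤ 1ℤ * E 0# + 1ℤ * (r * + T)) (ℤP.+-identityʳ _) (ℤP.+-monoʳ-≤ (1ℤ * E 0#) (subst (0ℤ ≤_) (sym (ℤP.*-identityˡ (r * + T))) 0≤rT))))
        ... | no z≢0 = subst (0ℤ ≤_) (ℤP.*-distribˡ-+ (ind (mem? M z)) (E z) (r * + T)) (*-nonneg (0≤ind (mem? M z)) (subst (_≤ E z + r * + T) (ℤP.+-inverseˡ (r * + T)) (ℤP.+-monoˡ-≤ (r * + T) (E-lower z≢0))))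
        lower-eq : r * (size M * G + size M * + T) - r * + e ≡ ∑ (λ z → ind (mem? M z) * E z + ind (mem? M z) * (r * + T) - ind (z ≟ 0#) * (r * + e))
        lower-eq = sym (begin
          ∑ (λ z → ind (mem? M z) * E z + ind (mem? M z) * (r * + T) - ind (z ≟ 0#) * (r * + e))
              ≡⟨ ∑-cong (λ z → cong (λ s → ind (mem? M z) * E z + ind (mem? M z) * (r * + T) + s) (ℤP.neg-distribʳ-* (ind (z ≟ 0#)) (r * + e))) ⟩
          ∑ (λ z → ind (mem? M z) * E z + ind (mem? M z) * (r * + T) + ind (z ≟ 0#) * - (r * + e))  ≡⟨ trans (∑-+ _ _) (cong₂ _+_ (∑-+ _ _) (∑-δ 0# (λ _ → - (r * + e)))) ⟩
          ∑ (λ z → ind (mem? M z) * E z) + ∑ (λ z → ind (mem? M z) * (r * + T)) - r * + e  ≡⟨ cong₂ (λ a b → a + b - r * + e) (sym total) (∑-*ʳ (r * + T) _) ⟩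
          r * (size M * G) + size M * (r * + T) - r * + e  ≡⟨ ring5 r (size M) G (+ T) (+ e) ⟩
          r * (size M * G + size M * + T) - r * + e  ∎)
          where
          ring5 : ∀ r s G T e → r * (s * G) + s * (r * T) - r * e ≡ r * (s * G + s * T) - r * e
          ring5 = solve-∀

  1≤N : 1 ℕ.≤ N
  1≤N = ℕP.∸-monoˡ-≤ {2} {Q} 1 (ℕP.≤-trans 2≤q (ℕP.≤-trans (ℕP.≤-reflexive (sym (ℕP.*-identityʳ q))) (ℕP.≤-trans (q^-mono 1≤n) (ℕP.≤-reflexive (sym Q≡qⁿ)))))

  -- Modules over K_l stable under τ = Frob^l.

  module SubfieldModules (l m : ℕ) (lm≡n : l ℕ.* m ≡ n) where
    1≤l : 1 ℕ.≤ l
    1≤l = go l lm≡n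
      where
      go : ∀ l → l ℕ.* m ≡ n → 1 ℕ.≤ l
      go zero    eq = subst (1 ℕ.≤_) (sym eq) 1≤n
      go (suc l) eq = ℕ.s≤s ℕ.z≤n

    1≤m : 1 ℕ.≤ m
    1≤m = go m lm≡n
      where
      go : ∀ m → l ℕ.* m ≡ n → 1 ℕ.≤ m
      go zero    eq = subst (1 ℕ.≤_) (trans (sym eq) (ℕP.*-zeroʳ l)) 1≤n
      go (suc m) eq = ℕ.s≤s ℕ.z≤n

    count-Kₗ : ∑ (λ c → ind (K? l c)) ≡ + (q ℕ.^ l)
    count-Kₗ = count-K l m 1≤l lm≡n

    frobₗ : ℕ → A → A
    frobₗ i x = frob (l ℕ.* i) x

    frobₗ-K : ∀ i {c} → InK l c → frobₗ i c ≡ c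
    frobₗ-K i {c} kc = subst (λ j → frob j c ≡ c) (ℕP.*-comm i l) (frob-fixed-* l i kc)

    frobₗ-0 : ∀ x → frobₗ 0 x ≡ x
    frobₗ-0 x = trans (cong (λ j → frob j x) (ℕP.*-zeroʳ l)) (frob-id x)

    frobₗ-suc : ∀ i x → frob l (frobₗ i x) ≡ frobₗ (suc i) x
    frobₗ-suc i x = trans (sym (frob-+ l (l ℕ.* i) x)) (cong (λ j → frob j x) (sym (ℕP.*-suc l i)))

    record Module : Set₁ where
      field
        Mem  : A → Set
        mem? : ∀ z → Dec (Mem z)
        0∈   : Mem 0#
        ⊕∈   : ∀ {y z} → Mem y → Mem z → Mem (y ⊕ z)
        K∈   : ∀ {c z} → InK l c → Mem z → Mem (c ⊗ z)
        τ∈   : ∀ {z} → Mem z → Mem (frob l z)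

      ⊖∈ : ∀ {z} → Mem z → Mem (⊖ z)
      ⊖∈ {z} z∈ = subst Mem (RP.-1*x≈-x z) (K∈ (K-⊖ {l} (K-1# {l})) z∈)

      frob∈ : ∀ i {z} → Mem z → Mem (frobₗ i z)
      frob∈ zero    z∈ = subst Mem (sym (frobₗ-0 _)) z∈
      frob∈ (suc i) z∈ = subst Mem (frobₗ-suc i _) (τ∈ (frob∈ i z∈))

      subspace : Subspace
      subspace = record { Mem = Mem ; mem? = mem? ; 0∈ = 0∈ ; ⊕∈ = ⊕∈ ; ⊗∈ = λ kc → K∈ (K₁⊆K l kc) }

    open Module

    ∣_∣ : Module → ℤ
    ∣ M ∣ = size (subspace M)

    -- Counts S through unique decompositions z = φ c + v. It serves both for adjoining one
    -- conjugate to a span and for direct sums.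
    fibre-size : ∀ {S C V : A → Set} (S? : ∀ z → Dec (S z)) (C? : ∀ z → Dec (C z)) (V? : ∀ z → Dec (V z)) (φ : A → A) →
                 (∀ z → S z → ∃ λ c → C c × V (z ⊝ φ c)) → (∀ z c → C c → V (z ⊝ φ c) → S z) →
                 (∀ z c c′ → C c → C c′ → V (z ⊝ φ c) → V (z ⊝ φ c′) → c ≡ c′) →
                 ∑ (λ z → ind (S? z)) ≡ ∑ (λ c → ind (C? c)) * ∑ (λ z → ind (V? z))
    fibre-size S? C? V? φ decompose compose unique = begin
      ∑ (λ z → ind (S? z))  ≡⟨ ∑-cong pointwise ⟩
      ∑ (λ z → ∑ (λ c → ind (C? c) * ind (V? (z ⊝ φ c))))  ≡⟨ ∑-swap _ ⟩
      ∑ (λ c → ∑ (λ z → ind (C? c) * ind (V? (z ⊝ φ c))))  ≡⟨ ∑-cong (λ c → trans (∑-*ˡ (ind (C? c)) _) (cong (ind (C? c) *_) (∑-⊕ (λ z → ind (V? z)) (⊖ φ c)))) ⟩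
      ∑ (λ c → ind (C? c) * ∑ (λ z → ind (V? z)))  ≡⟨ ∑-*ʳ _ _ ⟩
      ∑ (λ c → ind (C? c)) * ∑ (λ z → ind (V? z))  ∎
      where
      open ≡-Reasoning
      pointwise : ∀ z → ind (S? z) ≡ ∑ (λ c → ind (C? c) * ind (V? (z ⊝ φ c)))
      pointwise z with S? z
      ... | no ¬s = sym (∑-0 (λ c → trans (ind-× (C? c) (V? (z ⊝ φ c))) (ind-no (C? c ×-dec V? (z ⊝ φ c)) (λ (cc , vv) → ¬s (compose z c cc vv)))))
      ... | yes s with decompose z s
      ...   | c₀ , cc₀ , vv₀ = sym (trans (∑-cong (λ c → trans (ind-* (C? c) (V? (z ⊝ φ c)) (c ≟ c₀)
                (λ cc vv → unique z c c₀ cc cc₀ vv vv₀) (λ { refl → cc₀ , vv₀ })) (sym (ℤP.*-identityʳ _)))) (∑-δ c₀ (λ _ → 1ℤ)))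

    -- The K_l-span of y, τ y, ..., τ^(d-1) y. The top coefficient is peeled off first; it is unique
    -- unless τ^(d-1) y already lies in the lower span.
    Span : A → ℕ → A → Set
    Span y zero    z = z ≡ 0#
    Span y (suc d) z = ∃ λ c → InK l c × Span y d (z ⊝ c ⊗ frobₗ d y)

    span? : ∀ y d z → Dec (Span y d z)
    span? y zero    z = z ≟ 0#
    span? y (suc d) z = FinP.any? (λ c → K? l c ×-dec span? y d (z ⊝ c ⊗ frobₗ d y))

    module _ (y : A) where
      span-0 : ∀ d → Span y d 0#
      span-0 zero    = refl
      span-0 (suc d) = 0# , K-0# {l} , subst (Span y d) (sym (trans (cong (0# ⊝_) (R.zeroˡ _)) (R.-‿inverseʳ 0#))) (span-0 d)

      span-⊕ : ∀ d {z z′} → Span y d z → Span y d z′ → Span y d (z ⊕ z′)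
      span-⊕ zero    refl refl = R.+-identityʳ 0#
      span-⊕ (suc d) {z} {z′} (c , kc , s) (c′ , kc′ , s′) = c ⊕ c′ , K-⊕ {l} kc kc′ ,
        subst (Span y d) (solve 5 (λ z z′ c c′ u → (z :- c :* u) :+ (z′ :- c′ :* u) := z :+ z′ :- (c :+ c′) :* u) refl z z′ c c′ (frobₗ d y)) (span-⊕ d s s′)

      span-K : ∀ d {a z} → InK l a → Span y d z → Span y d (a ⊗ z)
      span-K zero    {a} ka refl = R.zeroʳ a
      span-K (suc d) {a} {z} ka (c , kc , s) = a ⊗ c , K-⊗ {l} ka kc ,
        subst (Span y d) (solve 4 (λ a z c u → a :* (z :- c :* u) := a :* z :- a :* c :* u) refl a z c (frobₗ d y)) (span-K d ka s)

      span-⊖ : ∀ d {z} → Span y d z → Span y d (⊖ z)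
      span-⊖ d {z} s = subst (Span y d) (RP.-1*x≈-x z) (span-K d (K-⊖ {l} (K-1# {l})) s)

      span-suc : ∀ d {z} → Span y d z → Span y (suc d) z
      span-suc d {z} s = 0# , K-0# {l} , subst (Span y d) (sym (trans (cong (z ⊝_) (R.zeroˡ _)) (trans (cong (z ⊕_) RP.-0#≈0#) (R.+-identityʳ z)))) s

      span-≤ : ∀ {d e z} → d ℕ.≤ e → Span y d z → Span y e z
      span-≤ {d} {z = z} d≤e s = go (ℕP.≤⇒≤′ d≤e)
        where
        go : ∀ {e} → d ℕ.≤′ e → Span y e z
        go ℕ.≤′-refl     = s
        go (ℕ.≤′-step p) = span-suc _ (go p)

      span-τ : ∀ d {z} → Span y d z → Span y (suc d) (frob l z)
      span-τ zero    refl = subst (Span y 1) (sym (frob-0# l)) (span-0 1)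
      span-τ (suc d) {z} (c , kc , s) = c , kc , subst (Span y (suc d)) eq (span-τ d s)
        where
        open ≡-Reasoning
        eq : frob l (z ⊝ c ⊗ frobₗ d y) ≡ frob l z ⊝ c ⊗ frobₗ (suc d) y
        eq = begin
          frob l (z ⊝ c ⊗ frobₗ d y)  ≡⟨ frob-⊕ l z _ ⟩
          frob l z ⊕ frob l (⊖ (c ⊗ frobₗ d y))  ≡⟨ cong (frob l z ⊕_) (trans (frob-⊖ l _) (cong ⊖_ (trans (frob-⊗ l c _) (cong₂ _⊗_ kc (frobₗ-suc d y))))) ⟩
          frob l z ⊝ c ⊗ frobₗ (suc d) y  ∎

      split : ∀ z u → z ≡ (z ⊝ u) ⊕ u
      split z u = solve 2 (λ z u → z := (z :- u) :+ u) refl z u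

      span⊆ : ∀ (M : Module) → Mem M y → ∀ d {z} → Span y d z → Mem M z
      span⊆ M y∈ zero    refl = 0∈ M
      span⊆ M y∈ (suc d) {z} (c , kc , s) = subst (Mem M) (sym (split z _)) (⊕∈ M (span⊆ M y∈ d s) (K∈ M kc (frob∈ M d y∈)))

      span-cancel : ∀ d {c u} → InK l c → c ≢ 0# → Span y d (c ⊗ u) → Span y d u
      span-cancel d {c} {u} kc c≢0 s = let (b , cb≡1) = inverse c c≢0 in
        subst (Span y d) (trans (sym (R.*-assoc b c u)) (trans (cong (_⊗ u) (trans (R.*-comm b c) cb≡1)) (R.*-identityˡ u)))
          (span-K d (K-inverse {l} c≢0 kc cb≡1) s)

      Stable : ℕ → Set
      Stable d = Span y d (frobₗ d y)

      stable? : ∀ d → Dec (Stable d)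
      stable? d = span? y d (frobₗ d y)

      -- While no conjugate falls into the span of its predecessors, each new coefficient is
      -- determined by the element, so every step multiplies the size by q^l.
      span-size : ∀ d → (∀ i → i ℕ.< d → ¬ Stable i) → ∑ (λ z → ind (span? y d z)) ≡ + (q ℕ.^ (l ℕ.* d))
      span-size zero    _ = trans (∑-cong (λ z → sym (ℤP.*-identityʳ _))) (trans (∑-δ 0# (λ _ → 1ℤ)) (cong (λ j → + (q ℕ.^ j)) (sym (ℕP.*-zeroʳ l))))
      span-size (suc d) free = trans (fibre-size (span? y (suc d)) (K? l) (span? y d) (_⊗ frobₗ d y) (λ z s → s) (λ z c kc s → c , kc , s) unique)
        (trans (cong₂ _*_ count-Kₗ (span-size d (λ i i<d → free i (ℕP.m<n⇒m<1+n i<d))))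
          (trans (sym (ℤP.pos-* (q ℕ.^ l) _)) (cong +_ (trans (sym (ℕP.^-distribˡ-+-* q l (l ℕ.* d))) (cong (q ℕ.^_) (sym (ℕP.*-suc l d)))))))
        where
        unique : ∀ z c c′ → InK l c → InK l c′ → Span y d (z ⊝ c ⊗ frobₗ d y) → Span y d (z ⊝ c′ ⊗ frobₗ d y) → c ≡ c′
        unique z c c′ kc kc′ s s′ with c ≟ c′
        ... | yes e = e
        ... | no ¬e = contradiction (span-cancel d (K-⊕ {l} kc (K-⊖ {l} kc′)) (λ e → ¬e (⊝≡0⇒≡ e))
                (subst (Span y d) (solve 4 (λ z c c′ u → (z :- c′ :* u) :+ :- (z :- c :* u) := (c :- c′) :* u) refl z c c′ (frobₗ d y)) (span-⊕ d s′ (span-⊖ d s))))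
                (free d (ℕP.n<1+n d))

      private
        ind-sum≤Q : ∀ {P : A → Set} (P? : ∀ z → Dec (P z)) → ∑ (λ z → ind (P? z)) ≤ + Q
        ind-sum≤Q P? = ≤-trans (∑-mono (λ z → ind≤1 (P? z))) (≤-reflexive (trans (∑-const Q 1ℤ) (ℤP.*-identityʳ (+ Q))))

      exponent-≤ : ∀ {i} → + (q ℕ.^ i) ≤ + Q → i ℕ.≤ n
      exponent-≤ {i} h with i ℕP.≤? n
      ... | yes p = p
      ... | no ¬p = contradiction (subst (q ℕ.^ i ℕ.≤_) Q≡qⁿ (ℤP.drop‿+≤+ h)) (ℕP.<⇒≱ (q^-mono-< (ℕP.≰⇒> ¬p)))

      -- Otherwise m + 1 conjugates would span q^(l(m+1)) > Q elements. The least d is the degree of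
      -- the minimal polynomial of y under τ, and also the dimension of the module generated by y.
      period : ∃ λ d → Stable d × (∀ i → i ℕ.< d → ¬ Stable i)
      period with least stable? (suc m)
      ... | inj₂ (d , _ , s , free) = d , s , free
      ... | inj₁ free = contradiction (exponent-≤ (subst (_≤ + Q) (span-size (suc m) free) (ind-sum≤Q (span? y (suc m)))))
              (ℕP.<⇒≱ (subst (ℕ._< l ℕ.* suc m) lm≡n (ℕP.*-monoʳ-< l {{ℕ.>-nonZero 1≤l}} (ℕP.n<1+n m))))

      dim : ℕ
      dim = proj₁ period

      dim-stable : Stable dim
      dim-stable = proj₁ (proj₂ period)

      dim-free : ∀ i → i ℕ.< dim → ¬ Stable i
      dim-free = proj₂ (proj₂ period)

      dim-≤ : ∀ i → Stable i → dim ℕ.≤ i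
      dim-≤ i s with dim ℕP.≤? i
      ... | yes p = p
      ... | no ¬p = contradiction s (dim-free i (ℕP.≰⇒> ¬p))

      cyclic : Module
      cyclic = record
        { Mem = Span y dim ; mem? = span? y dim ; 0∈ = span-0 dim ; ⊕∈ = span-⊕ dim ; K∈ = span-K dim ; τ∈ = τ-closed }
        where
        τ-closed : ∀ {z} → Span y dim z → Span y dim (frob l z)
        τ-closed {z} s with span-τ dim s
        ... | c , kc , s′ = subst (Span y dim) (sym (split _ _)) (span-⊕ dim s′ (span-K dim kc dim-stable))

      generator∈ : Mem cyclic y
      generator∈ = go dim dim-stable
        where
        go : ∀ d → Stable d → Span y d y
        go zero    s = trans (sym (frobₗ-0 y)) s
        go (suc d) s = span-≤ (ℕ.s≤s (ℕ.z≤n {d})) (1# , K-1# {l} , trans (cong (λ z → y ⊝ 1# ⊗ z) (frobₗ-0 y)) (trans (cong (y ⊝_) (R.*-identityˡ y)) (R.-‿inverseʳ y)))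

      cyclic-size : ∣ cyclic ∣ ≡ + (q ℕ.^ (l ℕ.* dim))
      cyclic-size = span-size dim dim-free

      cyclic⊆ : ∀ M → Mem M y → ∀ {z} → Mem cyclic z → Mem M z
      cyclic⊆ M y∈ = span⊆ M y∈ dim

      dim≥1 : y ≢ 0# → 1 ℕ.≤ dim
      dim≥1 y≢0 = go dim dim-stable
        where
        go : ∀ d → Stable d → 1 ℕ.≤ d
        go zero    s = contradiction (trans (sym (frobₗ-0 y)) s) y≢0
        go (suc d) _ = ℕ.s≤s ℕ.z≤n

    -- Polynomials in τ of degree below d with coefficients in K_l, acting on the field.
    Operator : ℕ → (A → A) → Set
    Operator zero    L = ∀ z → L z ≡ 0#
    Operator (suc d) L = ∃ λ c → ∃ λ L′ → InK l c × Operator d L′ × (∀ z → L z ≡ L′ z ⊕ c ⊗ frobₗ d z)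

    operator : ∀ y d {v} → Span y d v → ∃ λ L → Operator d L × L y ≡ v
    operator y zero    refl = (λ _ → 0#) , (λ _ → refl) , refl
    operator y (suc d) {v} (c , kc , s) with operator y d s
    ... | L , op , eq = _ , (c , L , kc , op , λ _ → refl) , trans (cong (_⊕ (c ⊗ frobₗ d y)) eq) (sym (split y v _))

    operator∈ : ∀ d {L} → Operator d L → ∀ M {z} → Mem M z → Mem M (L z)
    operator∈ zero    op M z∈ = subst (Mem M) (sym (op _)) (0∈ M)
    operator∈ (suc d) (c , L′ , kc , op , eq) M z∈ = subst (Mem M) (sym (eq _)) (⊕∈ M (operator∈ d op M z∈) (K∈ M kc (frob∈ M d z∈)))

    operator-⊕ : ∀ d {L} → Operator d L → ∀ y z → L (y ⊕ z) ≡ L y ⊕ L z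
    operator-⊕ zero    op y z = trans (op _) (sym (trans (cong₂ _⊕_ (op y) (op z)) (R.+-identityʳ 0#)))
    operator-⊕ (suc d) {L} (c , L′ , kc , op , eq) y z = begin
      L (y ⊕ z)  ≡⟨ eq _ ⟩
      L′ (y ⊕ z) ⊕ c ⊗ frobₗ d (y ⊕ z)  ≡⟨ cong₂ (λ a b → a ⊕ c ⊗ b) (operator-⊕ d op y z) (frob-⊕ (l ℕ.* d) y z) ⟩
      L′ y ⊕ L′ z ⊕ c ⊗ (frobₗ d y ⊕ frobₗ d z)  ≡⟨ solve 5 (λ a b c u v → a :+ b :+ c :* (u :+ v) := a :+ c :* u :+ (b :+ c :* v)) refl (L′ y) (L′ z) c (frobₗ d y) (frobₗ d z) ⟩
      (L′ y ⊕ c ⊗ frobₗ d y) ⊕ (L′ z ⊕ c ⊗ frobₗ d z)  ≡⟨ cong₂ _⊕_ (eq y) (eq z) ⟨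
      L y ⊕ L z  ∎
      where open ≡-Reasoning

    frobₗ-scaled : ∀ i a j z → InK l a → frobₗ i (a ⊗ frobₗ j z) ≡ a ⊗ frobₗ j (frobₗ i z)
    frobₗ-scaled i a j z ka = trans (frob-⊗ (l ℕ.* i) a _) (cong₂ _⊗_ (frobₗ-K i ka) (frob-comm (l ℕ.* i) (l ℕ.* j) z))

    operator-commutes : ∀ d {L} → Operator d L → ∀ a i z → InK l a → L (a ⊗ frobₗ i z) ≡ a ⊗ frobₗ i (L z)
    operator-commutes zero    op a i z ka = trans (op _) (sym (trans (cong (λ u → a ⊗ frobₗ i u) (op z)) (trans (cong (a ⊗_) (frob-0# (l ℕ.* i))) (R.zeroʳ a))))
    operator-commutes (suc d) {L} (c , L′ , kc , op , eq) a i z ka = begin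
      L (a ⊗ frobₗ i z)  ≡⟨ eq _ ⟩
      L′ (a ⊗ frobₗ i z) ⊕ c ⊗ frobₗ d (a ⊗ frobₗ i z)  ≡⟨ cong₂ (λ u v → u ⊕ c ⊗ v) (operator-commutes d op a i z ka) (frobₗ-scaled d a i z ka) ⟩
      a ⊗ frobₗ i (L′ z) ⊕ c ⊗ (a ⊗ frobₗ i (frobₗ d z))  ≡⟨ solve 4 (λ a u c v → a :* u :+ c :* (a :* v) := a :* (u :+ c :* v)) refl a (frobₗ i (L′ z)) c (frobₗ i (frobₗ d z)) ⟩
      a ⊗ (frobₗ i (L′ z) ⊕ c ⊗ frobₗ i (frobₗ d z))  ≡⟨ cong (λ u → a ⊗ (frobₗ i (L′ z) ⊕ u)) (trans (frob-⊗ (l ℕ.* i) c _) (cong (_⊗ frobₗ i (frobₗ d z)) (frobₗ-K i kc))) ⟨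
      a ⊗ (frobₗ i (L′ z) ⊕ frobₗ i (c ⊗ frobₗ d z))  ≡⟨ cong (a ⊗_) (trans (cong (frobₗ i) (eq z)) (frob-⊕ (l ℕ.* i) _ _)) ⟨
      a ⊗ frobₗ i (L z)  ∎
      where open ≡-Reasoning

    -- The power τ^i is x^(q^(l i)), so degree below d in τ means degree below q^(l d) in x.
    operator-Low : ∀ d {L} → Operator d L → Low (q ℕ.^ (l ℕ.* d)) L
    operator-Low zero    op = Low-0 _ op
    operator-Low (suc d) (c , L′ , kc , op , eq) = Low-cong _ (λ z → sym (eq z))
      (Low-⊕ _ (Low-≤ (ℕP.<⇒≤ lt) (operator-Low d op)) (Low-≤ lt (Low-⊗ _ c (Low-pow (q ℕ.^ (l ℕ.* d))))))
      where
      lt : q ℕ.^ (l ℕ.* d) ℕ.< q ℕ.^ (l ℕ.* suc d)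
      lt = q^-mono-< (ℕP.*-monoʳ-< l {{ℕ.>-nonZero 1≤l}} (ℕP.n<1+n d))

    ⊆∧size≥⇒⊇ : ∀ {P P′ : A → Set} (P? : ∀ z → Dec (P z)) (P′? : ∀ z → Dec (P′ z)) → (∀ z → P z → P′ z) →
                ∑ (λ z → ind (P′? z)) ≤ ∑ (λ z → ind (P? z)) → ∀ z → P′ z → P z
    ⊆∧size≥⇒⊇ P? P′? sub le z p′ with P? z in eq
    ... | yes p = p
    ... | no ¬p = contradiction (trans (sym (∑≤0⇒term≡0 (λ z → difference (ind-mono (P? z) (P′? z) (sub z))) total z)) (cong₂ _-_ (ind-yes (P′? z) p′) (ind-no (P? z) ¬p))) (λ ())
      where
      total : ∑ (λ z → ind (P′? z) - ind (P? z)) ≤ 0ℤ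
      total = ≤-trans (≤-reflexive (trans (∑-cong (λ z → cong (λ s → ind (P′? z) + s) (sym (ℤP.-1*i≡-i (ind (P? z)))))) (trans (∑-+ _ _) (cong (λ s → ∑ (λ z → ind (P′? z)) + s) (trans (∑-*ˡ -[1+ 0 ] _) (ℤP.-1*i≡-i _))))))
                (ℤP.i≤j⇒i-j≤0 le)

    -- The minimal polynomial of y under the l-th Frobenius, as an operator; its kernel is no larger than the
    -- cyclic module of y because it is a polynomial function of degree q^(l dim y).
    record Annihilator (y : A) : Set₁ where
      field
        P         : A → A
        additive  : ∀ u v → P (u ⊕ v) ≡ P u ⊕ P v
        stable    : ∀ M {z} → Mem M z → Mem M (P z)
        vanishes  : ∀ {z} → Mem (cyclic y) z → P z ≡ 0#
        kernel    : ∀ {z} → P z ≡ 0# → Mem (cyclic y) z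

    annihilator : ∀ y → Annihilator y
    annihilator y with operator y (dim y) (dim-stable y)
    ... | L , op , Ly≡ = record
        { P = P
        ; additive = additive
        ; stable = λ M z∈ → ⊕∈ M (frob∈ M (dim y) z∈) (⊖∈ M (operator∈ (dim y) op M z∈))
        ; vanishes = vanishes (dim y)
        ; kernel = λ {z} → ⊆∧size≥⇒⊇ (mem? (cyclic y)) (λ z → P z ≟ 0#) (λ z → vanishes (dim y))
                     (≤-trans (roots-≤ (q ℕ.^ (l ℕ.* dim y)) monic) (≤-reflexive (sym (cyclic-size y)))) z }
      where
      d = dim y
      P : A → A
      P z = frobₗ d z ⊝ L z
      additive : ∀ u v → P (u ⊕ v) ≡ P u ⊕ P v
      additive u v = trans (cong₂ _⊝_ (frob-⊕ (l ℕ.* d) u v) (operator-⊕ d op u v))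
        (solve 4 (λ a b c e → a :+ b :- (c :+ e) := a :- c :+ (b :- e)) refl (frobₗ d u) (frobₗ d v) (L u) (L v))
      commutes : ∀ a i → InK l a → P (a ⊗ frobₗ i y) ≡ 0#
      commutes a i ka = begin
        P (a ⊗ frobₗ i y)  ≡⟨ cong₂ _⊝_ (frobₗ-scaled d a i y ka) (operator-commutes d op a i y ka) ⟩
        a ⊗ frobₗ i (frobₗ d y) ⊝ a ⊗ frobₗ i (L y)  ≡⟨ cong (λ u → a ⊗ frobₗ i (frobₗ d y) ⊝ a ⊗ frobₗ i u) Ly≡ ⟩
        a ⊗ frobₗ i (frobₗ d y) ⊝ a ⊗ frobₗ i (frobₗ d y)  ≡⟨ R.-‿inverseʳ _ ⟩
        0#  ∎
        where open ≡-Reasoning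
      vanishes : ∀ e {z} → Span y e z → P z ≡ 0#
      vanishes zero    refl = trans (cong₂ _⊝_ (frob-0# (l ℕ.* d)) (RP.+-cancelˡ (L 0#) _ _ (trans (sym (operator-⊕ d op 0# 0#)) (trans (cong L (R.+-identityʳ 0#)) (sym (R.+-identityʳ _)))))) (R.-‿inverseʳ 0#)
      vanishes (suc e) {z} (c , kc , s) = trans (cong P (split y z _)) (trans (additive _ _) (trans (cong₂ _⊕_ (vanishes e s) (commutes c e kc)) (R.+-identityʳ 0#)))
      monic : Monic (q ℕ.^ (l ℕ.* d)) P
      monic = (λ z → ⊖ L z) , Low-cong _ (λ z → RP.-1*x≈-x (L z)) (Low-⊗ _ (⊖ 1#) (operator-Low d op)) , λ z → refl

    -- Simple modules and their independence.

    Simple : A → Set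
    Simple y = y ≢ 0# × (∀ z → Mem (cyclic y) z → z ≢ 0# → Mem (cyclic z) y)

    simple? : ∀ y → Dec (Simple y)
    simple? y = ¬? (y ≟ 0#) ×-dec FinP.all? (λ z → mem? (cyclic y) z →-dec (¬? (z ≟ 0#) →-dec mem? (cyclic z) y))

    zeroModule : Module
    zeroModule = record
      { Mem = _≡ 0# ; mem? = _≟ 0# ; 0∈ = refl
      ; ⊕∈ = λ { refl refl → R.+-identityʳ 0# } ; K∈ = λ { {c} _ refl → R.zeroʳ c } ; τ∈ = λ { refl → frob-0# l } }

    infixr 6 _⊞_
    _⊞_ : Module → Module → Module
    M ⊞ W = record
      { Mem = λ z → ∃ λ u → Mem M u × Mem W (z ⊝ u)
      ; mem? = λ z → FinP.any? (λ u → mem? M u ×-dec mem? W (z ⊝ u))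
      ; 0∈ = 0# , 0∈ M , subst (Mem W) (sym (R.-‿inverseʳ 0#)) (0∈ W)
      ; ⊕∈ = λ { {y} {z} (u , u∈ , yu∈) (v , v∈ , zv∈) → u ⊕ v , ⊕∈ M u∈ v∈ ,
          subst (Mem W) (solve 4 (λ y z u v → y :- u :+ (z :- v) := y :+ z :- (u :+ v)) refl y z u v) (⊕∈ W yu∈ zv∈) }
      ; K∈ = λ { {c} {z} kc (u , u∈ , zu∈) → c ⊗ u , K∈ M kc u∈ ,
          subst (Mem W) (solve 3 (λ c z u → c :* (z :- u) := c :* z :- c :* u) refl c z u) (K∈ W kc zu∈) }
      ; τ∈ = λ { {z} (u , u∈ , zu∈) → frob l u , τ∈ M u∈ ,
          subst (Mem W) (trans (frob-⊕ l z (⊖ u)) (cong (frob l z ⊕_) (frob-⊖ l u))) (τ∈ W zu∈) } }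

    ⊞-left : ∀ M W {z} → Mem M z → Mem (M ⊞ W) z
    ⊞-left M W {z} z∈ = z , z∈ , subst (Mem W) (sym (R.-‿inverseʳ z)) (0∈ W)

    ⊞-right : ∀ M W {z} → Mem W z → Mem (M ⊞ W) z
    ⊞-right M W {z} z∈ = 0# , 0∈ M , subst (Mem W) (sym (trans (cong (z ⊕_) RP.-0#≈0#) (R.+-identityʳ z))) z∈

    Disjoint : Module → Module → Set
    Disjoint M W = ∀ z → Mem M z → Mem W z → z ≡ 0#

    ⊞-size : ∀ M W → Disjoint M W → ∣ M ⊞ W ∣ ≡ ∣ M ∣ * ∣ W ∣
    ⊞-size M W disjoint = fibre-size (mem? (M ⊞ W)) (mem? M) (mem? W) (λ u → u) (λ z s → s) (λ z u u∈ w∈ → u , u∈ , w∈)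
      (λ z u v u∈ v∈ zu∈ zv∈ → ⊝≡0⇒≡ (disjoint (u ⊝ v) (⊕∈ M u∈ (⊖∈ M v∈))
        (subst (Mem W) (solve 3 (λ z u v → z :- v :+ :- (z :- u) := u :- v) refl z u v) (⊕∈ W zv∈ (⊖∈ W zu∈)))))

    ⟂-⊞ : ∀ {x} M W → x ⟂ subspace M → x ⟂ subspace W → x ⟂ subspace (M ⊞ W)
    ⟂-⊞ {x} M W ⟂M ⟂W z (u , u∈ , zu∈) = begin
      Tr (z ⊗ x)  ≡⟨ cong Tr (solve 3 (λ z u x → z :* x := u :* x :+ (z :- u) :* x) refl z u x) ⟩
      Tr (u ⊗ x ⊕ (z ⊝ u) ⊗ x)  ≡⟨ Tr-⊕ _ _ ⟩
      Tr (u ⊗ x) ⊕ Tr ((z ⊝ u) ⊗ x)  ≡⟨ cong₂ _⊕_ (⟂M u u∈) (⟂W _ zu∈) ⟩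
      0# ⊕ 0#  ≡⟨ R.+-identityʳ 0# ⟩
      0#  ∎
      where open ≡-Reasoning

    ⟂-⊞⁻ : ∀ {x} M W → x ⟂ subspace (M ⊞ W) → x ⟂ subspace M × x ⟂ subspace W
    ⟂-⊞⁻ M W ⟂ = (λ z z∈ → ⟂ z (⊞-left M W z∈)) , (λ z z∈ → ⟂ z (⊞-right M W z∈))

    total : List A → Module
    total []       = zeroModule
    total (y ∷ ys) = cyclic y ⊞ total ys

    data Independent : List A → Set where
      []  : Independent []
      _∷_ : ∀ {y ys} → Simple y × Disjoint (cyclic y) (total ys) → Independent ys → Independent (y ∷ ys)

    Covers : List A → A → Set
    Covers ys x = Any (λ y → Mem (cyclic y) x) ys

    covers? : ∀ ys x → Dec (Covers ys x)
    covers? ys x = Any.any? (λ y → mem? (cyclic y) x) ys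

    private
      simple-disjoint : ∀ {x y} → Simple x → ¬ Mem (cyclic y) x → Disjoint (cyclic x) (cyclic y)
      simple-disjoint {x} {y} (_ , minimal) x∉ z z∈x z∈y with z ≟ 0#
      ... | yes e = e
      ... | no z≢0 = contradiction (cyclic⊆ z (cyclic y) z∈y (minimal z z∈x z≢0)) x∉

      -- Disjointness in pairs is not enough for this: three lines in a plane are pairwise disjoint.
      -- P preserves every summand, so P u = - P v lies both in cyclic y and in the remaining sum
      -- and vanishes. The kernel of P is exactly cyclic x, which meets the different simple module
      -- cyclic y only in 0, so u = 0; induction handles v.
      annihilator-injective : ∀ {x} → Simple x → ∀ ys → Independent ys → ¬ Covers ys x →
                              ∀ z → Mem (total ys) z → Annihilator.P (annihilator x) z ≡ 0# → z ≡ 0#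
      annihilator-injective sx []       _ _ z z∈ _ = z∈
      annihilator-injective {x} sx (y ∷ ys) ((_ , disjoint) ∷ ind) ¬cov z (u , u∈ , v∈) Pz≡0 =
        trans (split x z u) (trans (cong₂ _⊕_ v≡0 u≡0) (R.+-identityʳ 0#))
        where
        open Annihilator (annihilator x)
        v = z ⊝ u
        Pv⊕Pu : P v ⊕ P u ≡ 0#
        Pv⊕Pu = trans (sym (additive v u)) (trans (cong P (sym (split x z u))) Pz≡0)
        Pu≡-Pv : P u ≡ ⊖ P v
        Pu≡-Pv = RP.+-inverseʳ-unique (P v) (P u) Pv⊕Pu
        Pu≡0 : P u ≡ 0#
        Pu≡0 = disjoint (P u) (stable (cyclic y) u∈) (subst (Mem (total ys)) (sym Pu≡-Pv) (⊖∈ (total ys) (stable (total ys) v∈)))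
        Pv≡0 : P v ≡ 0#
        Pv≡0 = trans (sym (trans (cong (P v ⊕_) Pu≡0) (R.+-identityʳ _))) Pv⊕Pu
        u≡0 : u ≡ 0#
        u≡0 = simple-disjoint sx (λ x∈ → ¬cov (here x∈)) u (kernel Pu≡0) u∈
        v≡0 : v ≡ 0#
        v≡0 = annihilator-injective sx ys ind (λ c → ¬cov (there c)) v v∈ Pv≡0

    extend : ∀ {x ys} → Simple x → ¬ Covers ys x → Independent ys → Independent (x ∷ ys)
    extend {x} {ys} sx ¬cov ind = (sx , λ z z∈x z∈ → annihilator-injective sx ys ind ¬cov z z∈ (Annihilator.vanishes (annihilator x) z∈x)) ∷ ind

    -- Greedy collection of generators of pairwise different simple modules; `base` is already collected.
    module Greedy (Good : A → Set) (good? : ∀ x → Dec (Good x)) (good⇒simple : ∀ {x} → Good x → Simple x) (base : List A) where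
      New : A → Set
      New x = Good x × ¬ Covers base x

      greedy : ∀ cs ys → Independent (ys ++ base) → All New ys →
               ∃ λ zs → Independent (zs ++ base) × All New zs
                      × (∀ {x} → Covers (ys ++ base) x → Covers (zs ++ base) x)
                      × (∀ {x} → x ∈ cs → Good x → Covers (zs ++ base) x)
      greedy []       ys ind new = ys , ind , new , (λ c → c) , λ ()
      greedy (c ∷ cs) ys ind new with good? c | covers? (ys ++ base) c
      ... | no ¬g | _ with greedy cs ys ind new
      ...   | zs , ind′ , new′ , mono , all = zs , ind′ , new′ , mono , λ { (here refl) g → contradiction g ¬g ; (there x∈) g → all x∈ g }
      greedy (c ∷ cs) ys ind new | yes g | yes cov with greedy cs ys ind new
      ...   | zs , ind′ , new′ , mono , all = zs , ind′ , new′ , mono , λ { (here refl) g → mono cov ; (there x∈) g → all x∈ g }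
      greedy (c ∷ cs) ys ind new | yes g | no ¬cov with greedy cs (c ∷ ys) (extend (good⇒simple g) ¬cov ind) ((g , λ b → ¬cov (AnyP.++⁺ʳ ys b)) ∷ new)
      ...   | zs , ind′ , new′ , mono , all = zs , ind′ , new′ , (λ b → mono (there b)) , λ { (here refl) g → mono (here (generator∈ c)) ; (there x∈) g → all x∈ g }

    record Decomposition : Set₁ where
      field
        lines others : List A
        independent  : Independent (others ++ lines)
        independent₁ : Independent lines
        lines-dim    : All (λ y → dim y ≡ 1) lines
        others-dim   : All (λ y → 2 ℕ.≤ dim y) others
        covers       : ∀ {x} → Simple x → Covers (others ++ lines) x

    opaque
      -- The modules of dimension 1 are collected in a separate earlier pass: then `lines` is
      -- independent by itself, and whatever is new in the second pass has dimension at least 2.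
      decomposition : Decomposition
      decomposition with Greedy.greedy (λ x → Simple x × dim x ≡ 1) (λ x → simple? x ×-dec (dim x ℕP.≟ 1)) proj₁ [] (allFin Q) [] [] []
      ... | ls , ind₁ , new₁ , _ , all₁ with Greedy.greedy Simple simple? (λ s → s) ls (allFin Q) [] (subst Independent (++-identityʳ ls) ind₁) []
      ...   | os , ind₂ , new₂ , _ , all₂ = record
          { lines = ls ; others = os ; independent = ind₂ ; independent₁ = subst Independent (++-identityʳ ls) ind₁
          ; lines-dim = All.map (λ ((_ , d) , _) → d) new₁
          ; others-dim = All.map (λ {x} (s , ¬cov) → large (dim≥1 x (proj₁ s)) (λ d≡1 → ¬cov (subst (λ zs → Covers zs x) (++-identityʳ ls) (all₁ (∈-allFin x) (s , d≡1))))) new₂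
          ; covers = λ {x} → all₂ (∈-allFin x) }
        where
        large : ∀ {d} → 1 ℕ.≤ d → d ≢ 1 → 2 ℕ.≤ d
        large 1≤d d≢1 = ℕP.≤∧≢⇒< 1≤d (λ e → d≢1 (sym e))

    -- For τ-stability, Tr(u · τ z) = Tr(τ(τ⁻¹ u · z)) = Tr(τ⁻¹ u · z), where τ⁻¹ = τ^(m-1) because
    -- τ^m is the identity.
    perp : A → Module
    perp x = record
      { Mem = _⟂ M ; mem? = _⟂? M
      ; 0∈ = λ u _ → trans (cong Tr (R.zeroʳ u)) Tr-0#
      ; ⊕∈ = λ {y} {z} y⟂ z⟂ u u∈ → trans (cong Tr (R.distribˡ u y z)) (trans (Tr-⊕ _ _) (trans (cong₂ _⊕_ (y⟂ u u∈) (z⟂ u u∈)) (R.+-identityʳ 0#)))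
      ; K∈ = λ {c} {z} kc z⟂ u u∈ → trans (cong Tr (solve 3 (λ c z u → u :* (c :* z) := c :* u :* z) refl c z u)) (z⟂ (c ⊗ u) (K∈ (cyclic x) kc u∈))
      ; τ∈ = λ {z} z⟂ u u∈ → trans (cong Tr (trans (cong (_⊗ frob l z) (sym (roundtrip u))) (sym (frob-⊗ l _ z)))) (trans (Tr-frob l _) (z⟂ _ (frob∈ (cyclic x) (m ℕ.∸ 1) u∈))) }
      where
      M = subspace (cyclic x)
      roundtrip : ∀ u → frob l (frobₗ (m ℕ.∸ 1) u) ≡ u
      roundtrip u = trans (frobₗ-suc (m ℕ.∸ 1) u) (trans (cong (λ j → frobₗ j u) (ℕP.m+[n∸m]≡n 1≤m)) (trans (cong (λ j → frob j u) lm≡n) (frob-n u)))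

    l*-cancel-< : ∀ {a b} → l ℕ.* a ℕ.< l ℕ.* b → a ℕ.< b
    l*-cancel-< {a} {b} = ℕP.*-cancelˡ-< l a b

    q^-cancel-< : ∀ {i j} → q ℕ.^ i ℕ.< q ℕ.^ j → i ℕ.< j
    q^-cancel-< {i} {j} h with j ℕP.≤? i
    ... | no ¬p = ℕP.≰⇒> ¬p
    ... | yes p = contradiction h (ℕP.≤⇒≯ (q^-mono p))

    q^-cancel-≤ : ∀ {i j} → q ℕ.^ i ℕ.≤ q ℕ.^ j → i ℕ.≤ j
    q^-cancel-≤ {i} {j} h with i ℕP.≤? j
    ... | yes p = p
    ... | no ¬p = contradiction h (ℕP.<⇒≱ (q^-mono-< (ℕP.≰⇒> ¬p)))

    -- Descent on the dimension, bounded by `b`: if y is not simple, some nonzero z in its module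
    -- fails to generate y, and the module of z is then strictly smaller.
    simple-element : ∀ N b y → dim y ℕ.≤ b → y ≢ 0# → Mem N y → ∃ λ y′ → Simple y′ × Mem N y′
    simple-element N zero    y d≤0 y≢0 y∈ = contradiction (ℕP.≤-trans (dim≥1 y y≢0) d≤0) (λ ())
    simple-element N (suc b) y d≤b y≢0 y∈ with FinP.any? (λ z → mem? (cyclic y) z ×-dec (¬? (z ≟ 0#) ×-dec ¬? (mem? (cyclic z) y)))
    ... | no ¬p = y , (y≢0 , minimal) , y∈
      where
      minimal : ∀ z → Mem (cyclic y) z → z ≢ 0# → Mem (cyclic z) y
      minimal z z∈ z≢0 with mem? (cyclic z) y
      ... | yes m = m
      ... | no ¬m = contradiction (z , z∈ , z≢0 , ¬m) ¬p
    ... | yes (z , z∈ , z≢0 , y∉) = simple-element N b z (ℕ.s≤s⁻¹ (ℕP.≤-trans smaller d≤b)) z≢0 (cyclic⊆ y N y∈ z∈)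
      where
      ¬size≥ : ¬ (∣ cyclic y ∣ ≤ ∣ cyclic z ∣)
      ¬size≥ le = y∉ (⊆∧size≥⇒⊇ (mem? (cyclic z)) (mem? (cyclic y)) (λ u → cyclic⊆ z (cyclic y) z∈) le y (generator∈ y))
      smaller : dim z ℕ.< dim y
      smaller = l*-cancel-< (q^-cancel-< (ℤP.drop‿+<+ (subst (_< + (q ℕ.^ (l ℕ.* dim y))) (cyclic-size z) (subst (∣ cyclic z ∣ <_) (cyclic-size y) (ℤP.≰⇒> ¬size≥)))))

    module _ (D : Decomposition) where
      open Decomposition D

      private
        -- A subspace and its complement have sizes with product Q, so a proper cyclic module has a
        -- nontrivial complement.
        exists-perp : ∀ x → dim x ℕ.< m → ∃ λ y → y ≢ 0# × y ⟂ subspace (cyclic x)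
        exists-perp x d<m with FinP.any? (λ y → ¬? (y ≟ 0#) ×-dec (y ⟂? subspace (cyclic x)))
        ... | yes p = p
        ... | no ¬p = contradiction (perp-size M) (λ eq → ℤP.<⇒≱ size<Q (≤-trans (≤-reflexive (sym eq)) (≤-trans (*-monoˡ 0≤size few) (≤-reflexive (ℤP.*-identityʳ _)))))
          where
          M = subspace (cyclic x)
          0≤size : 0ℤ ≤ size M
          0≤size = ∑-nonneg (λ z → 0≤ind (mem? (cyclic x) z))
          bound : ∀ y → ind (y ⟂? M) ≤ ind (y ≟ 0#) * 1ℤ
          bound y with y ≟ 0#
          ... | yes _ = ind≤1 (y ⟂? M)
          ... | no y≢0 = ≤-reflexive (ind-no (y ⟂? M) (λ y⟂ → ¬p (y , y≢0 , y⟂)))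
          few : ∑ (λ y → ind (y ⟂? M)) ≤ 1ℤ
          few = ≤-trans (∑-mono bound) (≤-reflexive (∑-δ 0# (λ _ → 1ℤ)))
          size<Q : size M < + Q
          size<Q = subst (_< + Q) (sym (cyclic-size x)) (+<+ (subst (q ℕ.^ (l ℕ.* dim x) ℕ.<_) (trans (cong (q ℕ.^_) lm≡n) (sym Q≡qⁿ)) (q^-mono-< (ℕP.*-monoʳ-< l {{ℕ.>-nonZero 1≤l}} d<m))))

        -- A nonzero element of a simple module generates it, so a simple module meeting perp x
        -- outside 0 is contained in perp x.
        covered-perp : ∀ {x y} ys → Independent ys → Mem (perp x) y → y ≢ 0# → Covers ys y → Any (λ z → x ⟂ subspace (cyclic z)) ys
        covered-perp {x} {y} (z ∷ ys) (((_ , minimal) , _) ∷ _) y∈ y≢0 (here y∈z) = here (λ u u∈ →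
          trans (cong Tr (R.*-comm u x)) (cyclic⊆ z (perp x) (cyclic⊆ y (perp x) y∈ (minimal y y∈z y≢0)) u∈ x (generator∈ x)))
        covered-perp (z ∷ ys) (_ ∷ ind) y∈ y≢0 (there c) = there (covered-perp ys ind y∈ y≢0 c)

      -- If the conjugates of x were dependent, cyclic x would be proper and perp x nonzero. Being a
      -- module, perp x would then contain a simple module, hence one of those collected.
      not-perp⇒free : ∀ x → ¬ Any (λ y → x ⟂ subspace (cyclic y)) (others ++ lines) → ∀ i → i ℕ.< m → ¬ Stable x i
      not-perp⇒free x ¬perp i i<m s with exists-perp x (ℕP.≤-<-trans (dim-≤ x i s) i<m)
      ... | y , y≢0 , y⟂ with simple-element (perp x) (dim y) y ℕP.≤-refl y≢0 y⟂
      ...   | y′ , sy′ , y′⟂ = ¬perp (covered-perp (others ++ lines) independent y′⟂ (proj₁ sy′) (covers sy′))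

    dims : List A → ℕ
    dims []       = 0
    dims (y ∷ ys) = dim y ℕ.+ dims ys

    dims-++ : ∀ ys zs → dims (ys ++ zs) ≡ dims ys ℕ.+ dims zs
    dims-++ []       zs = refl
    dims-++ (y ∷ ys) zs = trans (cong (dim y ℕ.+_) (dims-++ ys zs)) (sym (ℕP.+-assoc (dim y) _ _))

    dims-≥ : ∀ a {ys} → All (λ y → a ℕ.≤ dim y) ys → a ℕ.* length ys ℕ.≤ dims ys
    dims-≥ a []       = ℕP.≤-reflexive (ℕP.*-zeroʳ a)
    dims-≥ a {y ∷ ys} (h ∷ hs) = subst (ℕ._≤ dims (y ∷ ys)) (sym (ℕP.*-suc a (length ys))) (ℕP.+-mono-≤ h (dims-≥ a hs))

    total-size : ∀ {ys} → Independent ys → ∣ total ys ∣ ≡ + (q ℕ.^ (l ℕ.* dims ys))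
    total-size []  = trans (∑-cong (λ z → sym (ℤP.*-identityʳ _))) (trans (∑-δ 0# (λ _ → 1ℤ)) (cong (λ j → + (q ℕ.^ j)) (sym (ℕP.*-zeroʳ l))))
    total-size {y ∷ ys} ((_ , disjoint) ∷ ind) = trans (⊞-size (cyclic y) (total ys) disjoint) (trans (cong₂ _*_ (cyclic-size y) (total-size ind))
      (trans (sym (ℤP.pos-* (q ℕ.^ (l ℕ.* dim y)) _)) (cong +_ (trans (sym (ℕP.^-distribˡ-+-* q (l ℕ.* dim y) (l ℕ.* dims ys))) (cong (q ℕ.^_) (sym (ℕP.*-distribˡ-+ l (dim y) (dims ys))))))))

    dims-≤ : ∀ {ys} → Independent ys → dims ys ℕ.≤ m
    dims-≤ {ys} ind = ℕP.*-cancelˡ-≤ l {{ℕ.>-nonZero 1≤l}} (subst (l ℕ.* dims ys ℕ.≤_) (sym lm≡n)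
      (exponent-≤ 0# (subst (_≤ + Q) (total-size ind) (≤-trans (∑-mono (λ z → ind≤1 (mem? (total ys) z))) (≤-reflexive (trans (∑-const Q 1ℤ) (ℤP.*-identityʳ (+ Q))))))))

    dims-split : (D : Decomposition) → let open Decomposition D in length lines ℕ.+ 2 ℕ.* length others ℕ.≤ m
    dims-split D = ℕP.≤-trans (subst (ℕ._≤ dims (others ++ lines)) (ℕP.+-comm (2 ℕ.* length others) (length lines))
        (subst (2 ℕ.* length others ℕ.+ length lines ℕ.≤_) (sym (dims-++ others lines))
          (ℕP.+-mono-≤ (dims-≥ 2 others-dim) (subst (ℕ._≤ dims lines) (ℕP.*-identityˡ _) (dims-≥ 1 (All.map (λ d≡1 → ℕP.≤-reflexive (sym d≡1)) lines-dim))))))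
        (dims-≤ independent)
      where open Decomposition D

    sumN-span : ∀ x d (a : ℕ → A) → (∀ i → InK l (a i)) → Span x d (sumN d (λ i → a i ⊗ frobₗ i x))
    sumN-span x zero    a ka = refl
    sumN-span x (suc d) a ka = a d , ka d , subst (Span x d) (solve 2 (λ s u → s := s :+ u :- u) refl _ _) (sumN-span x d a ka)

    span-sumN : ∀ x d {z} → Span x d z → ∃ λ (a : ℕ → A) → (∀ i → InK l (a i)) × sumN d (λ i → a i ⊗ frobₗ i x) ≡ z
    span-sumN x zero    refl = (λ _ → 0#) , (λ _ → K-0# {l}) , refl
    span-sumN x (suc d) {z} (c , kc , s) with span-sumN x d s
    ... | a , ka , eq = a′ , ka′ , trans (cong₂ _⊕_ (trans (agree d ℕP.≤-refl) eq) (cong (_⊗ frobₗ d x) at-d)) (sym (split x z _))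
      where
      pick : ∀ i → Dec (i ≡ d) → A
      pick i (yes _) = c
      pick i (no _)  = a i
      a′ : ℕ → A
      a′ i = pick i (i ℕP.≟ d)
      ka′ : ∀ i → InK l (a′ i)
      ka′ i with i ℕP.≟ d
      ... | yes _ = kc
      ... | no _  = ka i
      at-d : a′ d ≡ c
      at-d with d ℕP.≟ d
      ... | yes _ = refl
      ... | no ¬e = contradiction refl ¬e
      below : ∀ i → i ℕ.< d → a′ i ≡ a i
      below i i<d with i ℕP.≟ d
      ... | yes refl = contradiction i<d (ℕP.n≮n d)
      ... | no _ = refl
      agree : ∀ e → e ℕ.≤ d → sumN e (λ i → a′ i ⊗ frobₗ i x) ≡ sumN e (λ i → a i ⊗ frobₗ i x)
      agree zero    _   = refl
      agree (suc e) e<d = cong₂ _⊕_ (agree e (ℕP.<⇒≤ e<d)) (cong (_⊗ frobₗ e x) (below e e<d))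

    module _ (x : A) (free : ∀ i → i ℕ.< m → ¬ Stable x i) where
      span-everything : ∀ z → Span x m z
      span-everything z = ⊆∧size≥⇒⊇ (span? x m) (λ _ → yes tt) (λ _ _ → tt)
        (≤-reflexive (trans (∑-const Q 1ℤ) (trans (ℤP.*-identityʳ (+ Q)) (sym (trans (span-size x m free) (cong +_ (trans (cong (q ℕ.^_) lm≡n) (sym Q≡qⁿ)))))))) z tt

      -- In a relation with nonzero top coefficient, dividing by that coefficient would place
      -- τ^(d-1) x in the span of the earlier conjugates.
      linearly-independent : ∀ d → d ℕ.≤ m → ∀ (a : ℕ → A) → (∀ i → InK l (a i)) → sumN d (λ i → a i ⊗ frobₗ i x) ≡ 0# → ∀ i → i ℕ.< d → a i ≡ 0#
      linearly-independent (suc d) d<m a ka eq i i<1+d with a d ≟ 0#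
      ... | no ad≢0 = contradiction (span-cancel x d (ka d) ad≢0 (subst (Span x d) (sym (RP.+-inverseʳ-unique _ _ eq)) (span-⊖ x d (sumN-span x d a ka)))) (free d d<m)
      ... | yes ad≡0 = case (ℕP.m≤n⇒m<n∨m≡n (ℕ.s≤s⁻¹ i<1+d))
        where
        rest : sumN d (λ i → a i ⊗ frobₗ i x) ≡ 0#
        rest = trans (sym (trans (cong (λ u → sumN d (λ i → a i ⊗ frobₗ i x) ⊕ u ⊗ frobₗ d x) ad≡0) (trans (cong (sumN d (λ i → a i ⊗ frobₗ i x) ⊕_) (R.zeroˡ _)) (R.+-identityʳ _)))) eq
        case : i ℕ.< d ⊎ i ≡ d → a i ≡ 0#
        case (inj₁ i<d)  = linearly-independent d (ℕP.<⇒≤ d<m) a ka rest i i<d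
        case (inj₂ refl) = ad≡0

  -- The number of Frobenius-stable lines over F_q.

  module Lines (g : ℕ) (g≡gcd : g ≡ gcd n (q ℕ.∸ 1)) where
    open SubfieldModules 1 n (ℕP.*-identityˡ n)
    open Module

    1≤g : 1 ℕ.≤ g
    1≤g = ℕP.n≢0⇒n>0 (λ g≡0 → ℕP.<⇒≢ 1≤n (sym (gcd[m,n]≡0⇒m≡0 (trans (sym g≡gcd) g≡0))))

    -- An eigenvalue c in F_q satisfies c^(q-1) = 1, so y is fixed by Frob^(q-1). It is also fixed
    -- by Frob^n, hence by Frob^gcd.
    eigenvector-fixed : ∀ {y c} → y ≢ 0# → InK 1 c → frob 1 y ≡ c ⊗ y → frob g y ≡ y
    eigenvector-fixed {y} {c} y≢0 kc eig = subst (λ j → frob j y ≡ y) (sym g≡gcd) (gcd-closed (λ j → frob j y ≡ y) (frob-id y)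
        (λ {a} {b} fa fb → trans (frob-+ a b y) (trans (cong (frob a) fb) fa))
        (λ {a} {b} fa fba → trans (cong (frob b) (sym fa)) (trans (sym (frob-+ b a y)) fba))
        {n} {q ℕ.∸ 1} (frob-n y) (trans (powers (q ℕ.∸ 1)) (trans (cong (_⊗ y) c^[q-1]≡1) (R.*-identityˡ y))))
      where
      c≢0 : c ≢ 0#
      c≢0 refl = y≢0 (frob≡0 1 (trans eig (R.zeroˡ y)))
      powers : ∀ j → frob j y ≡ pow c j ⊗ y
      powers zero    = trans (frob-id y) (sym (R.*-identityˡ y))
      powers (suc j) = trans (frob-+ 1 j y) (trans (cong (frob 1) (powers j)) (trans (frob-⊗ 1 (pow c j) y)
        (trans (cong₂ _⊗_ (K-pow j) eig) (solve 3 (λ a c y → a :* (c :* y) := c :* a :* y) refl (pow c j) c y))))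
        where
        K-pow : ∀ j → InK 1 (pow c j)
        K-pow zero    = K-1# {1}
        K-pow (suc j) = K-⊗ {1} kc (K-pow j)
      c^[q-1]≡1 : pow c (q ℕ.∸ 1) ≡ 1#
      c^[q-1]≡1 = ⊗-cancelˡ c≢0 (trans (trans (cong (pow c) (trans (ℕP.m+[n∸m]≡n 1≤q) (sym (ℕP.*-identityʳ q)))) kc) (sym (R.*-identityʳ c)))

    line-fixed : ∀ {y} → Simple y → dim y ≡ 1 → ∀ z → Mem (cyclic y) z → frob g z ≡ z
    line-fixed {y} (y≢0 , _) d≡1 z z∈ with subst (λ d → Span y d (frobₗ d y)) d≡1 (dim-stable y) | subst (λ d → Span y d z) d≡1 z∈
    ... | c , kc , eig | c′ , kc′ , eq = trans (cong (frob g) z≡) (trans (frob-⊗ g c′ y) (trans (cong₂ _⊗_ (K₁⊆K g kc′) (eigenvector-fixed y≢0 kc eig′)) (sym z≡)))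
      where
      z≡ : z ≡ c′ ⊗ y
      z≡ = trans (⊝≡0⇒≡ eq) (cong (c′ ⊗_) (frobₗ-0 y))
      eig′ : frob 1 y ≡ c ⊗ y
      eig′ = trans (⊝≡0⇒≡ eig) (cong (c ⊗_) (frobₗ-0 y))

    lines-fixed : ∀ {ys} → Independent ys → All (λ y → dim y ≡ 1) ys → ∀ z → Mem (total ys) z → frob g z ≡ z
    lines-fixed []                 []       z refl = frob-0# g
    lines-fixed {y ∷ ys} ((sy , _) ∷ ind) (d ∷ ds) z (u , u∈ , v∈) = trans (cong (frob g) (split y z u)) (trans (frob-⊕ g _ _)
      (trans (cong₂ _⊕_ (lines-fixed ind ds _ v∈) (line-fixed sy d u u∈)) (sym (split y z u))))

    -- The direct sum of the lines has at least q^(number of lines) elements, all of them roots of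
    -- z^(q^g) - z.
    lines-≤ : (D : Decomposition) → length (Decomposition.lines D) ℕ.≤ g
    lines-≤ D = ℕP.≤-trans (subst (ℕ._≤ dims lines) (ℕP.*-identityˡ _) (dims-≥ 1 (All.map (λ d≡1 → ℕP.≤-reflexive (sym d≡1)) lines-dim)))
        (subst (ℕ._≤ g) (ℕP.*-identityˡ _) (q^-cancel-≤ (ℤP.drop‿+≤+ (subst (_≤ + (q ℕ.^ g)) (total-size independent₁)
          (≤-trans (∑-mono (λ z → ind-mono (mem? (total lines) z) (frob g z ⊝ z ≟ 0#) (λ z∈ → ≡⇒⊝≡0 (lines-fixed independent₁ lines-dim z z∈))))
            (roots-≤ (q ℕ.^ g) monic))))))
      where
      open Decomposition D
      2≤q^g : 2 ℕ.≤ q ℕ.^ g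
      2≤q^g = ℕP.≤-trans 2≤q (subst (ℕ._≤ q ℕ.^ g) (ℕP.*-identityʳ q) (q^-mono 1≤g))
      monic : Monic (q ℕ.^ g) (λ z → frob g z ⊝ z)
      monic = ⊖_ , Low-≤ 2≤q^g (Low-cong 2 (λ z → trans (RP.-1*x≈-x _) (cong ⊖_ (pow-1 z))) (Low-⊗ 2 (⊖ 1#) (Low-pow 1))) , λ z → refl

  -- The modules for l ≥ 2 and their total density.

  Weighted : Set₁
  Weighted = List (Subspace × ℕ)

  weight : Weighted → ℕ
  weight []             = 0
  weight ((_ , w) ∷ xs) = w ℕ.+ weight xs

  weight-++ : ∀ xs ys → weight (xs ++ ys) ≡ weight xs ℕ.+ weight ys
  weight-++ []             ys = refl
  weight-++ ((_ , w) ∷ xs) ys = trans (cong (w ℕ.+_) (weight-++ xs ys)) (sym (ℕP.+-assoc w _ _))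

  -- That is 1/|S| ≤ w/Q: the weight bounds the expected density of the complement, on a common
  -- scale for all l.
  Dense : Subspace × ℕ → Set
  Dense (S , w) = + Q ≤ size S * + w

  module _ (l m : ℕ) (eq : l ℕ.* m ≡ n) where
    open SubfieldModules l m eq

    generators : List A
    generators = Decomposition.others decomposition ++ Decomposition.lines decomposition

    -- A nonzero module for l has at least q^l elements, whence the weight q^(n-l).
    entry : A → Subspace × ℕ
    entry y = Module.subspace (cyclic y) , q ℕ.^ (n ℕ.∸ l)

    entries : Weighted
    entries = map entry generators

    generators-dim : All (λ y → 1 ℕ.≤ dim y) generators
    generators-dim = AllP.++⁺ (All.map (ℕP.≤-trans (ℕP.n≤1+n 1)) (Decomposition.others-dim decomposition))
                              (All.map (λ e → ℕP.≤-reflexive (sym e)) (Decomposition.lines-dim decomposition))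

    generators-length : length generators ℕ.≤ m
    generators-length = ℕP.≤-trans (subst (ℕ._≤ dims generators) (ℕP.*-identityˡ (length generators)) (dims-≥ 1 generators-dim)) (dims-≤ (Decomposition.independent decomposition))

    weight-entries : weight entries ≡ length generators ℕ.* q ℕ.^ (n ℕ.∸ l)
    weight-entries = go generators
      where
      go : ∀ ys → weight (map entry ys) ≡ length ys ℕ.* q ℕ.^ (n ℕ.∸ l)
      go []       = refl
      go (y ∷ ys) = cong (q ℕ.^ (n ℕ.∸ l) ℕ.+_) (go ys)

    m≤n : m ℕ.≤ n
    m≤n = subst (m ℕ.≤_) eq (ℕP.m≤n*m m l {{ℕ.>-nonZero 1≤l}})

    l≤n : l ℕ.≤ n
    l≤n = subst (l ℕ.≤_) eq (ℕP.m≤m*n l m {{ℕ.>-nonZero 1≤m}})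

    entries-dense : All Dense entries
    entries-dense = AllP.map⁺ (All.map dense generators-dim)
      where
      dense : ∀ {y} → 1 ℕ.≤ dim y → Dense (entry y)
      dense {y} 1≤d = subst (λ s → + Q ≤ s * + (q ℕ.^ (n ℕ.∸ l))) (sym (cyclic-size y))
        (subst (+ Q ≤_) (ℤP.pos-* (q ℕ.^ (l ℕ.* dim y)) (q ℕ.^ (n ℕ.∸ l))) (+≤+ (begin
          Q  ≡⟨ Q≡qⁿ ⟩
          q ℕ.^ n  ≡⟨ cong (q ℕ.^_) (sym (ℕP.m+[n∸m]≡n l≤n)) ⟩
          q ℕ.^ (l ℕ.+ (n ℕ.∸ l))  ≡⟨ ℕP.^-distribˡ-+-* q l (n ℕ.∸ l) ⟩
          q ℕ.^ l ℕ.* q ℕ.^ (n ℕ.∸ l)  ≤⟨ ℕP.*-monoˡ-≤ (q ℕ.^ (n ℕ.∸ l)) (q^-mono (subst (ℕ._≤ l ℕ.* dim y) (ℕP.*-identityʳ l) (ℕP.*-monoʳ-≤ l 1≤d))) ⟩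
          q ℕ.^ (l ℕ.* dim y) ℕ.* q ℕ.^ (n ℕ.∸ l)  ∎)))
        where open ℕP.≤-Reasoning

    entries-complete : ∀ x → All (λ (S , _) → ¬ (x ⟂ S)) entries → ∀ i → i ℕ.< m → ¬ Stable x i
    entries-complete x none = not-perp⇒free decomposition x (AllP.All¬⇒¬Any (AllP.map⁻ none))

  entriesAt : ∀ l → Dec (l ∣ n) → Weighted
  entriesAt l (yes (divides m eq)) = entries l m (trans (ℕP.*-comm l m) (sym eq))
  entriesAt l (no _)               = []

  bad : ℕ → Weighted
  bad zero          = []
  bad (suc zero)    = []
  bad (suc (suc b)) = entriesAt (suc (suc b)) (suc (suc b) ∣? n) ++ bad (suc b)

  bad-dense : ∀ b → All Dense (bad b)
  bad-dense zero          = []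
  bad-dense (suc zero)    = []
  bad-dense (suc (suc b)) = AllP.++⁺ (at (suc (suc b)) (suc (suc b) ∣? n)) (bad-dense (suc b))
    where
    at : ∀ l d → All Dense (entriesAt l d)
    at l (yes (divides m eq)) = entries-dense l m _
    at l (no _)               = []

  length-at : ∀ l d → length (entriesAt l d) ℕ.≤ n
  length-at l (yes (divides m eq)) = ℕP.≤-trans (ℕP.≤-reflexive (length-map (entry l m _) (generators l m _))) (ℕP.≤-trans (generators-length l m _) (m≤n l m (trans (ℕP.*-comm l m) (sym eq))))
  length-at l (no _)               = ℕ.z≤n

  bad-length : ∀ b → length (bad b) ℕ.≤ b ℕ.* n
  bad-length zero          = ℕ.z≤n
  bad-length (suc zero)    = ℕ.z≤n
  bad-length (suc (suc b)) = ℕP.≤-trans (ℕP.≤-reflexive (length-++ (entriesAt (suc (suc b)) (suc (suc b) ∣? n)))) (ℕP.+-mono-≤ (length-at (suc (suc b)) (suc (suc b) ∣? n)) (bad-length (suc b)))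

  bad-complete : ∀ x b → All (λ (S , _) → ¬ (x ⟂ S)) (bad b) → ∀ l m (eq : l ℕ.* m ≡ n) → 2 ℕ.≤ l → l ℕ.≤ b →
                 ∀ i → i ℕ.< m → ¬ SubfieldModules.Stable l m eq x i
  bad-complete x zero          none l m eq 2≤l l≤b = contradiction (ℕP.≤-trans 2≤l l≤b) (λ ())
  bad-complete x (suc zero)    none l m eq 2≤l l≤b = contradiction (ℕP.≤-trans 2≤l l≤b) (λ { (ℕ.s≤s ()) })
  bad-complete x (suc (suc b)) none l m eq 2≤l l≤b =
    [ (λ l< → bad-complete x (suc b) (proj₂ none′) l m eq 2≤l (ℕ.s≤s⁻¹ l<)) , top ]′ (ℕP.m≤n⇒m<n∨m≡n l≤b)
    where
    none′ = AllP.++⁻ (entriesAt (suc (suc b)) (suc (suc b) ∣? n)) none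
    at : ∀ l d → All (λ (S , _) → ¬ (x ⟂ S)) (entriesAt l d) → 2 ℕ.≤ l → ∀ m (eq : l ℕ.* m ≡ n) → ∀ i → i ℕ.< m → ¬ SubfieldModules.Stable l m eq x i
    at l (no ¬d) _ _ m eq = contradiction (divides m (trans (sym eq) (ℕP.*-comm l m))) ¬d
    at l (yes (divides m′ eq′)) none 2≤l m eq = same (ℕP.*-cancelˡ-≡ m′ m l {{ℕ.>-nonZero (ℕP.≤-trans (ℕP.n≤1+n 1) 2≤l)}} (trans (ℕP.*-comm l m′) (trans (sym eq′) (sym eq)))) (trans (ℕP.*-comm l m′) (sym eq′)) none
      where
      same : m′ ≡ m → (e : l ℕ.* m′ ≡ n) → All (λ (S , _) → ¬ (x ⟂ S)) (entries l m′ e) → ∀ i → i ℕ.< m → ¬ SubfieldModules.Stable l m eq x i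
      -- The modules are indexed by the proof of l m = n; uniqueness of such proofs identifies those
      -- found by the divisibility test with those asked for.
      same refl e none = subst (λ e → ∀ i → i ℕ.< m → ¬ SubfieldModules.Stable l m e x i) (ℕP.≡-irrelevant e eq) (entries-complete l m e x none)
    top : l ≡ suc (suc b) → ∀ i → i ℕ.< m → ¬ SubfieldModules.Stable l m eq x i
    top refl = at l (l ∣? n) (proj₁ none′) 2≤l m eq

  weight-at : ∀ l d → weight (entriesAt l d) ℕ.≤ n ℕ.* q ℕ.^ (n ℕ.∸ l)
  weight-at l (no _)               = ℕ.z≤n
  weight-at l (yes (divides m eq)) = ℕP.≤-trans (ℕP.≤-reflexive (weight-entries l m _)) (ℕP.*-monoˡ-≤ (q ℕ.^ (n ℕ.∸ l)) (ℕP.≤-trans (generators-length l m _) (m≤n l m (trans (ℕP.*-comm l m) (sym eq)))))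

  -- For l = 2 the number of modules is bounded by m = n/2 instead of the cruder n of `weight-at`,
  -- because this term has constant relative size when n is of order q².
  weight-2 : 2 ℕ.* weight (bad 2) ℕ.≤ n ℕ.* q ℕ.^ (n ℕ.∸ 2)
  weight-2 = ℕP.≤-trans (ℕP.≤-reflexive (cong (2 ℕ.*_) (trans (weight-++ (entriesAt 2 (2 ∣? n)) []) (ℕP.+-identityʳ _)))) (at (2 ∣? n))
    where
    at : ∀ d → 2 ℕ.* weight (entriesAt 2 d) ℕ.≤ n ℕ.* q ℕ.^ (n ℕ.∸ 2)
    at (no _)               = ℕ.z≤n
    at (yes (divides m eq)) = ℕP.≤-trans (ℕP.≤-reflexive (trans (cong (2 ℕ.*_) (weight-entries 2 m _)) (sym (ℕP.*-assoc 2 (length (generators 2 m _)) _))))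
      (ℕP.*-monoˡ-≤ (q ℕ.^ (n ℕ.∸ 2)) (ℕP.≤-trans (ℕP.*-monoʳ-≤ 2 (generators-length 2 m _)) (ℕP.≤-reflexive (trans (ℕP.*-comm 2 m) (sym eq)))))

  weight-2-odd : ¬ (2 ∣ n) → weight (bad 2) ≡ 0
  weight-2-odd odd = trans (weight-++ (entriesAt 2 (2 ∣? n)) []) (trans (ℕP.+-identityʳ _) (at (2 ∣? n)))
    where
    at : ∀ d → weight (entriesAt 2 d) ≡ 0
    at (no _)  = refl
    at (yes d) = contradiction d odd

  -- Telescoping the geometric series: n qⁿ⁻ᵇ is the tail still available beyond b.
  weight-bound : ∀ b → 2 ℕ.≤ b → b ℕ.≤ n →
                 (q ℕ.∸ 1) ℕ.* weight (bad b) ℕ.+ n ℕ.* q ℕ.^ (n ℕ.∸ b) ℕ.≤ (q ℕ.∸ 1) ℕ.* weight (bad 2) ℕ.+ n ℕ.* q ℕ.^ (n ℕ.∸ 2)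
  weight-bound (suc zero) (ℕ.s≤s ()) _
  weight-bound (suc (suc zero)) _ _ = ℕP.≤-refl
  weight-bound (suc (suc (suc b))) _ b<n = ℕP.≤-trans (begin
      r ℕ.* weight (bad (suc b₂)) ℕ.+ n ℕ.* X  ≡⟨ cong (λ z → r ℕ.* z ℕ.+ n ℕ.* X) (weight-++ (entriesAt (suc b₂) (suc b₂ ∣? n)) (bad b₂)) ⟩
      r ℕ.* (weight (entriesAt (suc b₂) (suc b₂ ∣? n)) ℕ.+ W) ℕ.+ n ℕ.* X ≤⟨ ℕP.+-monoˡ-≤ (n ℕ.* X) (ℕP.*-monoʳ-≤ r (ℕP.+-monoˡ-≤ W (weight-at (suc b₂) (suc b₂ ∣? n)))) ⟩
      r ℕ.* (n ℕ.* X ℕ.+ W) ℕ.+ n ℕ.* X  ≡⟨ telescope r n X W ⟩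
      r ℕ.* W ℕ.+ n ℕ.* ((1 ℕ.+ r) ℕ.* X)  ≡⟨ cong (λ z → r ℕ.* W ℕ.+ n ℕ.* (z ℕ.* X)) (ℕP.m+[n∸m]≡n 1≤q) ⟩
      r ℕ.* W ℕ.+ n ℕ.* (q ℕ.* X)  ≡⟨ cong (λ z → r ℕ.* W ℕ.+ n ℕ.* q ℕ.^ z) (sym (ℕP.+-∸-assoc 1 b<n)) ⟩
      r ℕ.* W ℕ.+ n ℕ.* q ℕ.^ (n ℕ.∸ b₂)  ∎)
      (weight-bound (suc (suc b)) (ℕ.s≤s (ℕ.s≤s ℕ.z≤n)) (ℕP.<⇒≤ b<n))
    where
    open ℕP.≤-Reasoning
    b₂ = suc (suc b)
    r = q ℕ.∸ 1
    X = q ℕ.^ (n ℕ.∸ suc b₂)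
    W = weight (bad b₂)

  -- Counting elements that avoid all obstructions.

  module Counting (T : ℕ) (qQ≤TT : q ℕ.* Q ℕ.≤ T ℕ.* T) where
    open FinalInequality
    open PrimeDivisor
    open PrimeDivisors N 1≤N
    open SubfieldModules 1 n (ℕP.*-identityˡ n)
    open Module
    open Sieve {Q} (+ N) (+ T)

    u : Subspace → A → ℤ
    u S x = ind (x ⟂? S)

    -- The invariant of the sieve: every intersection is that of the e-th roots of unity, e = N/D,
    -- with one complement S^⊥, so its expected mass is N/(D|S|).
    Base : Subspace → ℕ → ℕ → (A → ℤ) → ℤ → Set
    Base S e D b δ = 1 ℕ.≤ e × e ℕ.* D ≡ N × (∀ x → b x ≡ h e x * u S x) × δ ≡ + D * size S

    sieve-base : ∀ {S e D b δ} → Base S e D b δ → Sieveable b δ []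
    sieve-base {S} {e} {D} {b} {δ} (1≤e , eD≡N , b≡ , δ≡) = ≤-trans (≤-reflexive lhs) (≤-trans (*-monoˡ {+ D} (+≤+ ℕ.z≤n) up) (≤-reflexive rhs))
                  , ≤-trans (≤-reflexive (trans (cong +_ (sym eD≡N)) (trans (ℤP.pos-* e D) (ℤP.*-comm (+ e) (+ D))))) (≤-trans (*-monoˡ {+ D} (+≤+ ℕ.z≤n) lo) (≤-reflexive (trans (ℤP.*-distribˡ-+ (+ D) _ _) (cong₂ _+_ (sym lhs) δT))))
      where
      up = proj₁ (equidistribution T qQ≤TT e D 1≤e eD≡N S)
      lo = proj₂ (equidistribution T qQ≤TT e D 1≤e eD≡N S)
      G = ∑ (λ x → h e x * u S x)
      lhs : δ * ∑ b ≡ + D * (size S * G)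
      lhs = trans (cong₂ _*_ δ≡ (∑-cong b≡)) (ℤP.*-assoc (+ D) (size S) G)
      δT : + D * (size S * + T) ≡ δ * + T
      δT = trans (sym (ℤP.*-assoc (+ D) (size S) (+ T))) (cong (_* + T) (sym δ≡))
      rhs : + D * (+ e + size S * + T) ≡ + N + δ * + T
      rhs = trans (ℤP.*-distribˡ-+ (+ D) (+ e) (size S * + T)) (cong₂ _+_ (trans (sym (ℤP.pos-* D e)) (cong +_ (trans (ℕP.*-comm D e) eD≡N))) δT)

    primeItem : PrimeDivisor N → Item
    primeItem d = h (cofactor d) , + r d

    -- With e = f r and N/r = f D, both conditions say that the r-th and the D-th power of x^f are
    -- 1; since r and D are coprime, x^f = 1.
    h-prime : ∀ {e D} (d : PrimeDivisor N) → 1 ℕ.≤ e → e ℕ.* D ≡ N → ¬ (r d ∣ D) →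
              ∃ λ f → 1 ℕ.≤ f × f ℕ.* (D ℕ.* r d) ≡ N × (∀ x → h e x * h (cofactor d) x ≡ h f x)
    h-prime {e} {D} d 1≤e eD≡N r∤D with euclidsLemma e D (prime d) (divides (cofactor d) (trans eD≡N (sym (factors d))))
    ... | inj₂ r∣D = contradiction r∣D r∤D
    ... | inj₁ (divides f e≡fr) = f , 1≤f f e≡fr , fDr≡N , λ x → ind-* (pow x e ≟ 1#) (pow x (cofactor d) ≟ 1#) (pow x f ≟ 1#) (both x)
            (λ xᶠ≡1 → trans (cong (pow x) e≡fr) (pow≡1-* f (r d) xᶠ≡1) , trans (cong (pow x) cof≡fD) (pow≡1-* f D xᶠ≡1))
      where
      instance
        r≢0 : ℕ.NonZero (r d)
        r≢0 = prime⇒nonZero (prime d)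
      1≤f : ∀ f → e ≡ f ℕ.* r d → 1 ℕ.≤ f
      1≤f zero    eq = subst (1 ℕ.≤_) eq 1≤e
      1≤f (suc f) eq = ℕ.s≤s ℕ.z≤n
      swap : ∀ a b c → a ℕ.* (b ℕ.* c) ≡ a ℕ.* c ℕ.* b
      swap a b c = trans (cong (a ℕ.*_) (ℕP.*-comm b c)) (sym (ℕP.*-assoc a c b))
      fDr≡N : f ℕ.* (D ℕ.* r d) ≡ N
      fDr≡N = trans (swap f D (r d)) (trans (cong (ℕ._* D) (sym e≡fr)) eD≡N)
      cof≡fD : cofactor d ≡ f ℕ.* D
      cof≡fD = ℕP.*-cancelʳ-≡ (cofactor d) (f ℕ.* D) (r d) (trans (factors d) (trans (sym fDr≡N) (sym (ℕP.*-assoc f D (r d)))))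
      both : ∀ x → pow x e ≡ 1# → pow x (cofactor d) ≡ 1# → pow x f ≡ 1#
      both x xᵉ≡1 xᶜ≡1 = trans (sym (pow-1 _)) (subst (λ g → pow (pow x f) g ≡ 1#) (prime-gcd≡1 (prime d) r∤D)
        (pow≡1-gcd {a = r d} {D} (trans (sym (pow-* x f (r d))) (trans (cong (pow x) (sym e≡fr)) xᵉ≡1)) (trans (sym (pow-* x f D)) (trans (cong (pow x) (sym cof≡fD)) xᶜ≡1))))

    -- Taking an event multiplies D by its prime. The later primes are smaller, hence distinct from
    -- it, and still do not divide the new D.
    sieve-primes : ∀ S L → (∀ {e D b δ} → Base S e D b δ → Sieveable b δ L) →
                   ∀ ds → AllPairs (λ d d′ → r d′ ℕ.< r d) ds → ∀ {e D b δ} → All (λ d → ¬ (r d ∣ D)) ds →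
                   Base S e D b δ → Sieveable b δ (map primeItem ds ++ L)
    sieve-primes S L tail [] _ {e} {D} _ base = tail {e} {D} base
    sieve-primes S L tail (d ∷ ds) (lts ∷ sorted) {e} {D} {b} {δ} (r∤D ∷ rs∤D) base@(1≤e , eD≡N , b≡ , δ≡) with h-prime d 1≤e eD≡N r∤D
    ... | f , 1≤f , fDr≡N , hh = +≤+ ℕ.z≤n , sieve-primes S L tail ds sorted rs∤D base , sieve-primes S L tail ds sorted (step ds lts rs∤D) (1≤f , fDr≡N , b≡′ , δ≡′)
      where
      ring : ∀ a b c → a * b * c ≡ a * c * b
      ring = solve-∀
      b≡′ : ∀ x → b x * h (cofactor d) x ≡ h f x * u S x
      b≡′ x = trans (cong (_* h (cofactor d) x) (b≡ x)) (trans (ring (h e x) (u S x) (h (cofactor d) x)) (cong (_* u S x) (hh x)))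
      δ≡′ : δ * + r d ≡ + (D ℕ.* r d) * size S
      δ≡′ = trans (cong (_* + r d) δ≡) (trans (ring (+ D) (size S) (+ r d)) (cong (_* size S) (sym (ℤP.pos-* D (r d)))))
      step : ∀ ds → All (λ d′ → r d′ ℕ.< r d) ds → All (λ d′ → ¬ (r d′ ∣ D)) ds → All (λ d′ → ¬ (r d′ ∣ D ℕ.* r d)) ds
      step []        []         []         = []
      step (d′ ∷ ds) (lt ∷ lts) (nd ∷ nds) = not ∷ step ds lts nds
        where
        not : ¬ (r d′ ∣ D ℕ.* r d)
        not div with euclidsLemma D (r d) (prime d′) div
        ... | inj₁ d∣D = nd d∣D
        ... | inj₂ d∣r with prime⇒irreducible (prime d) d∣r
        ...   | inj₁ r≡1 = ¬prime[1] (subst Prime r≡1 (prime d′))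
        ...   | inj₂ r≡r = ℕP.<⇒≢ lt r≡r

    moduleItem : A → Item
    moduleItem y = u (subspace (cyclic y)) , ∣ cyclic y ∣

    -- `W` accumulates the modules chosen so far: orthogonality to several modules is orthogonality
    -- to their sum. Disjointness from the remaining ones keeps the sizes multiplicative.
    sieve-modules : ∀ ys W → Independent ys → Disjoint W (total ys) → ∀ {e D b δ} → Base (subspace W) e D b δ → Sieveable b δ (map moduleItem ys)
    sieve-modules [] W _ _ {e} {D} base = sieve-base {subspace W} {e} {D} base
    sieve-modules (y ∷ ys) W ((_ , disjoint) ∷ ind′) W∩ {e} {D} {b} {δ} base@(1≤e , eD≡N , b≡ , δ≡) =
        ∑-nonneg (λ z → 0≤ind (mem? (cyclic y) z))
      , sieve-modules ys W ind′ (λ z z∈W z∈ → W∩ z z∈W (⊞-right (cyclic y) (total ys) z∈)) base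
      , sieve-modules ys (cyclic y ⊞ W) ind′ disjoint′ (1≤e , eD≡N , b≡′ , δ≡′)
      where
      disjoint′ : Disjoint (cyclic y ⊞ W) (total ys)
      disjoint′ z (v , v∈ , w∈) z∈ = disjoint z (subst (Mem (cyclic y)) (sym z≡v) v∈) z∈
        where
        z≡v : z ≡ v
        z≡v = ⊝≡0⇒≡ (W∩ (z ⊝ v) w∈ (⊕∈ (total (y ∷ ys)) (⊞-right (cyclic y) (total ys) z∈) (⊖∈ (total (y ∷ ys)) (⊞-left (cyclic y) (total ys) v∈))))
      b≡′ : ∀ x → b x * u (subspace (cyclic y)) x ≡ h e x * u (subspace (cyclic y ⊞ W)) x
      b≡′ x = trans (cong (_* u (subspace (cyclic y)) x) (b≡ x)) (trans (ℤP.*-assoc (h e x) _ _) (cong (h e x *_)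
        (ind-* (x ⟂? subspace W) (x ⟂? subspace (cyclic y)) (x ⟂? subspace (cyclic y ⊞ W)) (λ xW xy → ⟂-⊞ (cyclic y) W xy xW) (λ ⟂ → let (xy , xW) = ⟂-⊞⁻ (cyclic y) W ⟂ in xW , xy))))
      ring : ∀ a b c → a * b * c ≡ a * (c * b)
      ring = solve-∀
      δ≡′ : δ * ∣ cyclic y ∣ ≡ + D * ∣ cyclic y ⊞ W ∣
      δ≡′ = trans (cong (_* ∣ cyclic y ∣) δ≡) (trans (ring (+ D) ∣ W ∣ ∣ cyclic y ∣) (cong (+ D *_) (sym (⊞-size (cyclic y) W (λ z z∈y z∈W → W∩ z z∈W (⊞-left (cyclic y) (total ys) z∈y))))))

    primes : List (PrimeDivisor N)
    primes = divisors N

    P : List Item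
    P = map primeItem primes

    private
      base₀ : ∀ S → Base S N 1 (λ x → h N x * u S x) (size S)
      base₀ S = 1≤N , ℕP.*-identityʳ N , (λ x → refl) , sym (ℤP.*-identityˡ (size S))

      primes∤1 : All (λ d → ¬ (r d ∣ 1)) primes
      primes∤1 = All.universal (λ d d∣1 → contradiction (∣⇒≤ d∣1) (ℕP.<⇒≱ (ℕ.nonTrivial⇒n>1 (r d) {{prime⇒nonTrivial (prime d)}}))) primes

    -- C S counts the primitive elements orthogonal to S, and C₀ those orthogonal to no module of ys.
    C : Subspace → ℤ
    C S = ∑ (λ x → h N x * u S x * sift P x)

    -- Orthogonality to S sits in the initial weight and only the primes are sieved, so modules for
    -- different l are never intersected.
    C-upper : ∀ S → size S * modulus P * C S ≤ + N * survivors P + size S * modulus P * 2^ P * + T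
    C-upper S = subst (λ L → size S * modulus L * ∑ (λ x → h N x * u S x * sift L x) ≤ + N * survivors L + size S * modulus L * 2^ L * + T) (++-identityʳ P)
      (proj₁ (sieve (P ++ []) (λ x → h N x * u S x) (size S) (∑-nonneg (λ z → 0≤ind (Subspace.mem? S z)))
        (sieve-primes S [] (λ {e} {D} → sieve-base {S} {e} {D}) primes (divisors-sorted N) primes∤1 (base₀ S))))

    1n≡n : 1 ℕ.* n ≡ n
    1n≡n = ℕP.*-identityˡ n

    ys : List A
    ys = generators 1 n 1n≡n

    M : List Item
    M = map moduleItem ys

    C₀ : ℤ
    C₀ = ∑ (λ x → h N x * sift (P ++ M) x)

    -- The sieve starts from the zero module, to which every x is orthogonal.
    C₀-lower : + N * (survivors P * survivors M) ≤ modulus P * modulus M * C₀ + modulus P * modulus M * (2^ P * 2^ M) * + T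
    C₀-lower = ≤-trans (≤-reflexive (cong (+ N *_) (sym (survivors-++ P M)))) (≤-trans lower (≤-reflexive rhs))
      where
      Z = subspace zeroModule
      size-Z : size Z ≡ 1ℤ
      size-Z = trans (∑-cong (λ z → sym (ℤP.*-identityʳ _))) (∑-δ 0# (λ _ → 1ℤ))
      u-Z : ∀ x → u Z x ≡ 1ℤ
      u-Z x = ind-yes (x ⟂? Z) (λ z z≡0 → trans (cong (λ z → Tr (z ⊗ x)) z≡0) (trans (cong Tr (R.zeroˡ x)) Tr-0#))
      L = P ++ M
      lower : + N * survivors L ≤ size Z * modulus L * ∑ (λ x → h N x * u Z x * sift L x) + size Z * modulus L * 2^ L * + T
      lower = proj₂ (sieve L (λ x → h N x * u Z x) (size Z) (∑-nonneg (λ z → 0≤ind (Subspace.mem? Z z)))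
        (sieve-primes Z M (sieve-modules ys zeroModule (Decomposition.independent decomposition) (λ z z≡0 _ → z≡0)) primes (divisors-sorted N) primes∤1 (base₀ Z)))
      m≡ : size Z * modulus L ≡ modulus P * modulus M
      m≡ = trans (cong (_* modulus L) size-Z) (trans (ℤP.*-identityˡ (modulus L)) (modulus-++ P M))
      rhs : size Z * modulus L * ∑ (λ x → h N x * u Z x * sift L x) + size Z * modulus L * 2^ L * + T
          ≡ modulus P * modulus M * C₀ + modulus P * modulus M * (2^ P * 2^ M) * + T
      rhs = cong₂ _+_ (cong₂ _*_ m≡ (∑-cong (λ x → cong (_* sift L x) (trans (cong (h N x *_) (u-Z x)) (ℤP.*-identityʳ (h N x))))))
                      (cong₂ (λ a b → a * b * + T) m≡ (2^-++ P M))

    2^-length : ∀ L → 2^ L ≡ + (2 ℕ.^ length L)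
    2^-length []      = refl
    2^-length (_ ∷ L) = trans (cong (+ 2 *_) (2^-length L)) (sym (ℤP.pos-* 2 (2 ℕ.^ length L)))

    survivors-P>0 : ∀ ds → 0ℤ < survivors (map primeItem ds)
    survivors-P>0 []       = +<+ (ℕ.s≤s ℕ.z≤n)
    survivors-P>0 (d ∷ ds) = *-positive (subst (0ℤ <_) (sym (ℤP.⊖-≥ (ℕP.<⇒≤ 2≤r))) (+<+ (ℕP.m<n⇒0<n∸m 2≤r))) (survivors-P>0 ds)
      where 2≤r = ℕ.nonTrivial⇒n>1 (r d) {{prime⇒nonTrivial (prime d)}}

    -- Each prime satisfies r ≤ 2 (r - 1), so the product of r/(r - 1) is at most 2^ω.
    modulus-P≤ : ∀ ds → 0ℤ ≤ modulus (map primeItem ds) × modulus (map primeItem ds) ≤ 2^ (map primeItem ds) * survivors (map primeItem ds)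
    modulus-P≤ []       = +≤+ ℕ.z≤n , ≤-refl
    modulus-P≤ (d ∷ ds) with modulus-P≤ ds
    ... | 0≤m , m≤ = *-nonneg {+ r d} (+≤+ ℕ.z≤n) 0≤m , ≤-from-difference _ (ring (+ r d) m t φ)
          (+-nonneg (*-nonneg {+ r d} (+≤+ ℕ.z≤n) (difference m≤)) (*-nonneg (difference (+≤+ 2≤r)) (*-nonneg 0≤t (ℤP.<⇒≤ (survivors-P>0 ds)))))
      where
      2≤r = ℕ.nonTrivial⇒n>1 (r d) {{prime⇒nonTrivial (prime d)}}
      m = modulus (map primeItem ds)
      t = 2^ map primeItem ds
      φ = survivors (map primeItem ds)
      0≤t : 0ℤ ≤ t
      0≤t = subst (0ℤ ≤_) (sym (2^-length (map primeItem ds))) (+≤+ ℕ.z≤n)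
      ring : ∀ r m t φ → + 2 * t * ((r - 1ℤ) * φ) - r * m ≡ r * (t * φ - m) + (r - + 2) * (t * φ)
      ring = solve-∀

    ΣC : Weighted → ℤ
    ΣC []             = 0ℤ
    ΣC ((S , _) ∷ xs) = C S + ΣC xs

    U : Weighted → A → ℤ
    U []             x = 0ℤ
    U ((S , _) ∷ xs) x = u S x + U xs x

    ΣC-∑ : ∀ xs → ∑ (λ x → h N x * sift P x * U xs x) ≡ ΣC xs
    ΣC-∑ []             = ∑-0 (λ x → ℤP.*-zeroʳ (h N x * sift P x))
    ΣC-∑ ((S , _) ∷ xs) = trans (∑-cong (λ x → ring (h N x) (sift P x) (u S x) (U xs x))) (trans (∑-+ _ _) (cong (λ s → C S + s) (ΣC-∑ xs)))
      where
      ring : ∀ h s u U → h * s * (u + U) ≡ h * u * s + h * s * U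
      ring = solve-∀

    ΣC-upper : ∀ xs → All Dense xs → + Q * modulus P * ΣC xs ≤ + weight xs * (+ N * survivors P) + + length xs * (+ Q * modulus P * 2^ P * + T)
    ΣC-upper []             [] = ≤-reflexive (trans (ℤP.*-zeroʳ (+ Q * modulus P)) (ring (+ N * survivors P) (+ Q * modulus P * 2^ P * + T)))
      where
      ring : ∀ a b → 0ℤ ≡ 0ℤ * a + 0ℤ * b
      ring = solve-∀
    ΣC-upper ((S , w′) ∷ xs) (dense ∷ ds) = ≤-trans (≤-reflexive (ℤP.*-distribˡ-+ (+ Q * m) (C S) (ΣC xs)))
        (≤-trans (ℤP.+-mono-≤ one (ΣC-upper xs ds)) (≤-reflexive (ring′ (+ w′) (+ weight xs) Φ (+ length xs) (+ Q * m * t * + T))))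
      where
      m = modulus P
      t = 2^ P
      Φ = + N * survivors P
      D = m * C S - m * t * + T
      0≤Φ : 0ℤ ≤ Φ
      0≤Φ = *-nonneg {+ N} (+≤+ ℕ.z≤n) (ℤP.<⇒≤ (survivors-P>0 primes))
      ring₁ : ∀ s m c t T Φ → Φ + s * m * t * T - s * m * c ≡ Φ - s * (m * c - m * t * T)
      ring₁ = solve-∀
      sD≤Φ : size S * D ≤ Φ
      sD≤Φ = ℤP.0≤i-j⇒j≤i (subst (0ℤ ≤_) (ring₁ (size S) m (C S) t (+ T) Φ) (difference (C-upper S)))
      ring₂ : ∀ s w D → s * w * D ≡ w * (s * D)
      ring₂ = solve-∀
      -- Passing from |S| to Q/w needs the sign of `D`: for D ≥ 0 density gives Q D ≤ w |S| D, and
      -- for D ≤ 0 the right side is already nonnegative.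
      QD≤ : + Q * D ≤ + w′ * Φ
      QD≤ with ℤP.≤-total 0ℤ D
      ... | inj₁ 0≤D = ≤-trans (*-monoʳ 0≤D dense) (≤-trans (≤-reflexive (ring₂ (size S) (+ w′) D)) (*-monoˡ {+ w′} (+≤+ ℕ.z≤n) sD≤Φ))
      ... | inj₂ D≤0 = ≤-trans (*-monoˡ {+ Q} (+≤+ ℕ.z≤n) D≤0) (≤-trans (≤-reflexive (ℤP.*-zeroʳ (+ Q))) (*-nonneg {+ w′} (+≤+ ℕ.z≤n) 0≤Φ))
      ring₃ : ∀ Q m c t T wΦ → wΦ + Q * m * t * T - Q * m * c ≡ wΦ - Q * (m * c - m * t * T)
      ring₃ = solve-∀
      one : + Q * m * C S ≤ + w′ * Φ + + Q * m * t * + T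
      one = ≤-from-difference _ (ring₃ (+ Q) m (C S) t (+ T) (+ w′ * Φ)) (difference QD≤)
      ring′ : ∀ a b c d e → a * c + e + (b * c + d * e) ≡ (a + b) * c + (1ℤ + d) * e
      ring′ = solve-∀

    ind-01 : ∀ {A : Set} (d : Dec A) → ind d ≡ 0ℤ ⊎ ind d ≡ 1ℤ
    ind-01 (yes _) = inj₂ refl
    ind-01 (no _)  = inj₁ refl

    primeItems-indicator : All Indicator P
    primeItems-indicator = AllP.map⁺ (All.universal (λ d x → ind-01 (pow x (cofactor d) ≟ 1#)) primes)

    moduleItems-indicator : All Indicator M
    moduleItems-indicator = AllP.map⁺ (All.universal (λ y x → ind-01 (x ⟂? proj₁ (entry 1 n 1n≡n y))) ys)

    ind≡0⇒¬ : ∀ {A : Set} (d : Dec A) → ind d ≡ 0ℤ → ¬ A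
    ind≡0⇒¬ (no ¬a) _ = ¬a

    U-nonneg : ∀ xs x → 0ℤ ≤ U xs x
    U-nonneg []             x = ≤-refl
    U-nonneg ((S , _) ∷ xs) x = +-nonneg (0≤ind (x ⟂? S)) (U-nonneg xs x)

    U≤0⇒not-⟂ : ∀ xs x → U xs x ≤ 0ℤ → All (λ (S , _) → ¬ (x ⟂ S)) xs
    U≤0⇒not-⟂ []             x _ = []
    U≤0⇒not-⟂ ((S , _) ∷ xs) x U≤0 = ind≡0⇒¬ (x ⟂? S) (ℤP.≤-antisym (≤-trans u≤ U≤0) (0≤ind (x ⟂? S))) ∷ U≤0⇒not-⟂ xs x (≤-trans U≤ U≤0)
      where
      u≤ : u S x ≤ u S x + U xs x
      u≤ = subst (_≤ u S x + U xs x) (ℤP.+-identityʳ (u S x)) (ℤP.+-monoʳ-≤ (u S x) (U-nonneg xs x))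
      U≤ : U xs x ≤ u S x + U xs x
      U≤ = subst (_≤ u S x + U xs x) (ℤP.+-identityˡ (U xs x)) (ℤP.+-monoˡ-≤ (U xs x) (0≤ind (x ⟂? S)))

    Good : A → Set
    Good x = x ≢ 0# × (∀ r f → Prime r → f ℕ.* r ≡ N → pow x f ≢ 1#)
           × (∀ l m (eq : l ℕ.* m ≡ n) i → i ℕ.< m → ¬ SubfieldModules.Stable l m eq x i)

    -- The first two factors are 0 or 1, so both are 1 and the bracket is positive. As `sift M x` is
    -- at most 1 and `U` is a nonnegative integer, this forces the values 1 and 0.
    extract : ∀ x → 0ℤ < h N x * sift P x * (sift M x - U (bad n) x) → Good x
    extract x pos with ind-01 (pow x N ≟ 1#) | sift-01 primeItems-indicator x | sift-01 moduleItems-indicator x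
    ... | inj₁ h≡0 | _ | _ = contradiction pos (λ lt → ℤP.<-irrefl (sym (cong (λ s → s * sift P x * (sift M x - U (bad n) x)) h≡0)) lt)
    ... | inj₂ _ | inj₁ s≡0 | _ = contradiction pos (λ lt → ℤP.<-irrefl (sym (trans (cong (λ s → h N x * s * (sift M x - U (bad n) x)) s≡0) (cong (_* (sift M x - U (bad n) x)) (ℤP.*-zeroʳ (h N x))))) lt)
    ... | inj₂ h≡1 | inj₂ s≡1 | d = body d
      where
      pos′ : 0ℤ < sift M x - U (bad n) x
      pos′ = subst (0ℤ <_) (trans (cong₂ (λ a b → a * b * (sift M x - U (bad n) x)) h≡1 s≡1) (ℤP.*-identityˡ _)) pos
      x≢0 : x ≢ 0#
      x≢0 x≡0 = contradiction (trans (sym h≡1) (ind-no (pow x N ≟ 1#) (λ eq → pow≡1⇒≢0 1≤N eq x≡0))) (λ ())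
      maximal : ∀ r f → Prime r → f ℕ.* r ≡ N → pow x f ≢ 1#
      maximal s f pr eq xᶠ≡1 = go primes (AllP.map⁻ (sift≡1 primeItems-indicator x s≡1)) (divisors-complete N {s} {f} pr eq s≤N)
        where
        s≤N : s ℕ.≤ N
        s≤N = ∣⇒≤ {{ℕ.>-nonZero 1≤N}} (divides f (sym eq))
        go : ∀ ds → All (λ d → h (cofactor d) x ≡ 0ℤ) ds → ¬ Any (λ d → PrimeDivisor.r d ≡ s) ds
        go (d ∷ ds) (z ∷ _) (here refl) = ind≡0⇒¬ (pow x (cofactor d) ≟ 1#) z (trans (cong (pow x) (ℕP.*-cancelʳ-≡ (cofactor d) f s {{prime⇒nonZero pr}} (trans (factors d) (sym eq)))) xᶠ≡1)
        go (d ∷ ds) (_ ∷ zs) (there a) = go ds zs a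
      body : sift M x ≡ 0ℤ ⊎ sift M x ≡ 1ℤ → Good x
      body (inj₁ s≡0) = contradiction pos′ (ℤP.≤⇒≯ (≤-trans (≤-reflexive (cong (_- U (bad n) x) s≡0)) (≤-trans (≤-reflexive (ℤP.+-identityˡ _)) (ℤP.neg-mono-≤ (U-nonneg (bad n) x)))))
      body (inj₂ s≡1) = x≢0 , maximal , free
        where
        U≤0 : U (bad n) x ≤ 0ℤ
        U≤0 = ℤP.≮⇒≥ (λ 0<U → ℤP.<⇒≱ pos′ (≤-trans (≤-reflexive (cong (_- U (bad n) x) s≡1)) (ℤP.i≤j⇒i-j≤0 (ℤP.i<j⇒suc[i]≤j 0<U))))
        none₁ : All (λ (S , _) → ¬ (x ⟂ S)) (entries 1 n 1n≡n)
        none₁ = AllP.map⁺ (All.map (λ {y} → ind≡0⇒¬ (x ⟂? proj₁ (entry 1 n 1n≡n y))) (AllP.map⁻ (sift≡1 moduleItems-indicator x s≡1)))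
        free : ∀ l m (eq : l ℕ.* m ≡ n) i → i ℕ.< m → ¬ SubfieldModules.Stable l m eq x i
        free zero m eq = contradiction eq (ℕP.<⇒≢ 1≤n)
        free (suc zero) m eq = one m (trans (sym (ℕP.*-identityˡ m)) eq) eq
          where
          one : ∀ m → m ≡ n → (eq : 1 ℕ.* m ≡ n) → ∀ i → i ℕ.< m → ¬ SubfieldModules.Stable 1 m eq x i
          one m refl eq = subst (λ e → ∀ i → i ℕ.< n → ¬ SubfieldModules.Stable 1 n e x i) (ℕP.≡-irrelevant 1n≡n eq) (entries-complete 1 n 1n≡n x none₁)
        free (suc (suc l)) m eq = bad-complete x n (U≤0⇒not-⟂ (bad n) x U≤0) (suc (suc l)) m eq (ℕ.s≤s (ℕ.s≤s ℕ.z≤n)) (l≤n (suc (suc l)) m eq)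

    modulus-M>0 : ∀ ys → 0ℤ < modulus (map moduleItem ys)
    modulus-M>0 []       = +<+ (ℕ.s≤s ℕ.z≤n)
    modulus-M>0 (y ∷ ys) = *-positive (subst (0ℤ <_) (sym (SubfieldModules.cyclic-size 1 n 1n≡n y)) (+<+ (1≤qʲ (1 ℕ.* SubfieldModules.dim 1 n 1n≡n y)))) (modulus-M>0 ys)

    -- One factor 2^ω counts the subsets in the sieve, the other bounds the product of r/(r - 1)
    -- over the primes r dividing N.
    W : ℕ
    W = 2 ℕ.^ length primes ℕ.* 2 ℕ.^ length primes

    -- ρ/1000 bounds from below the proportion surviving the sieve for l = 1, and β/1000 from above what l ≥ 2 removes.
    exists-good : ∀ ρ β → + ρ * modulus M ≤ + 1000 * survivors M → 1000 ℕ.* weight (bad n) ℕ.≤ β ℕ.* Q → β ℕ.+ 100 ℕ.≤ ρ →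
                  10 ℕ.* W ℕ.* T ℕ.* (2 ℕ.^ n ℕ.+ n ℕ.* n) ℕ.< N → ∃ Good
    exists-good ρ β density few gap small = let (x , pos) = ∑-positive _ positive-sum in x , extract x pos
      where
      t≡ : 2^ P ≡ + (2 ℕ.^ length primes)
      t≡ = trans (2^-length P) (cong (λ z → + (2 ℕ.^ z)) (length-map primeItem primes))
      tt≡ : 2^ P * 2^ P ≡ + W
      tt≡ = trans (cong₂ _*_ t≡ t≡) (sym (ℤP.pos-* (2 ℕ.^ length primes) _))
      tM≡ : 2^ M ≡ + (2 ℕ.^ length ys)
      tM≡ = trans (2^-length M) (cong (λ z → + (2 ℕ.^ z)) (length-map moduleItem ys))
      Err : ℕ
      Err = 10 ℕ.* W ℕ.* T ℕ.* (2 ℕ.^ length ys ℕ.+ length (bad n))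
      Err≡ : + 10 * (2^ P * 2^ P) * + T * (2^ M + + length (bad n)) ≡ + Err
      Err≡ = trans (cong₂ (λ a b → + 10 * a * + T * (b + + length (bad n))) tt≡ tM≡)
        (trans (cong₂ (λ a b → a * + T * b) (sym (ℤP.pos-* 10 W)) (sym (ℤP.pos-+ (2 ℕ.^ length ys) _)))
          (trans (cong (_* + (2 ℕ.^ length ys ℕ.+ length (bad n))) (sym (ℤP.pos-* (10 ℕ.* W) T))) (sym (ℤP.pos-* (10 ℕ.* W ℕ.* T) _))))
      Err<N : Err ℕ.< N
      Err<N = ℕP.≤-<-trans (ℕP.*-monoʳ-≤ (10 ℕ.* W ℕ.* T) (ℕP.+-mono-≤ (ℕP.^-monoʳ-≤ 2 (generators-length 1 n 1n≡n)) (bad-length n))) small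
      0≤2^ : ∀ L → 0ℤ ≤ 2^ L
      0≤2^ L = subst (0ℤ ≤_) (sym (2^-length L)) (+≤+ ℕ.z≤n)
      gap₀ : 0ℤ < C₀ - ΣC (bad n)
      gap₀ = combine {wt = + weight (bad n)} {len = + length (bad n)} {ρ = + ρ} {β = + β}
        (+<+ (ℕP.≤-trans (ℕ.s≤s ℕ.z≤n) (ℕP.≤-reflexive (sym Q≡1+N)))) (survivors-P>0 primes) (+≤+ ℕ.z≤n) (modulus-M>0 ys) (proj₁ (modulus-P≤ primes))
        (0≤2^ P) (0≤2^ M) (+≤+ ℕ.z≤n) (+≤+ ℕ.z≤n)
        C₀-lower density (ΣC-upper (bad n) (bad-dense n))
        (pos-*-≤ 1000 (weight (bad n)) β Q few)
        (subst (_≤ + ρ) (ℤP.pos-+ β 100) (+≤+ gap))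
        (proj₂ (modulus-P≤ primes))
        (subst (_< + N) (sym Err≡) (+<+ Err<N))
      ring : ∀ h s m U → h * s * (m - U) ≡ h * (s * m) + - 1ℤ * (h * s * U)
      ring = solve-∀
      positive-sum : 0ℤ < ∑ (λ x → h N x * sift P x * (sift M x - U (bad n) x))
      positive-sum = subst (0ℤ <_) (sym (trans (∑-cong (λ x → trans (ring (h N x) (sift P x) (sift M x) (U (bad n) x)) (cong (λ s → h N x * s + - 1ℤ * (h N x * sift P x * U (bad n) x)) (sym (sift-++ P M x)))))
        (trans (∑-+ _ _) (cong (λ s → C₀ + s) (trans (∑-*ˡ (- 1ℤ) _) (trans (cong (- 1ℤ *_) (ΣC-∑ (bad n))) (ℤP.-1*i≡-i (ΣC (bad n))))))))) gap₀

  -- Numerical densities in the two ranges of n.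

  module Conclusion (t : ℕ) (1+n≤2t : suc n ℕ.≤ t ℕ.+ t) (2t≤2+n : t ℕ.+ t ℕ.≤ suc (suc n))
                    (g : ℕ) (g≡gcd : g ≡ gcd n (q ℕ.∸ 1)) where
    T : ℕ
    T = q ℕ.^ t

    qQ≤TT : q ℕ.* Q ℕ.≤ T ℕ.* T
    qQ≤TT = ℕP.≤-trans (ℕP.≤-reflexive (cong (q ℕ.*_) Q≡qⁿ)) (ℕP.≤-trans (q^-mono 1+n≤2t) (ℕP.≤-reflexive (ℕP.^-distribˡ-+-* q t t)))

    open FinalInequality
    open Counting T qQ≤TT
    open PrimeDivisors N 1≤N
    open Sieve {Q} (+ N) (+ T)
    open SieveDensity {Q} (+ N) (+ T)
    open SubfieldModules 1 n (ℕP.*-identityˡ n)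
    open Decomposition decomposition

    Mo Ml : List Item
    Mo = map moduleItem others
    Ml = map moduleItem lines

    g∣n : g ∣ n
    g∣n = subst (_∣ n) (sym g≡gcd) (gcd[m,n]∣m n (q ℕ.∸ 1))

    g∣q-1 : g ∣ (q ℕ.∸ 1)
    g∣q-1 = subst (_∣ (q ℕ.∸ 1)) (sym g≡gcd) (gcd[m,n]∣n n (q ℕ.∸ 1))

    lines-≤g : length Ml ℕ.≤ g
    lines-≤g = ℕP.≤-trans (ℕP.≤-reflexive (length-map moduleItem lines)) (Lines.lines-≤ g g≡gcd decomposition)

    g≤q-1 : g ℕ.≤ q ℕ.∸ 1
    g≤q-1 = ∣⇒≤ {{ℕ.>-nonZero (ℕP.m<n⇒0<n∸m 2≤q)}} g∣q-1

    others-≤ : 2 ℕ.* length Mo ℕ.≤ n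
    others-≤ = ℕP.≤-trans (ℕP.≤-reflexive (cong (2 ℕ.*_) (length-map moduleItem others))) (ℕP.≤-trans (ℕP.m≤n+m _ (length lines)) (dims-split decomposition))

    1≤qq : 1 ℕ.≤ q ℕ.* q
    1≤qq = ℕP.*-mono-≤ 1≤q 1≤q

    item-large : ∀ a {y} → a ℕ.≤ dim y → + (q ℕ.^ a) ≤ proj₂ (moduleItem y)
    item-large a {y} h = ≤-trans (+≤+ (q^-mono (ℕP.≤-trans h (ℕP.≤-reflexive (sym (ℕP.*-identityˡ (dim y))))))) (≤-reflexive (sym (cyclic-size y)))

    lines-large : All (Large q 1≤q) Ml
    lines-large = AllP.map⁺ (All.map (λ {y} d≡1 → subst (λ z → + z ≤ proj₂ (moduleItem y)) (ℕP.*-identityʳ q) (item-large 1 (ℕP.≤-reflexive (sym d≡1)))) lines-dim)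

    others-large : All (Large (q ℕ.* q) 1≤qq) Mo
    others-large = AllP.map⁺ (All.map (λ {y} 2≤d → subst (λ z → + z ≤ proj₂ (moduleItem y)) (cong (q ℕ.*_) (ℕP.*-identityʳ q)) (item-large 2 2≤d)) others-dim)

    M≡ : map moduleItem ys ≡ Mo ++ Ml
    M≡ = map-++ moduleItem others lines

    0≤sO = survivors-nonneg (q ℕ.* q) 1≤qq others-large
    0≤mO = modulus-nonneg (q ℕ.* q) 1≤qq others-large
    0≤sL = survivors-nonneg q 1≤q lines-large
    0≤mL = modulus-nonneg q 1≤q lines-large

    density : ∀ ρ → + ρ * (modulus Mo * modulus Ml) ≤ + 1000 * (survivors Mo * survivors Ml) →
              + ρ * modulus (map moduleItem ys) ≤ + 1000 * survivors (map moduleItem ys)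
    density ρ h = subst (λ L → + ρ * modulus L ≤ + 1000 * survivors L) (sym M≡)
      (≤-trans (≤-reflexive (cong (+ ρ *_) (modulus-++ Mo Ml))) (≤-trans h (≤-reflexive (cong (+ 1000 *_) (sym (survivors-++ Mo Ml))))))

    density₁ : n ℕ.≤ q ℕ.* q → + 125 * modulus (map moduleItem ys) ≤ + 1000 * survivors (map moduleItem ys)
    density₁ n≤qq = density 125 (product-density₁ 0≤mL 0≤sO (half (q ℕ.* q) 1≤qq others-large (ℕP.≤-trans others-≤ n≤qq))
      (quarter q 1≤q lines-large (ℕP.≤-trans (ℕ.s≤s (ℕP.≤-trans lines-≤g g≤q-1)) (ℕP.≤-reflexive (ℕP.m+[n∸m]≡n 1≤q)))))

    -- The gcd g divides q - 1 and also n, so it is a proper divisor of q - 1 and the cofactor is at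
    -- least 2.
    2g≤q-1 : ¬ ((q ℕ.∸ 1) ∣ n) → 2 ℕ.* g ℕ.≤ q ℕ.∸ 1
    2g≤q-1 ∤ = go g∣q-1
      where
      go : g ∣ (q ℕ.∸ 1) → 2 ℕ.* g ℕ.≤ q ℕ.∸ 1
      go (divides zero eq)          = contradiction (subst (1 ℕ.≤_) eq (ℕP.m<n⇒0<n∸m 2≤q)) (λ ())
      go (divides (suc zero) eq)    = contradiction (subst (_∣ n) (sym (trans eq (ℕP.*-identityˡ g))) g∣n) ∤
      go (divides (suc (suc c)) eq) = ℕP.≤-trans (ℕP.*-monoˡ-≤ g (ℕ.s≤s (ℕ.s≤s (ℕ.z≤n {c})))) (ℕP.≤-reflexive (sym eq))

    others-density₂ : 100 ℕ.* n ℕ.≤ 43 ℕ.* (q ℕ.* q) → + 785 * modulus Mo ≤ + 1000 * survivors Mo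
    others-density₂ range = scaled-bernoulli (+ (q ℕ.* q)) (survivors Mo) (modulus Mo) (+ length Mo) (+<+ 1≤qq) 0≤mO
        (bernoulli (q ℕ.* q) 1≤qq others-large)
        (pos-*-≤ 200 (length Mo) 43 (q ℕ.* q) (ℕP.≤-trans (ℕP.≤-trans (ℕP.≤-reflexive (ℕP.*-assoc 100 2 (length Mo))) (ℕP.*-monoʳ-≤ 100 others-≤)) range))

    density₂ : ¬ ((q ℕ.∸ 1) ∣ n) → 100 ℕ.* n ℕ.≤ 43 ℕ.* (q ℕ.* q) → + 392 * modulus (map moduleItem ys) ≤ + 1000 * survivors (map moduleItem ys)
    density₂ ∤ range = density 392 (product-density₂ 0≤mO 0≤mL 0≤sO (others-density₂ range)
      (half q 1≤q lines-large (ℕP.≤-trans (ℕP.*-monoʳ-≤ 2 lines-≤g) (ℕP.≤-trans (2g≤q-1 ∤) (ℕP.m∸n≤m q 1)))))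

    module _ (2≤n : 2 ℕ.≤ n) (1000≤q-1 : 1000 ℕ.≤ q ℕ.∸ 1) where
      private
        rr = q ℕ.∸ 1
        Wn = weight (bad n)
        W₂ = weight (bad 2)
        X = q ℕ.^ (n ℕ.∸ 2)

        qqX≡Q : q ℕ.* q ℕ.* X ≡ Q
        qqX≡Q = trans (cong (ℕ._* X) (cong (q ℕ.*_) (sym (ℕP.*-identityʳ q)))) (trans (sym (ℕP.^-distribˡ-+-* q 2 (n ℕ.∸ 2))) (trans (cong (q ℕ.^_) (ℕP.m+[n∸m]≡n 2≤n)) (sym Q≡qⁿ)))

        bound : n ℕ.≤ q ℕ.* q → rr ℕ.* Wn ℕ.≤ rr ℕ.* W₂ ℕ.+ Q
        bound n≤qq = ℕP.≤-trans (ℕP.m≤m+n _ _) (ℕP.≤-trans (weight-bound n 2≤n ℕP.≤-refl) (ℕP.+-monoʳ-≤ (rr ℕ.* W₂) (ℕP.≤-trans (ℕP.*-monoˡ-≤ X n≤qq) (ℕP.≤-reflexive qqX≡Q))))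

      -- For odd n nothing comes from l = 2, and the tail is at most Q/(q - 1) ≤ Q/1000.
      few₁ : ¬ (2 ∣ n) → n ℕ.≤ q ℕ.* q → 1000 ℕ.* Wn ℕ.≤ 1 ℕ.* Q
      few₁ odd n≤qq = ℕP.≤-trans (ℕP.*-monoˡ-≤ Wn 1000≤q-1) (ℕP.≤-trans (bound n≤qq) (ℕP.≤-reflexive (trans (cong (λ z → rr ℕ.* z ℕ.+ Q) (weight-2-odd odd)) (trans (cong (ℕ._+ Q) (ℕP.*-zeroʳ rr)) (sym (ℕP.*-identityˡ Q))))))

      -- Of the 216 thousandths, 215 = 1000 · 0.43/2 come from l = 2 and the remaining one from the
      -- tail Q/(q - 1).
      few₂ : n ℕ.≤ q ℕ.* q → 100 ℕ.* n ℕ.≤ 43 ℕ.* (q ℕ.* q) → 1000 ℕ.* Wn ℕ.≤ 216 ℕ.* Q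
      few₂ n≤qq range = ℕP.*-cancelˡ-≤ rr {{ℕ.>-nonZero (ℕP.≤-trans (ℕP.≤ᵇ⇒≤ 1 1000 tt) 1000≤q-1)}} (begin
          rr ℕ.* (1000 ℕ.* Wn)  ≡⟨ swap rr 1000 Wn ⟩
          1000 ℕ.* (rr ℕ.* Wn)  ≤⟨ ℕP.*-monoʳ-≤ 1000 (bound n≤qq) ⟩
          1000 ℕ.* (rr ℕ.* W₂ ℕ.+ Q)  ≡⟨ trans (ℕP.*-distribˡ-+ 1000 (rr ℕ.* W₂) Q) (cong (ℕ._+ 1000 ℕ.* Q) (swap 1000 rr W₂)) ⟩
          rr ℕ.* (1000 ℕ.* W₂) ℕ.+ 1000 ℕ.* Q  ≤⟨ ℕP.+-mono-≤ (ℕP.*-monoʳ-≤ rr 1000W₂≤) (ℕP.*-monoˡ-≤ Q 1000≤q-1) ⟩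
          rr ℕ.* (215 ℕ.* Q) ℕ.+ rr ℕ.* Q  ≡⟨ ℕP.*-distribˡ-+ rr (215 ℕ.* Q) Q ⟨
          rr ℕ.* (215 ℕ.* Q ℕ.+ Q)  ≡⟨ cong (rr ℕ.*_) (ℕP.+-comm (215 ℕ.* Q) Q) ⟩
          rr ℕ.* (216 ℕ.* Q)  ∎)
        where
        open ℕP.≤-Reasoning
        swap : ∀ a b c → a ℕ.* (b ℕ.* c) ≡ b ℕ.* (a ℕ.* c)
        swap a b c = trans (sym (ℕP.*-assoc a b c)) (trans (cong (ℕ._* c) (ℕP.*-comm a b)) (ℕP.*-assoc b a c))
        200W₂≤ : 200 ℕ.* W₂ ℕ.≤ 43 ℕ.* Q
        200W₂≤ = begin
          200 ℕ.* W₂  ≡⟨ ℕP.*-assoc 100 2 W₂ ⟩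
          100 ℕ.* (2 ℕ.* W₂)  ≤⟨ ℕP.*-monoʳ-≤ 100 weight-2 ⟩
          100 ℕ.* (n ℕ.* X)  ≡⟨ ℕP.*-assoc 100 n X ⟨
          100 ℕ.* n ℕ.* X  ≤⟨ ℕP.*-monoˡ-≤ X range ⟩
          43 ℕ.* (q ℕ.* q) ℕ.* X  ≡⟨ ℕP.*-assoc 43 (q ℕ.* q) X ⟩
          43 ℕ.* (q ℕ.* q ℕ.* X)  ≡⟨ cong (43 ℕ.*_) qqX≡Q ⟩
          43 ℕ.* Q  ∎
        1000W₂≤ : 1000 ℕ.* W₂ ℕ.≤ 215 ℕ.* Q
        1000W₂≤ = ℕP.≤-trans (ℕP.≤-reflexive (ℕP.*-assoc 5 200 W₂)) (ℕP.≤-trans (ℕP.*-monoʳ-≤ 5 200W₂≤) (ℕP.≤-reflexive (sym (ℕP.*-assoc 5 43 Q))))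

    -- A variable in place of 256 keeps powers such as `B ^ B` symbolic.
    module _ (B : ℕ) (B≡256 : B ≡ 256) where
      private
        ω = length primes
        x = 2 ℕ.^ ω

      -- The fourth power of 4^ω is 256^ω, which is where the base 256 comes from.
      W⁴≤ : W ℕ.^ 4 ℕ.≤ B ℕ.^ B ℕ.* Q
      W⁴≤ = begin
        (x ℕ.* x) ℕ.^ 4  ≡⟨ square^4≡^8 x ⟩
        x ℕ.^ 8  ≡⟨ trans (ℕP.^-*-assoc 2 ω 8) (trans (cong (2 ℕ.^_) (ℕP.*-comm ω 8)) (sym (ℕP.^-*-assoc 2 8 ω))) ⟩
        256 ℕ.^ ω  ≡⟨ cong (ℕ._^ ω) B≡256 ⟨
        B ℕ.^ ω  ≤⟨ few-divisors B (subst (1 ℕ.≤_) (sym B≡256) (ℕ.s≤s ℕ.z≤n)) N ⟩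
        B ℕ.^ B ℕ.* radical primes  ≤⟨ ℕP.*-monoʳ-≤ (B ℕ.^ B) (ℕP.≤-trans (radical-≤ N) (ℕP.m∸n≤m Q 1)) ⟩
        B ℕ.^ B ℕ.* Q  ∎
        where
        open ℕP.≤-Reasoning

      small : 1048576 ℕ.≤ q → q ℕ.≤ n → 10 ℕ.* W ℕ.* T ℕ.* (2 ℕ.^ n ℕ.+ n ℕ.* n) ℕ.< N
      -- Here 10 is the factor from `combine`; 18 fits because (2 · 10)^4 = 160000 ≤ 2^18, 20
      -- because q ≥ 2^20, and 8 B because 256^B = 2^(8 B).
      small big q≤n = ErrorTerm.error-small q n Q T W t (B ℕ.^ B) 10 20 18 (8 ℕ.* B) i big n≡4+i Q≡qⁿ refl
          (ℕP.≤-trans (ℕP.≤-reflexive (cong (t ℕ.+_) (ℕP.+-identityʳ t))) (ℕP.≤-trans 2t≤2+n (ℕP.≤-reflexive (ℕP.+-comm 2 n))))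
          (ℕP.*-mono-≤ (ℕP.m^n>0 2 ω) (ℕP.m^n>0 2 ω)) W⁴≤ (ℕ.s≤s ℕ.z≤n) (ℕP.≤ᵇ⇒≤ 160000 262144 tt)
          (ℕP.≤-reflexive (trans (cong (ℕ._^ B) B≡256) (ℕP.^-*-assoc 2 8 B)))
          (subst (λ n → 18 ℕ.+ 8 ℕ.* B ℕ.+ (n ℕ.+ 1) ℕ.* 4 ℕ.< 20 ℕ.* i) (sym n≡4+i) (exponent-inequality B i B≡256 1000≤i))
        where
        i = n ℕ.∸ 4
        1004≤n : 1004 ℕ.≤ n
        1004≤n = ℕP.≤-trans (ℕP.≤ᵇ⇒≤ 1004 1048576 tt) (ℕP.≤-trans big q≤n)
        n≡4+i : n ≡ 4 ℕ.+ i
        n≡4+i = sym (ℕP.m+[n∸m]≡n (ℕP.≤-trans (ℕP.≤ᵇ⇒≤ 4 1004 tt) 1004≤n))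
        1000≤i : 1000 ℕ.≤ i
        1000≤i = ℕP.∸-monoˡ-≤ {1004} {n} 4 1004≤n

    -- Case (1): 1/4 · 1/2 = 125/1000 against O(1/q). Case (2): 1/2 · (1 - 0.43/2) ≥ 392/1000 against 0.43/2 + O(1/q) ≤ 216/1000.
    conclusion : 1048576 ℕ.≤ q → Range q n → ∃ Good
    conclusion big (inj₁ (odd , q≤n , n≤qq)) =
      exists-good 125 1 (density₁ n≤qq) (few₁ (ℕP.≤-trans 2≤q q≤n) (ℕP.∸-monoˡ-≤ {1001} {q} 1 (ℕP.≤-trans (ℕP.≤ᵇ⇒≤ 1001 1048576 tt) big)) odd n≤qq)
        (ℕP.≤ᵇ⇒≤ 101 125 tt) (small 256 refl big q≤n)
    conclusion big (inj₂ (_ , ∤ , q≤n , range)) =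
      exists-good 392 216 (density₂ ∤ range) (few₂ (ℕP.≤-trans 2≤q q≤n) (ℕP.∸-monoˡ-≤ {1001} {q} 1 (ℕP.≤-trans (ℕP.≤ᵇ⇒≤ 1001 1048576 tt) big)) n≤qq range)
        (ℕP.≤ᵇ⇒≤ 316 392 tt) (small 256 refl big q≤n)
      where
      n≤qq : n ℕ.≤ q ℕ.* q
      n≤qq = ℕP.*-cancelˡ-≤ 100 (ℕP.≤-trans range (ℕP.*-monoˡ-≤ (q ℕ.* q) (ℕP.≤ᵇ⇒≤ 43 100 tt)))

open import Defs

-- Transfer to arbitrary finite fields.

module Transport {Q : ℕ} (𝔽 : FiniteField Q) where
  private
    module 𝔽 = FiniteField 𝔽
  open 𝔽 using (Carrier; _≈_)
  open Inverse 𝔽.count using (to; from; to-cong; strictlyInverseˡ; strictlyInverseʳ)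

  -- The operations are moved along the enumeration of the field; the ring laws then come back
  -- through the monomorphism `from`.
  rawRing : RawRing 0ℓ 0ℓ
  rawRing = record
    { Carrier = Fin Q ; _≈_ = _≡_
    ; _+_ = λ x y → to (from x 𝔽.+ from y) ; _*_ = λ x y → to (from x 𝔽.* from y)
    ; -_ = λ x → to (𝔽.- from x) ; 0# = to 𝔽.0# ; 1# = to 𝔽.1# }

  from-injective : ∀ {x y} → from x ≈ from y → x ≡ y
  from-injective {x} {y} eq = trans (sym (strictlyInverseˡ x)) (trans (to-cong eq) (strictlyInverseˡ y))

  monomorphism : IsRingMonomorphism rawRing 𝔽.rawRing from
  monomorphism = record
    { isRingHomomorphism = record
      { isSemiringHomomorphism = record
        { isNearSemiringHomomorphism = record
          { +-isMonoidHomomorphism = record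
            { isMagmaHomomorphism = record
              { isRelHomomorphism = record { cong = λ { refl → 𝔽.refl } }
              ; homo = λ _ _ → strictlyInverseʳ _ }
            ; ε-homo = strictlyInverseʳ _ }
          ; *-homo = λ _ _ → strictlyInverseʳ _ }
        ; 1#-homo = strictlyInverseʳ _ }
      ; -‿homo = λ _ → strictlyInverseʳ _ }
    ; injective = from-injective }

  F : FinField Q
  F = record
    { _⊕_ = _ ; _⊗_ = _ ; ⊖_ = _ ; 0# = _ ; 1# = _
    ; isCommutativeRing = Algebra.Morphism.RingMonomorphism.isCommutativeRing monomorphism 𝔽.isCommutativeRing
    ; 1≢0 = λ eq → 𝔽.1≉0 (𝔽.trans (𝔽.sym (strictlyInverseʳ 𝔽.1#)) (𝔽.trans (𝔽.reflexive (cong from eq)) (strictlyInverseʳ 𝔽.0#)))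
    ; inverse = λ x x≢0 → let (y , xy≈1) = 𝔽.inverse (from x) (λ eq → x≢0 (trans (sym (strictlyInverseˡ x)) (to-cong eq))) in
        to y , to-cong (𝔽.trans (𝔽.*-congˡ (strictlyInverseʳ y)) xy≈1) }

  open FieldBasics F using (A; _⊕_; _⊗_; 0#; 1#; _≟_) renaming (pow to pow′)

  from-pow : ∀ x k → from (pow′ x k) ≈ pow 𝔽 (from x) k
  from-pow x zero    = strictlyInverseʳ _
  from-pow x (suc k) = 𝔽.trans (strictlyInverseʳ _) (𝔽.*-congˡ (from-pow x k))

  pow-cong : ∀ {x y} k → x ≈ y → pow 𝔽 x k ≈ pow 𝔽 y k
  pow-cong zero    eq = 𝔽.refl
  pow-cong (suc k) eq = 𝔽.*-cong eq (pow-cong k eq)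

  to-pow : ∀ y k → pow′ (to y) k ≡ to (pow 𝔽 y k)
  to-pow y k = trans (sym (strictlyInverseˡ _)) (to-cong (𝔽.trans (from-pow (to y) k) (pow-cong k (strictlyInverseʳ y))))

  from≈0⇒≡0 : ∀ {x} → from x ≈ 𝔽.0# → x ≡ 0#
  from≈0⇒≡0 {x} eq = trans (sym (strictlyInverseˡ x)) (to-cong eq)

  to≡0⇒≈0 : ∀ {y} → to y ≡ 0# → y ≈ 𝔽.0#
  to≡0⇒≈0 {y} eq = 𝔽.trans (𝔽.sym (strictlyInverseʳ y)) (𝔽.trans (𝔽.reflexive (cong from eq)) (strictlyInverseʳ 𝔽.0#))

  module _ (p k q n : ℕ) (p-prime : Prime p) (q≡pᵏ : q ≡ p ℕ.^ k) (Q≡qⁿ : Q ≡ q ℕ.^ n) (1≤n : 1 ℕ.≤ n) (2≤q : 2 ℕ.≤ q) where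
    open FrobeniusField F p k q n p-prime q≡pᵏ Q≡qⁿ 1≤n 2≤q using (sumN; sumN-suc; InK; K-0#; module SubfieldModules)

    from-sumN : ∀ m (f : Fin m → Carrier) (g : ℕ → A) → (∀ i → f i ≈ from (g (Fin.toℕ i))) → sumF 𝔽 m f ≈ from (sumN m g)
    from-sumN zero    f g eq = 𝔽.sym (strictlyInverseʳ _)
    from-sumN (suc m) f g eq = 𝔽.trans (𝔽.+-cong (eq Fin.zero) (from-sumN m (f ∘ Fin.suc) (g ∘ suc) (eq ∘ Fin.suc)))
      (𝔽.trans (𝔽.sym (strictlyInverseʳ _)) (𝔽.reflexive (cong from (sym (sumN-suc m g)))))

    from-primitive : ∀ x → x ≢ 0# → (∀ r f → Prime r → f ℕ.* r ≡ FieldBasics.N F → pow′ x f ≢ 1#) → Primitive 𝔽 (from x)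
    from-primitive x x≢0 maximal = (λ eq → x≢0 (from≈0⇒≡0 eq)) , λ y y≉0 →
      let (j , eq) = MultiplicativeGroup.generates F x x≢0 maximal (to y) (λ e → y≉0 (to≡0⇒≈0 e)) in
      j , 𝔽.trans (𝔽.sym (from-pow x j)) (𝔽.trans (𝔽.reflexive (cong from eq)) (strictlyInverseʳ y))

    module _ (l m : ℕ) (lm≡n : l ℕ.* m ≡ n) where
      open SubfieldModules l m lm≡n using (Stable; frobₗ; span-everything; linearly-independent; span-sumN)

      from-normal : ∀ x → (∀ i → i ℕ.< m → ¬ Stable x i) → NormalOver 𝔽 q l m (from x)
      from-normal x free = independent , spanning
        where
        term : ∀ (a : Fin m → Carrier) (b : ℕ → A) → (∀ i → a i ≈ from (b (Fin.toℕ i))) → ∀ i →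
               a i 𝔽.* pow 𝔽 (from x) (q ℕ.^ (l ℕ.* Fin.toℕ i)) ≈ from (b (Fin.toℕ i) ⊗ frobₗ (Fin.toℕ i) x)
        term a b ab i = 𝔽.trans (𝔽.*-cong (ab i) (𝔽.sym (from-pow x (q ℕ.^ (l ℕ.* Fin.toℕ i))))) (𝔽.sym (strictlyInverseʳ _))

        independent : (a : Fin m → Carrier) → (∀ i → InSubfield 𝔽 q l (a i)) →
                      sumF 𝔽 m (λ i → a i 𝔽.* pow 𝔽 (from x) (q ℕ.^ (l ℕ.* Fin.toℕ i))) ≈ 𝔽.0# → ∀ i → a i ≈ 𝔽.0#
        independent a ka sum≈0 i = to≡0⇒≈0 (trans (sym (at i)) (linearly-independent x free m ℕP.≤-refl b kb
            (from≈0⇒≡0 (𝔽.trans (𝔽.sym (from-sumN m _ _ (term a b (λ i → 𝔽.trans (𝔽.sym (strictlyInverseʳ (a i))) (𝔽.reflexive (cong from (sym (at i)))))))) sum≈0))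
            (Fin.toℕ i) (FinP.toℕ<n i)))
          where
          -- A finite coefficient family is continued to all of ℕ by 0, which lies in every K_l and
          -- sits beyond the range of the sum.
          extend : ∀ j → Dec (j ℕ.< m) → A
          extend j (yes j<m) = to (a (Fin.fromℕ< j<m))
          extend j (no _)    = 0#
          b : ℕ → A
          b j = extend j (j ℕP.<? m)
          kb : ∀ j → InK l (b j)
          kb j with j ℕP.<? m
          ... | yes j<m = trans (to-pow (a (Fin.fromℕ< j<m)) (q ℕ.^ l)) (to-cong (ka (Fin.fromℕ< j<m)))
          ... | no _    = K-0# {l}
          at : ∀ i → b (Fin.toℕ i) ≡ to (a i)
          at i with Fin.toℕ i ℕP.<? m
          ... | yes i<m = cong (λ j → to (a j)) (FinP.fromℕ<-toℕ i i<m)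
          ... | no i≮m  = contradiction (FinP.toℕ<n i) i≮m

        spanning : ∀ y → ∃ λ (a : Fin m → Carrier) → (∀ i → InSubfield 𝔽 q l (a i)) ×
                   (sumF 𝔽 m (λ i → a i 𝔽.* pow 𝔽 (from x) (q ℕ.^ (l ℕ.* Fin.toℕ i))) ≈ y)
        spanning y = let (b , kb , eq) = span-sumN x m (span-everything x free (to y)) in
            (λ i → from (b (Fin.toℕ i)))
          , (λ i → 𝔽.trans (𝔽.sym (from-pow (b (Fin.toℕ i)) (q ℕ.^ l))) (𝔽.reflexive (cong from (kb (Fin.toℕ i)))))
          , 𝔽.trans (from-sumN m _ _ (term (λ i → from (b (Fin.toℕ i))) b (λ i → 𝔽.refl))) (𝔽.trans (𝔽.reflexive (cong from eq)) (strictlyInverseʳ y))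

open import Data.Nat using (_≤_; _*_; _^_; _∸_)

theorem2 : Σ ℕ λ c → 1 ≤ c ×
    ((q n : ℕ) → IsPrimePower q → c ≤ q → 1 ≤ n →
    ((¬ (2 ∣ n) × q ≤ n × n ≤ q * q)
    ⊎ (2 ∣ n × ¬ ((q ∸ 1) ∣ n) × q ≤ n × 100 * n ≤ 43 * (q * q))) →
    (F : FiniteField (q ^ n)) →
    ∃ λ x → Primitive F x × CompletelyNormal F q n x)
-- The constant is 2^20. The densities in thousandths rely on q - 1 ≥ 1000; the error term relies on
-- q ≥ 2^20, by which each factor q of Q outweighs the factor 2^4 that 2^(n+1) contributes under
-- fourth powers.
theorem2 = 1048576 , ℕP.≤ᵇ⇒≤ 1 1048576 tt , λ q n (p , k , p-prime , _ , q≡pᵏ) big 1≤n range 𝔽 →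
  let open Transport 𝔽
      2≤q = ℕP.≤-trans (ℕP.≤ᵇ⇒≤ 2 1048576 tt) big
      (t , 1+n≤2t , 2t≤2+n) = ceil-half (suc n)
      (x , x≢0 , maximal , free) = FrobeniusField.Conclusion.conclusion F p k q n p-prime q≡pᵏ refl 1≤n 2≤q t 1+n≤2t 2t≤2+n (gcd n (q ∸ 1)) refl big range
  in Inverse.from (FiniteField.count 𝔽) x , from-primitive p k q n p-prime q≡pᵏ refl 1≤n 2≤q x x≢0 maximal ,
     λ l m lm≡n → from-normal p k q n p-prime q≡pᵏ refl 1≤n 2≤q l m lm≡n x (free l m lm≡n)
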